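{- If $\kappa$ is an uncountable cardinal which is $\kappa$-compact, then $\kappa$ is a non-Galvin cardinal.
   Context: $\kappa$ is $\kappa$-compact if every $\kappa$-complete filter on $\kappa$ can be extended to a $\kappa$-complete ultrafilter on $\kappa$. $\kappa$ is a non-Galvin cardinal if there are elementary embeddings $j:V\to M$, $i:V\to N$, $k:N\to M$ (with $M,N$ transitive inner models) such that: (1) $k\circ i=j$; (2) the critical point of $j$ is $\kappa$ and the critical point of $k$ is $i(\kappa)$; (3) ${}^\kappa N\subseteq N$ and ${}^\kappa M\subseteq M$; (4) there is $A\in M$ such that $\{i(\alpha)\mid\alpha<\kappa^+\}\subseteq A$ and $M\models|A|<i(\kappa)$.
   Formalization: The cardinal κ is additionally assumed to be regular; for singular κ every κ-complete filter on κ is principal, so κ would be κ-compact trivially, while a non-Galvin cardinal is a critical point and hence regular. -}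

module Defs where

open import Level using (Level; suc)
open import Data.Nat.Base as ℕ using (ℕ)
open import Data.Fin.Base using (Fin)
open import Data.Vec.Base using (Vec; _∷_; lookup; map)
open import Data.Vec.Relation.Unary.All using (All)
open import Data.Product.Base using (Σ; ∃-syntax; Σ-syntax; _×_)
open import Data.Sum.Base using (_⊎_)
open import Data.Empty.Polymorphic using (⊥)
open import Data.Unit.Polymorphic using (⊤)
open import Function.Bundles using (_⇔_)
open import Relation.Nullary using (¬_)
open import Relation.Binary.PropositionalEquality.Core using (_≡_; _≢_)

-- First-order formulas of the language {∈} with n free variables (de Bruijn).
-- Conjunction, disjunction and ∃ are the usual classical abbreviations, which
-- is adequate because satisfaction is only used under excluded middle.
data Formula (n : ℕ) : Set where
  _≐_ _∈̇_ : Fin n → Fin n → Formula n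
  ⊥̇       : Formula n
  _⇒̇_     : Formula n → Formula n → Formula n
  ∀̇_      : Formula (ℕ.suc n) → Formula n

-- Everything is stated over an arbitrary first-order structure (V , ∈), on
-- which ZFC is imposed as a hypothesis.  "Set" means element of V.
module SetTheory {ℓ : Level} (V : Set ℓ) (_∈_ : V → V → Set ℓ) where

  Class : Set (suc ℓ)
  Class = V → Set ℓ

  Univ : Class
  Univ _ = ⊤

  -- Satisfaction in the structure (C , ∈), for environments with values in C.
  Sat : Class → ∀ {n} → Formula n → Vec V n → Set ℓ
  Sat C (x ≐ y)  ρ = lookup ρ x ≡ lookup ρ y
  Sat C (x ∈̇ y)  ρ = lookup ρ x ∈ lookup ρ y
  Sat C ⊥̇        ρ = ⊥
  Sat C (φ ⇒̇ ψ)  ρ = Sat C φ ρ → Sat C ψ ρ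
  Sat C (∀̇ φ)    ρ = ∀ x → C x → Sat C φ (x ∷ ρ)

  -- Notions relativized to a class C: in this module all quantifiers over sets
  -- range over C, so that a notion P of this module, taken at C, reads "C ⊨ P".
  module Relative (C : Class) where

    _⊆_ : V → V → Set ℓ
    x ⊆ y = ∀ z → C z → z ∈ x → z ∈ y

    Nonempty : V → Set ℓ
    Nonempty x = ∃[ z ] C z × z ∈ x

    -- z = {x , y}
    IsUpair : V → V → V → Set ℓ
    IsUpair z x y = ∀ w → C w → (w ∈ z) ⇔ (w ≡ x ⊎ w ≡ y)

    -- p = ⟨x , y⟩ = {{x} , {x , y}}
    IsPair : V → V → V → Set ℓ
    IsPair p x y = ∀ z → C z → (z ∈ p) ⇔ (IsUpair z x x ⊎ IsUpair z x y)

    -- s = x ∪ {x}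
    IsSucc : V → V → Set ℓ
    IsSucc s x = ∀ z → C z → (z ∈ s) ⇔ (z ∈ x ⊎ z ≡ x)

    Inductive : V → Set ℓ
    Inductive w =
        (∃[ e ] C e × ¬ Nonempty e × e ∈ w)
      × (∀ x → C x → x ∈ w → ∃[ s ] C s × IsSucc s x × s ∈ w)

    IsOmega : V → Set ℓ
    IsOmega w = Inductive w × (∀ u → C u → Inductive u → w ⊆ u)

    -- ⟨x , y⟩ ∈ f
    App : V → V → V → Set ℓ
    App f x y = ∃[ p ] C p × IsPair p x y × p ∈ f

    -- f is a function with domain a
    FunctionOn : V → V → Set ℓ
    FunctionOn f a =
        (∀ p → C p → p ∈ f →
           ∃[ x ] ∃[ y ] C x × C y × x ∈ a × IsPair p x y)
      × (∀ x → C x → x ∈ a →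
           ∃[ y ] C y × App f x y × (∀ y′ → C y′ → App f x y′ → y′ ≡ y))

    Function : V → V → V → Set ℓ
    Function f a b =
      FunctionOn f a × (∀ x y → C x → C y → App f x y → y ∈ b)

    Injection : V → V → V → Set ℓ
    Injection f a b =
        Function f a b
      × (∀ x x′ y → C x → C x′ → C y → App f x y → App f x′ y → x ≡ x′)

    Bijection : V → V → V → Set ℓ
    Bijection f a b =
        Injection f a b
      × (∀ y → C y → y ∈ b → ∃[ x ] C x × x ∈ a × App f x y)

    Equinumerous : V → V → Set ℓ
    Equinumerous a b = ∃[ f ] C f × Bijection f a b

    TransitiveSet : V → Set ℓ
    TransitiveSet x = ∀ y → C y → y ∈ x → y ⊆ x

    record WellOrderedBy∈ (x : V) : Set ℓ where
      field
        irrefl     : ∀ y → C y → y ∈ x → ¬ (y ∈ y)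
        trans      : ∀ y z w → C y → C z → C w → y ∈ x → z ∈ x → w ∈ x →
                     y ∈ z → z ∈ w → y ∈ w
        trichotomy : ∀ y z → C y → C z → y ∈ x → z ∈ x →
                     y ∈ z ⊎ y ≡ z ⊎ z ∈ y
        least      : ∀ s → C s → s ⊆ x → Nonempty s →
                     ∃[ m ] C m × m ∈ s × (∀ y → C y → y ∈ s → y ≡ m ⊎ m ∈ y)

    Ordinal : V → Set ℓ
    Ordinal x = TransitiveSet x × WellOrderedBy∈ x

    Cardinal : V → Set ℓ
    Cardinal κ = Ordinal κ × (∀ β → C β → β ∈ κ → ¬ Equinumerous β κ)

    -- |a| < κ
    CardLess : V → V → Set ℓ
    CardLess a κ = ∃[ μ ] C μ × Cardinal μ × Equinumerous a μ × μ ∈ κ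

    record ZF : Set ℓ where
      field
        extensionality : ∀ x y → C x → C y →
          (∀ z → C z → (z ∈ x) ⇔ (z ∈ y)) → x ≡ y
        foundation : ∀ x → C x → Nonempty x →
          ∃[ y ] C y × y ∈ x × ¬ (∃[ z ] C z × z ∈ y × z ∈ x)
        pairing : ∀ x y → C x → C y → ∃[ z ] C z × IsUpair z x y
        union : ∀ x → C x →
          ∃[ u ] C u × (∀ z → C z → (z ∈ u) ⇔ (∃[ y ] C y × y ∈ x × z ∈ y))
        powerset : ∀ x → C x →
          ∃[ p ] C p × (∀ z → C z → (z ∈ p) ⇔ (z ⊆ x))
        infinity : ∃[ w ] C w × Inductive w
        separation : ∀ {n} (φ : Formula (1 ℕ.+ n)) (ρ : Vec V n) → All C ρ →
          ∀ a → C a →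
          ∃[ b ] C b × (∀ x → C x → (x ∈ b) ⇔ (x ∈ a × Sat C φ (x ∷ ρ)))
        replacement : ∀ {n} (φ : Formula (2 ℕ.+ n)) (ρ : Vec V n) → All C ρ →
          ∀ a → C a →
          (∀ x y y′ → C x → C y → C y′ → x ∈ a →
             Sat C φ (x ∷ y ∷ ρ) → Sat C φ (x ∷ y′ ∷ ρ) → y ≡ y′) →
          ∃[ b ] C b × (∀ y → C y →
             (y ∈ b) ⇔ (∃[ x ] C x × x ∈ a × Sat C φ (x ∷ y ∷ ρ)))

    Choice : Set ℓ
    Choice = ∀ F → C F → (∀ x → C x → x ∈ F → Nonempty x) →
      ∃[ f ] C f × FunctionOn f F ×
        (∀ x y → C x → C y → x ∈ F → App f x y → y ∈ x)

  open Relative Univ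

  ZFC : Set ℓ
  ZFC = ZF × Choice

  Uncountable : V → Set ℓ
  Uncountable x = ∀ ω → IsOmega ω → ¬ (∃[ f ] Injection f x ω)

  -- Regularity of an infinite cardinal: functions from smaller ordinals into κ
  -- are bounded.  κ-completeness of filters is conventionally considered only for
  -- regular κ; for singular κ every κ-complete filter on κ is principal, so that
  -- IsCompact below would hold trivially.
  Regular : V → Set ℓ
  Regular κ = ∀ β → β ∈ κ → ∀ f → Function f β κ →
    ∃[ γ ] γ ∈ κ × (∀ x y → App f x y → y ∈ γ)

  -- μ = κ⁺
  IsSuccessorCardinal : V → V → Set ℓ
  IsSuccessorCardinal μ κ =
    Cardinal μ × κ ∈ μ × (∀ ν → Cardinal ν → κ ∈ ν → μ ≡ ν ⊎ μ ∈ ν)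

  -- Proper filters on the set S.
  record IsFilter (F S : V) : Set ℓ where
    field
      subsets      : ∀ X → X ∈ F → X ⊆ S
      whole        : S ∈ F
      nonempty     : ∀ X → X ∈ F → Nonempty X
      upward       : ∀ X Y → X ∈ F → X ⊆ Y → Y ⊆ S → Y ∈ F
      intersection : ∀ X Y Z → X ∈ F → Y ∈ F →
                     (∀ z → (z ∈ Z) ⇔ (z ∈ X × z ∈ Y)) → Z ∈ F

  IsUltrafilter : V → V → Set ℓ
  IsUltrafilter U S = IsFilter U S ×
    (∀ X Z → X ⊆ S → (∀ z → (z ∈ Z) ⇔ (z ∈ S × ¬ (z ∈ X))) → X ∈ U ⊎ Z ∈ U)

  -- F is closed under intersections of fewer than κ of its elements.
  IsComplete : V → V → V → Set ℓ
  IsComplete κ F S = ∀ 𝒳 → 𝒳 ⊆ F → CardLess 𝒳 κ →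
    ∀ I → (∀ z → (z ∈ I) ⇔ (z ∈ S × (∀ X → X ∈ 𝒳 → z ∈ X))) → I ∈ F

  IsCompact : V → Set ℓ
  IsCompact κ = ∀ F → IsFilter F κ → IsComplete κ F κ →
    ∃[ U ] F ⊆ U × IsUltrafilter U κ × IsComplete κ U κ

  -- As usual in ZFC, proper classes and class functions are definable from
  -- parameters.
  Definable : Class → Set ℓ
  Definable M = ∃[ n ] Σ[ φ ∈ Formula (1 ℕ.+ n) ] Σ[ ρ ∈ Vec V n ]
    (∀ x → M x ⇔ Sat Univ φ (x ∷ ρ))

  -- A class function on D is represented by a map V → V; only its values on D
  -- are meaningful.
  DefinableOn : Class → (V → V) → Set ℓ
  DefinableOn D f = ∃[ n ] Σ[ φ ∈ Formula (2 ℕ.+ n) ] Σ[ ρ ∈ Vec V n ]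
    (∀ x y → D x → (f x ≡ y) ⇔ Sat Univ φ (x ∷ y ∷ ρ))

  record InnerModel (M : Class) : Set ℓ where
    field
      definable  : Definable M
      transitive : ∀ x y → M x → y ∈ x → M y
      ordinals   : ∀ α → Ordinal α → M α
      zf         : Relative.ZF M

  record ElementaryEmbedding (D E : Class) (f : V → V) : Set ℓ where
    field
      definable  : DefinableOn D f
      maps       : ∀ x → D x → E (f x)
      elementary : ∀ {n} (φ : Formula n) (ρ : Vec V n) → All D ρ →
                   Sat D φ ρ ⇔ Sat E φ (map f ρ)

  IsCriticalPoint : (V → V) → V → Set ℓ
  IsCriticalPoint f κ = Ordinal κ × (∀ α → α ∈ κ → f α ≡ α) × f κ ≢ κ

  -- Every function (that is a set) from κ to M belongs to M.
  ClosedUnder : V → Class → Set ℓ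
  ClosedUnder κ M =
    ∀ f → FunctionOn f κ → (∀ x y → App f x y → M y) → M f

  record NonGalvin (κ : V) : Set (suc ℓ) where
    field
      M N         : Class
      j i k       : V → V
      M-inner     : InnerModel M
      N-inner     : InnerModel N
      j-embedding : ElementaryEmbedding Univ M j
      i-embedding : ElementaryEmbedding Univ N i
      k-embedding : ElementaryEmbedding N M k
      commutes    : ∀ x → k (i x) ≡ j x
      crit-j      : IsCriticalPoint j κ
      crit-k      : IsCriticalPoint k (i κ)
      N-closed    : ClosedUnder κ N
      M-closed    : ClosedUnder κ M
      covering    : ∃[ κ⁺ ] IsSuccessorCardinal κ⁺ κ ×
                    (∃[ A ] M A × (∀ α → α ∈ κ⁺ → i α ∈ A) ×
                            Relative.CardLess M A (i κ))

module Submission where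

-- Work in (V , ∈) and let U be a κ-complete nonprincipal ultrafilter on κ, obtained by
-- extending the filter of tails.  Let g be ≤-minimal modulo U among the functions q ↦ g(q) ≤ q
-- that are unbounded on κ: every regressive h(q) ∈ g(q) is constant almost everywhere.
-- Since U makes κ a strong limit, the triples p = ⟨q , δ , a⟩ with δ < g(q) and a ⊆ κ
-- of size < g(q) can be indexed by κ, and κ-compactness gives a κ-complete W on them that
-- projects to U and contains {p : f_α(q) ∈ a} for all α < κ⁺ and {p : ξ < δ} for all
-- ξ < κ; here f_α(q) is the order type of b_α[g(q)] for a fixed surjection b_α : κ → α.
--
-- M is the ultrapower of V by W.  N is the same construction on the functions F with
-- F(p) ∈ G(q) for some thin G, meaning that every selector of G is constant modulo U; this is
-- the hull in M of j[V] and the ordinals below η = [p ↦ g(q)].  Thinness is preserved by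
-- pairing, by composition with functions in V and by sequences of length < g(q), which gives
-- Łoś's theorem and κ-closure for N, and a thin G satisfies G(q) ∩ κ ⊆ g(q) almost
-- everywhere, so that i(κ) = η is the critical point of the inverse collapse k.  Likewise
-- G(q) ∩ α ⊆ b_α[g(q)], so i(α) is represented in M by p ↦ f_α(q) and lies in the set
-- represented by p ↦ a, whose size in M is below η.

open import Defs
open import Axiom.ExcludedMiddle using (ExcludedMiddle)
open import Level using (Level; lift; lower) renaming (suc to lsuc)
open import Data.Nat.Base using (ℕ; zero; suc) renaming (_+_ to _+ℕ_)
open import Data.Fin.Base using (Fin; zero; suc; _↑ˡ_; _↑ʳ_; splitAt)
open import Data.Fin.Properties using (splitAt-↑ˡ; splitAt-↑ʳ)
open import Data.Vec.Base using (Vec; []; _∷_; head; tail; lookup; tabulate; map)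
open import Data.Vec.Properties using (lookup∘tabulate; lookup-map; map-∘)
open import Data.Vec.Relation.Unary.All using (All; []; _∷_)
open import Data.Product.Base using (Σ; ∃-syntax; Σ-syntax; _×_; _,_; proj₁; proj₂)
open import Data.Sum.Base using (_⊎_; inj₁; inj₂; [_,_]′)
open import Data.Empty using (⊥-elim) renaming (⊥ to ⊥₀)
open import Data.Empty.Polymorphic using (⊥)
open import Data.Unit.Polymorphic using (⊤; tt)
open import Function.Base using (_∘_; id; case_of_)
open import Function.Bundles using (_⇔_; mk⇔; Equivalence)
open import Relation.Nullary using (¬_; yes; no)
open import Relation.Binary.PropositionalEquality

-- Compactness speaks of filters on κ, while the natural index set for a covering of κ⁺, its small
-- subsets, is too large. The covering set is therefore guessed by bounded subsets of κ, with
-- coordinates taken from Ult(V , U): there `g` represents κ, f_α represents α, and thin functions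
-- represent the subsets of the pointwise image of V. Since W projects to U, there is a canonical
-- map e from Ult(V , U) to M. The hull behind N is the union of e(X) over the X represented by thin
-- functions, and i(α) = e(α) for α < κ⁺. So it is the e(α) that must be covered, and they are
-- represented by functions into κ. The component δ makes e move κ: it represents an ordinal that is
-- at least κ and below η = e(κ). Hence κ itself is represented by a function below q ↦ g(q), and
-- the κ-closure of both models rests on this. V is an arbitrary first-order structure, so
-- separation, replacement and the choice of witnesses apply to predicates given by formulas only.
-- This is why the auxiliary predicates and functions come with definitions.

module Development {ℓ : Level} (V : Set ℓ) (_∈_ : V → V → Set ℓ)
                   (axioms : ExcludedMiddle ℓ × SetTheory.ZFC V _∈_) where

  open SetTheory V _∈_
  open Equivalence using (to; from)
  private module R = Relative Univ

  em : ExcludedMiddle ℓ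
  em = proj₁ axioms

  zfc : ZFC
  zfc = proj₂ axioms

  by-cases : {A : Set ℓ} (P : Set ℓ) → (P → A) → (¬ P → A) → A
  by-cases P f g with em {P}
  ... | yes p = f p
  ... | no ¬p = g ¬p

  dne : {P : Set ℓ} → ¬ ¬ P → P
  dne {P} h = by-cases P id (λ n → ⊥-elim (h n))

  ¬∀⇒∃¬ : {A : Set ℓ} {P : A → Set ℓ} → ¬ (∀ x → P x) → ∃[ x ] ¬ P x
  ¬∀⇒∃¬ h = dne λ n → h λ x → dne λ np → n (x , np)

  -- Definable predicates and terms

  Env : ℕ → Set ℓ
  Env = Vec V

  -- The formula is given as a family natural in the positions of its variables
  -- and parameters, so that no renaming operation on formulas is needed.
  record Code {n} (P : Env n → Set ℓ) : Set ℓ where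
    no-eta-equality
    constructor code
    field
      m  : ℕ
      pm : Fin m → V
      fm : ∀ {k} → (Fin n → Fin k) → (Fin m → Fin k) → Formula k
      ok : ∀ {k} (rv : Fin n → Fin k) (rp : Fin m → Fin k) (σ : Vec V k) (ρ : Env n) →
           (∀ i → lookup σ (rv i) ≡ lookup ρ i) → (∀ i → lookup σ (rp i) ≡ pm i) →
           P ρ ⇔ Sat Univ (fm rv rp) σ

  -- The language has no function symbols, so a function of the environment is defined through its
  -- graph, with the value as head variable.
  record Term {n} (t : Env n → V) : Set ℓ where
    no-eta-equality
    constructor term
    field graph : Code {suc n} (λ ρ → head ρ ≡ t (tail ρ))

  open Code
  open Term

  private
    shift : ∀ {n k} → (Fin n → Fin k) → Fin (suc n) → Fin (suc k)
    shift r zero    = zero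
    shift r (suc i) = suc (r i)

    lk-shift : ∀ {n k} (r : Fin n → Fin k) (σ : Vec V k) (ρ : Env n) x →
               (∀ i → lookup σ (r i) ≡ lookup ρ i) →
               ∀ i → lookup (x ∷ σ) (shift r i) ≡ lookup (x ∷ ρ) i
    lk-shift r σ ρ x e zero    = refl
    lk-shift r σ ρ x e (suc i) = e i

  opaque
    c-eq : ∀ {n} (i j : Fin n) → Code (λ ρ → lookup ρ i ≡ lookup ρ j)
    c-eq i j = code 0 (λ ()) (λ rv _ → rv i ≐ rv j) λ rv rp σ ρ e _ →
      mk⇔ (λ h → trans (e i) (trans h (sym (e j))))
          (λ h → trans (sym (e i)) (trans h (e j)))

    c-mem : ∀ {n} (i j : Fin n) → Code (λ ρ → lookup ρ i ∈ lookup ρ j)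
    c-mem i j = code 0 (λ ()) (λ rv _ → rv i ∈̇ rv j) λ rv rp σ ρ e _ →
      mk⇔ (subst₂ _∈_ (sym (e i)) (sym (e j))) (subst₂ _∈_ (e i) (e j))

    c-const : ∀ {n} (c : V) → Code {suc n} (λ ρ → head ρ ≡ c)
    c-const c = code 1 (λ _ → c) (λ rv rp → rv zero ≐ rp zero) λ { rv rp σ (_ ∷ _) e e′ →
      mk⇔ (λ h → trans (e zero) (trans h (sym (e′ zero))))
          (λ h → trans (sym (e zero)) (trans h (e′ zero))) }

    c-imp : ∀ {n} {P Q : Env n → Set ℓ} → Code P → Code Q → Code (λ ρ → P ρ → Q ρ)
    c-imp {n} {P} {Q} c d = code (m c +ℕ m d) prm
        (λ rv rp → fm c rv (rp ∘ (_↑ˡ m d)) ⇒̇ fm d rv (rp ∘ (m c ↑ʳ_)))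
        λ rv rp σ ρ e e′ →
          let C = ok c rv (rp ∘ (_↑ˡ m d)) σ ρ e (λ i → trans (e′ _) (prmˡ i))
              D = ok d rv (rp ∘ (m c ↑ʳ_)) σ ρ e (λ i → trans (e′ _) (prmʳ i))
          in mk⇔ (λ h s → to D (h (from C s))) (λ h p → from D (h (to C p)))
      where
        prm : Fin (m c +ℕ m d) → V
        prm i = [ pm c , pm d ]′ (splitAt (m c) i)
        prmˡ : ∀ i → prm (i ↑ˡ m d) ≡ pm c i
        prmˡ i = cong [ pm c , pm d ]′ (splitAt-↑ˡ (m c) i (m d))
        prmʳ : ∀ i → prm (m c ↑ʳ i) ≡ pm d i
        prmʳ i = cong [ pm c , pm d ]′ (splitAt-↑ʳ (m c) (m d) i)

    c-bot : ∀ {n} → Code {n} (λ _ → ⊥)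
    c-bot = code 0 (λ ()) (λ _ _ → ⊥̇) λ _ _ _ _ _ _ → mk⇔ id id

    c-all : ∀ {n} {P : Env n → V → Set ℓ} →
            Code {suc n} (λ ρ → P (tail ρ) (head ρ)) → Code (λ ρ → ∀ x → P ρ x)
    c-all c = code (m c) (pm c) (λ rv rp → ∀̇ (fm c (shift rv) (suc ∘ rp))) λ rv rp σ ρ e e′ →
      let C : ∀ x → _
          C x = ok c (shift rv) (suc ∘ rp) (x ∷ σ) (x ∷ ρ) (lk-shift rv σ ρ x e) e′
      in mk⇔ (λ h x _ → to (C x) (h x)) (λ h x → from (C x) (h x tt))

    c-equiv : ∀ {n} {P Q : Env n → Set ℓ} → (∀ ρ → P ρ ⇔ Q ρ) → Code P → Code Q
    c-equiv h c = code (m c) (pm c) (fm c) λ rv rp σ ρ e e′ →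
      let C = ok c rv rp σ ρ e e′
      in mk⇔ (to C ∘ from (h ρ)) (to (h ρ) ∘ from C)

    c-ren : ∀ {n n′} {P : Env n → Set ℓ} (r : Fin n → Fin n′) (f : Env n′ → Env n) →
            (∀ ρ i → lookup ρ (r i) ≡ lookup (f ρ) i) → Code P → Code (P ∘ f)
    c-ren r f h c = code (m c) (pm c) (λ rv rp → fm c (rv ∘ r) rp) λ rv rp σ ρ e e′ →
      ok c (rv ∘ r) rp σ (f ρ) (λ i → trans (e (r i)) (h ρ i)) e′

    c-not : ∀ {n} {P : Env n → Set ℓ} → Code P → Code (λ ρ → ¬ P ρ)
    c-not c = c-equiv (λ ρ → mk⇔ (λ h p → lower (h p)) (λ h p → lift (h p))) (c-imp c c-bot)

    c-ex : ∀ {n} {P : Env n → V → Set ℓ} →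
           Code {suc n} (λ ρ → P (tail ρ) (head ρ)) → Code (λ ρ → Σ V (P ρ))
    c-ex {P = P} c = c-equiv
      (λ ρ → mk⇔ (λ h → dne λ n → h λ x p → n (x , p)) (λ (x , p) h → h x p))
      (c-not (c-all {P = λ ρ x → ¬ P ρ x} (c-not c)))

    c-and : ∀ {n} {P Q : Env n → Set ℓ} → Code P → Code Q → Code (λ ρ → P ρ × Q ρ)
    c-and c d = c-equiv
      (λ ρ → mk⇔ (λ h → dne λ n → h λ p q → n (p , q)) (λ (p , q) h → h p q))
      (c-not (c-imp c (c-not d)))

    c-or : ∀ {n} {P Q : Env n → Set ℓ} → Code P → Code Q → Code (λ ρ → P ρ ⊎ Q ρ)
    c-or {P = P} c d = c-equiv
      (λ ρ → mk⇔ (λ h → by-cases (P ρ) inj₁ (inj₂ ∘ h))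
                 (λ { (inj₁ p) n → ⊥-elim (n p) ; (inj₂ q) _ → q }))
      (c-imp (c-not c) d)

    -- Substitution of a definable term for the first variable: P (t ρ) is read as
    -- ∃ x (x ≡ t ρ ∧ P x).
    c-sub : ∀ {n} {P : V → Env n → Set ℓ} {t : Env n → V} →
            Code {suc n} (λ ρ → P (head ρ) (tail ρ)) →
            Code {suc n} (λ ρ → head ρ ≡ t (tail ρ)) → Code (λ ρ → P (t ρ) ρ)
    c-sub {P = P} {t} c d = c-equiv
      (λ ρ → mk⇔ (λ { (_ , refl , p) → p }) (λ p → t ρ , refl , p))
      (c-ex {P = λ ρ x → x ≡ t ρ × P x ρ} (c-and d c))

    private
      skip : ∀ {n} → Fin (suc n) → Fin (suc (suc n))
      skip zero    = zero
      skip (suc i) = suc (suc i)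

      skip-ok : ∀ {n} (ρ : Env (suc (suc n))) i →
                lookup ρ (skip i) ≡ lookup (head ρ ∷ tail (tail ρ)) i
      skip-ok (x ∷ y ∷ ρ) zero    = refl
      skip-ok (x ∷ y ∷ ρ) (suc i) = refl

    -- The head of the environment is reserved for the value of the term, so the new variable is
    -- inserted in second place.
    c-weaken : ∀ {n} {t : Env n → V} → Code {suc n} (λ ρ → head ρ ≡ t (tail ρ)) →
               Code {suc (suc n)} (λ ρ → head ρ ≡ t (tail (tail ρ)))
    c-weaken = c-ren skip (λ ρ → head ρ ∷ tail (tail ρ)) skip-ok

    c-skip : ∀ {n} {P : Env n → V → Set ℓ} → Code {suc n} (λ ρ → P (tail ρ) (head ρ)) →
             Code {suc (suc n)} (λ ρ → P (tail (tail ρ)) (head ρ))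
    c-skip = c-ren skip (λ ρ → head ρ ∷ tail (tail ρ)) skip-ok

    c-sub₂ : ∀ {n} {P : V → V → Env n → Set ℓ} {s t : Env n → V} →
             Code {suc (suc n)} (λ ρ → P (head ρ) (head (tail ρ)) (tail (tail ρ))) →
             Code {suc n} (λ ρ → head ρ ≡ s (tail ρ)) →
             Code {suc n} (λ ρ → head ρ ≡ t (tail ρ)) → Code (λ ρ → P (s ρ) (t ρ) ρ)
    c-sub₂ {P = P} {s} {t} c d e =
      c-sub {P = λ y ρ → P (s ρ) y ρ} (c-sub {P = λ x ρ → P x (head ρ) (tail ρ)} c (c-weaken {t = s} d)) e

    c-eq₀₁ : ∀ {n} → Code {suc (suc n)} (λ ρ → head ρ ≡ head (tail ρ))
    c-eq₀₁ = c-equiv (λ { (_ ∷ _ ∷ _) → mk⇔ id id }) (c-eq zero (suc zero))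

    c-mem₀₁ : ∀ {n} → Code {suc (suc n)} (λ ρ → head ρ ∈ head (tail ρ))
    c-mem₀₁ = c-equiv (λ { (_ ∷ _ ∷ _) → mk⇔ id id }) (c-mem zero (suc zero))

    term-var : ∀ {n} (i : Fin n) {t : Env n → V} → (∀ ρ → lookup ρ i ≡ t ρ) → Term t
    term-var i h = term (c-equiv (λ { (x ∷ ρ) → mk⇔ (λ e → trans e (h ρ)) (λ e → trans e (sym (h ρ))) })
                                 (c-eq zero (suc i)))

  opaque
    instance
      def-eq : ∀ {n} {s t : Env n → V} → ⦃ Term s ⦄ → ⦃ Term t ⦄ → Code (λ ρ → s ρ ≡ t ρ)
      def-eq ⦃ c ⦄ ⦃ d ⦄ =
        c-sub₂ {P = λ x y _ → x ≡ y} c-eq₀₁ (graph c) (graph d)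

      def-mem : ∀ {n} {s t : Env n → V} → ⦃ Term s ⦄ → ⦃ Term t ⦄ → Code (λ ρ → s ρ ∈ t ρ)
      def-mem ⦃ c ⦄ ⦃ d ⦄ =
        c-sub₂ {P = λ x y _ → x ∈ y} c-mem₀₁ (graph c) (graph d)

      def-imp : ∀ {n} {P Q : Env n → Set ℓ} → ⦃ Code P ⦄ → ⦃ Code Q ⦄ → Code (λ ρ → P ρ → Q ρ)
      def-imp ⦃ c ⦄ ⦃ d ⦄ = c-imp c d

      def-bot : ∀ {n} → Code {n} (λ _ → ⊥)
      def-bot = c-bot

      def-top : ∀ {n} → Code {n} (λ _ → ⊤)
      def-top = c-equiv (λ _ → mk⇔ (λ _ → tt) (λ _ x → x)) (c-imp c-bot c-bot)

      def-all : ∀ {n} {P : Env n → V → Set ℓ} →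
                ⦃ Code {suc n} (λ ρ → P (tail ρ) (head ρ)) ⦄ → Code (λ ρ → ∀ x → P ρ x)
      def-all ⦃ c ⦄ = c-all c

      def-ex : ∀ {n} {P : Env n → V → Set ℓ} →
               ⦃ Code {suc n} (λ ρ → P (tail ρ) (head ρ)) ⦄ → Code (λ ρ → Σ V (λ x → P ρ x))
      def-ex ⦃ c ⦄ = c-ex c

      def-not : ∀ {n} {P : Env n → Set ℓ} → ⦃ Code P ⦄ → Code (λ ρ → ¬ P ρ)
      def-not ⦃ c ⦄ = c-not c

      def-and : ∀ {n} {P Q : Env n → Set ℓ} → ⦃ Code P ⦄ → ⦃ Code Q ⦄ → Code (λ ρ → P ρ × Q ρ)
      def-and ⦃ c ⦄ ⦃ d ⦄ = c-and c d

      def-or : ∀ {n} {P Q : Env n → Set ℓ} → ⦃ Code P ⦄ → ⦃ Code Q ⦄ → Code (λ ρ → P ρ ⊎ Q ρ)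
      def-or ⦃ c ⦄ ⦃ d ⦄ = c-or c d

      term-const : ∀ {n} {c : V} → Term {n} (λ _ → c)
      term-const {c = c} = term (c-const c)

      term-v0 : ∀ {n} → Term {1 +ℕ n} (λ ρ → head ρ)
      term-v0 = term-var zero λ { (_ ∷ _) → refl }
      term-v1 : ∀ {n} → Term {2 +ℕ n} (λ ρ → head (tail ρ))
      term-v1 = term-var (suc zero) λ { (_ ∷ _ ∷ _) → refl }
      term-v2 : ∀ {n} → Term {3 +ℕ n} (λ ρ → head (tail (tail ρ)))
      term-v2 = term-var (suc (suc zero)) λ { (_ ∷ _ ∷ _ ∷ _) → refl }
      term-v3 : ∀ {n} → Term {4 +ℕ n} (λ ρ → head (tail (tail (tail ρ))))
      term-v3 = term-var (suc (suc (suc zero))) λ { (_ ∷ _ ∷ _ ∷ _ ∷ _) → refl }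
      term-v4 : ∀ {n} → Term {5 +ℕ n} (λ ρ → head (tail (tail (tail (tail ρ)))))
      term-v4 = term-var (suc (suc (suc (suc zero)))) λ { (_ ∷ _ ∷ _ ∷ _ ∷ _ ∷ _) → refl }
      term-v5 : ∀ {n} → Term {6 +ℕ n} (λ ρ → head (tail (tail (tail (tail (tail ρ))))))
      term-v5 = term-var (suc (suc (suc (suc (suc zero))))) λ { (_ ∷ _ ∷ _ ∷ _ ∷ _ ∷ _ ∷ _) → refl }
      term-v6 : ∀ {n} → Term {7 +ℕ n} (λ ρ → head (tail (tail (tail (tail (tail (tail ρ)))))))
      term-v6 = term-var (suc (suc (suc (suc (suc (suc zero)))))) λ { (_ ∷ _ ∷ _ ∷ _ ∷ _ ∷ _ ∷ _ ∷ _) → refl }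
      term-v7 : ∀ {n} → Term {8 +ℕ n} (λ ρ → head (tail (tail (tail (tail (tail (tail (tail ρ))))))))
      term-v7 = term-var (suc (suc (suc (suc (suc (suc (suc zero))))))) λ { (_ ∷ _ ∷ _ ∷ _ ∷ _ ∷ _ ∷ _ ∷ _ ∷ _) → refl }
      term-v8 : ∀ {n} → Term {9 +ℕ n} (λ ρ → head (tail (tail (tail (tail (tail (tail (tail (tail ρ)))))))))
      term-v8 = term-var (suc (suc (suc (suc (suc (suc (suc (suc zero)))))))) λ { (_ ∷ _ ∷ _ ∷ _ ∷ _ ∷ _ ∷ _ ∷ _ ∷ _ ∷ _) → refl }
      term-v9 : ∀ {n} → Term {10 +ℕ n} (λ ρ → head (tail (tail (tail (tail (tail (tail (tail (tail (tail ρ))))))))))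
      term-v9 = term-var (suc (suc (suc (suc (suc (suc (suc (suc (suc zero))))))))) λ { (_ ∷ _ ∷ _ ∷ _ ∷ _ ∷ _ ∷ _ ∷ _ ∷ _ ∷ _ ∷ _) → refl }
      term-v10 : ∀ {n} → Term {11 +ℕ n} (λ ρ → head (tail (tail (tail (tail (tail (tail (tail (tail (tail (tail ρ)))))))))))
      term-v10 = term-var (suc (suc (suc (suc (suc (suc (suc (suc (suc (suc zero)))))))))) λ { (_ ∷ _ ∷ _ ∷ _ ∷ _ ∷ _ ∷ _ ∷ _ ∷ _ ∷ _ ∷ _ ∷ _) → refl }
      term-v11 : ∀ {n} → Term {12 +ℕ n} (λ ρ → head (tail (tail (tail (tail (tail (tail (tail (tail (tail (tail (tail ρ))))))))))))
      term-v11 = term-var (suc (suc (suc (suc (suc (suc (suc (suc (suc (suc (suc zero))))))))))) λ { (_ ∷ _ ∷ _ ∷ _ ∷ _ ∷ _ ∷ _ ∷ _ ∷ _ ∷ _ ∷ _ ∷ _ ∷ _) → refl }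

  -- Definability is found by instance search, which follows the syntax of a predicate through the
  -- instances above; a variable is recognised as `head` of an iterated `tail`.
  auto : {A : Set ℓ} → ⦃ A ⦄ → A
  auto ⦃ a ⦄ = a

  infix 1 _↔_
  _↔_ : Set ℓ → Set ℓ → Set ℓ
  A ↔ B = (A → B) × (B → A)

  Def₁ : (V → Set ℓ) → Set ℓ
  Def₁ P = Code {1} (λ ρ → P (head ρ))

  Def₂ : (V → V → Set ℓ) → Set ℓ
  Def₂ P = Code {2} (λ ρ → P (head ρ) (head (tail ρ)))

  Def₃ : (V → V → V → Set ℓ) → Set ℓ
  Def₃ P = Code {3} (λ ρ → P (head ρ) (head (tail ρ)) (head (tail (tail ρ))))

  Term₁ : (V → V) → Set ℓ
  Term₁ t = Term {1} (λ ρ → t (head ρ))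

  Term₂ : (V → V → V) → Set ℓ
  Term₂ t = Term {2} (λ ρ → t (head ρ) (head (tail ρ)))

  Term₃ : (V → V → V → V) → Set ℓ
  Term₃ t = Term {3} (λ ρ → t (head ρ) (head (tail ρ)) (head (tail (tail ρ))))

  opaque
    def-sub₁ : ∀ {n} {P : V → Set ℓ} {s : Env n → V} → Def₁ P → Term s → Code (λ ρ → P (s ρ))
    def-sub₁ {P = P} {s} c d = c-sub {P = λ x _ → P x} {s}
      (c-ren (_↑ˡ _) (λ ρ → head ρ ∷ []) (λ { (_ ∷ _) zero → refl }) c) (graph d)

    def-sub₂ : ∀ {n} {P : V → V → Set ℓ} {s t : Env n → V} →
               Def₂ P → Term s → Term t → Code (λ ρ → P (s ρ) (t ρ))
    def-sub₂ {P = P} {s} {t} c d e = c-sub₂ {P = λ x y _ → P x y} {s} {t}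
      (c-ren (_↑ˡ _) (λ ρ → head ρ ∷ head (tail ρ) ∷ [])
             (λ { (_ ∷ _ ∷ _) zero → refl ; (_ ∷ _ ∷ _) (suc zero) → refl }) c) (graph d) (graph e)

    def-sub₃ : ∀ {n} {P : V → V → V → Set ℓ} {s t u : Env n → V} →
               Def₃ P → Term s → Term t → Term u → Code (λ ρ → P (s ρ) (t ρ) (u ρ))
    def-sub₃ {P = P} {s} {t} {u} c d e f = c-sub {P = λ z ρ → P (s ρ) (t ρ) z} {u}
      (c-sub₂ {P = λ x y ρ → P x y (head ρ)} {λ ρ → s (tail ρ)} {λ ρ → t (tail ρ)}
        (c-ren (_↑ˡ _) (λ ρ → head ρ ∷ head (tail ρ) ∷ head (tail (tail ρ)) ∷ [])
          (λ { (_ ∷ _ ∷ _ ∷ _) zero → refl ; (_ ∷ _ ∷ _ ∷ _) (suc zero) → refl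
             ; (_ ∷ _ ∷ _ ∷ _) (suc (suc zero)) → refl }) c)
        (c-weaken {t = s} (graph d)) (c-weaken {t = t} (graph e)))
      (graph f)

    term-sub₁ : ∀ {n} {h : V → V} {s : Env n → V} → Term₁ h → Term s → Term (λ ρ → h (s ρ))
    term-sub₁ {h = h} {s} c d = term
      (def-sub₂ {P = λ y x → y ≡ h x} {s = head} {t = λ ρ → s (tail ρ)} (graph c) auto (term (c-weaken {t = s} (graph d))))

    term-sub₂ : ∀ {n} {h : V → V → V} {s t : Env n → V} →
                Term₂ h → Term s → Term t → Term (λ ρ → h (s ρ) (t ρ))
    term-sub₂ {h = h} {s} {t} c d e = term
      (def-sub₃ {P = λ y x z → y ≡ h x z} {s = head} {t = λ ρ → s (tail ρ)} {λ ρ → t (tail ρ)}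
        (graph c) auto (term (c-weaken {t = s} (graph d))) (term (c-weaken {t = t} (graph e))))

    term-sub₃ : ∀ {n} {h : V → V → V → V} {s t u : Env n → V} →
                Term₃ h → Term s → Term t → Term u → Term (λ ρ → h (s ρ) (t ρ) (u ρ))
    term-sub₃ {h = h} {s} {t} {u} c d e f = term
      (c-sub {P = λ z ρ → head ρ ≡ h (s (tail ρ)) (t (tail ρ)) z} {λ ρ → u (tail ρ)}
        (c-sub₂ {P = λ x y ρ → head (tail ρ) ≡ h x y (head ρ)}
                {λ ρ → s (tail (tail ρ))} {λ ρ → t (tail (tail ρ))}
          (c-ren r (λ ρ → head (tail (tail (tail ρ))) ∷ head ρ ∷ head (tail ρ) ∷ head (tail (tail ρ)) ∷ [])
                 r-ok (graph c))
          (c-weaken {t = λ ρ → s (tail ρ)} (c-weaken {t = s} (graph d)))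
          (c-weaken {t = λ ρ → t (tail ρ)} (c-weaken {t = t} (graph e))))
        (c-weaken {t = u} (graph f)))
      where
        r : ∀ {n} → Fin 4 → Fin (4 +ℕ n)
        r zero                   = suc (suc (suc zero))
        r (suc zero)             = zero
        r (suc (suc zero))       = suc zero
        r (suc (suc (suc zero))) = suc (suc zero)
        r-ok : ∀ {n} (ρ : Env (4 +ℕ n)) i → lookup ρ (r i) ≡
               lookup (head (tail (tail (tail ρ))) ∷ head ρ ∷ head (tail ρ) ∷ head (tail (tail ρ)) ∷ []) i
        r-ok (_ ∷ _ ∷ _ ∷ _ ∷ _) zero                   = refl
        r-ok (_ ∷ _ ∷ _ ∷ _ ∷ _) (suc zero)             = refl
        r-ok (_ ∷ _ ∷ _ ∷ _ ∷ _) (suc (suc zero))       = refl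
        r-ok (_ ∷ _ ∷ _ ∷ _ ∷ _) (suc (suc (suc zero))) = refl

    c-swap : ∀ {n} {P : V → V → Env n → Set ℓ} → Code {suc (suc n)} (λ ρ → P (head ρ) (head (tail ρ)) (tail (tail ρ))) →
             Code {suc (suc n)} (λ ρ → P (head (tail ρ)) (head ρ) (tail (tail ρ)))
    c-swap = c-ren sw (λ ρ → head (tail ρ) ∷ head ρ ∷ tail (tail ρ)) sw-ok
      where
        sw : ∀ {n} → Fin (suc (suc n)) → Fin (suc (suc n))
        sw zero          = suc zero
        sw (suc zero)    = zero
        sw (suc (suc i)) = suc (suc i)
        sw-ok : ∀ {n} (ρ : Env (suc (suc n))) i →
                lookup ρ (sw i) ≡ lookup (head (tail ρ) ∷ head ρ ∷ tail (tail ρ)) i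
        sw-ok (_ ∷ _ ∷ _) zero          = refl
        sw-ok (_ ∷ _ ∷ _) (suc zero)    = refl
        sw-ok (_ ∷ _ ∷ _) (suc (suc i)) = refl

  open Relative.ZF (proj₁ zfc) using (extensionality; pairing; union; powerset; infinity; separation; replacement)

  -- Elementary set theory

  infix 4 _⊆_
  _⊆_ : V → V → Set ℓ
  x ⊆ y = ∀ z → z ∈ x → z ∈ y

  ext : ∀ {x y} → x ⊆ y → y ⊆ x → x ≡ y
  ext h k = extensionality _ _ tt tt λ z _ → mk⇔ (h z) (k z)

  -- Extensionality turns the graph `y ≡ t ρ` into a statement about the members of `y`.
  term-ext : ∀ {n} {t : Env n → V} {P : Env n → V → Set ℓ} → (∀ ρ w → w ∈ t ρ ↔ P ρ w) →
             Code {suc n} (λ ρ → P (tail ρ) (head ρ)) → Term t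
  term-ext {n} {t} {P} h c = term (c-equiv
    (λ { (y ∷ ρ) → mk⇔
      (λ k → ext (λ w wy → proj₂ (h ρ w) (proj₁ (k w) wy)) (λ w wt → proj₂ (k w) (proj₁ (h ρ w) wt)))
      (λ { refl w → h ρ w }) })
    (c-all {P = λ ρ w → w ∈ head ρ ↔ P (tail ρ) w}
      (c-and (c-imp auto (c-skip {P = P} c)) (c-imp (c-skip {P = P} c) auto))))

  all-univ : ∀ {n} (ρ : Vec V n) → All Univ ρ
  all-univ []      = []
  all-univ (x ∷ ρ) = tt ∷ all-univ ρ

  private
    sep-ex : (a : V) (P : V → Set ℓ) → Def₁ P → ∃[ b ] (∀ x → (x ∈ b) ↔ (x ∈ a × P x))
    sep-ex a P c =
      let (b , _ , h) = separation (fm c (_↑ˡ _) (1 ↑ʳ_)) (tabulate (pm c)) (all-univ _) a tt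
          e : ∀ x → P x ⇔ _
          e x = ok c (_↑ˡ _) (1 ↑ʳ_) (x ∷ tabulate (pm c)) (x ∷ [])
                  (λ { zero → refl }) (λ i → lookup∘tabulate (pm c) i)
      in b , λ x → (λ xb → let (xa , s) = to (h x tt) xb in xa , from (e x) s) ,
                   (λ (xa , p) → from (h x tt) (xa , to (e x) p))

    repl-ex : (a : V) (R : V → V → Set ℓ) → Def₂ R →
              (∀ x y y′ → x ∈ a → R x y → R x y′ → y ≡ y′) →
              ∃[ b ] (∀ y → (y ∈ b) ↔ (∃[ x ] x ∈ a × R x y))
    repl-ex a R c f =
      let e : ∀ x y → R x y ⇔ _
          e x y = ok c (_↑ˡ _) (2 ↑ʳ_) (x ∷ y ∷ tabulate (pm c)) (x ∷ y ∷ [])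
                  (λ { zero → refl ; (suc zero) → refl }) (λ i → lookup∘tabulate (pm c) i)
          (b , _ , h) = replacement (fm c (_↑ˡ _) (2 ↑ʳ_)) (tabulate (pm c)) (all-univ _) a tt
             (λ x y y′ _ _ _ xa s s′ → f x y y′ xa (from (e x y) s) (from (e x y′) s′))
      in b , λ y → (λ yb → let (x , _ , xa , s) = to (h y tt) yb in x , xa , from (e x y) s) ,
                   (λ (x , xa , p) → from (h y tt) (x , tt , xa , to (e x y) p))

  opaque
    sep : (a : V) (P : V → Set ℓ) ⦃ d : Def₁ P ⦄ → V
    sep a P ⦃ d ⦄ = proj₁ (sep-ex a P d)

    sep-e : ∀ {a P x} {d : Def₁ P} → x ∈ sep a P ⦃ d ⦄ → x ∈ a × P x
    sep-e {a} {P} {x} {d} = proj₁ (proj₂ (sep-ex a P d) x)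

    sep-i : ∀ {a P x} {d : Def₁ P} → x ∈ a → P x → x ∈ sep a P ⦃ d ⦄
    sep-i {a} {P} {x} {d} h k = proj₂ (proj₂ (sep-ex a P d) x) (h , k)

  opaque
    repl : (a : V) (R : V → V → Set ℓ) → ⦃ Def₂ R ⦄ →
           (∀ x y y′ → x ∈ a → R x y → R x y′ → y ≡ y′) →
           ∃[ b ] (∀ y → (y ∈ b) ↔ (∃[ x ] x ∈ a × R x y))
    repl a R ⦃ d ⦄ = repl-ex a R d

    pr : V → V → V
    pr x y = proj₁ (pairing x y tt tt)

    pr-e : ∀ {x y z} → z ∈ pr x y → z ≡ x ⊎ z ≡ y
    pr-e {x} {y} {z} = to (proj₂ (proj₂ (pairing x y tt tt)) z tt)

    pr-i₁ : ∀ {x y} → x ∈ pr x y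
    pr-i₁ {x} {y} = from (proj₂ (proj₂ (pairing x y tt tt)) x tt) (inj₁ refl)

    pr-i₂ : ∀ {x y} → y ∈ pr x y
    pr-i₂ {x} {y} = from (proj₂ (proj₂ (pairing x y tt tt)) y tt) (inj₂ refl)

    ⋃ : V → V
    ⋃ x = proj₁ (union x tt)

    ⋃-e : ∀ {x z} → z ∈ ⋃ x → ∃[ y ] y ∈ x × z ∈ y
    ⋃-e {x} {z} h = let (y , _ , r) = to (proj₂ (proj₂ (union x tt)) z tt) h in y , r

    ⋃-i : ∀ {x y z} → y ∈ x → z ∈ y → z ∈ ⋃ x
    ⋃-i {x} {y} {z} h k = from (proj₂ (proj₂ (union x tt)) z tt) (y , tt , h , k)

    𝒫 : V → V
    𝒫 x = proj₁ (powerset x tt)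

    𝒫-e : ∀ {x z} → z ∈ 𝒫 x → z ⊆ x
    𝒫-e {x} {z} h w = to (proj₂ (proj₂ (powerset x tt)) z tt) h w tt

    𝒫-i : ∀ {x z} → z ⊆ x → z ∈ 𝒫 x
    𝒫-i {x} {z} h = from (proj₂ (proj₂ (powerset x tt)) z tt) λ w _ → h w

  opaque
    ∅ : V
    ∅ = sep (proj₁ infinity) (λ _ → ⊥)

    ∅-e : ∀ {x} → ¬ (x ∈ ∅)
    ∅-e h = lower (proj₂ (sep-e h))

  private
    img-ex : (a : V) (t : V → V) → Term₁ t → ∃[ b ] (∀ y → (y ∈ b) ↔ (∃[ x ] x ∈ a × y ≡ t x))
    img-ex a t d = repl-ex a (λ x y → y ≡ t x)
      (def-sub₂ {P = λ y x → y ≡ t x} {λ ρ → head (tail ρ)} {head} (graph d) auto auto)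
      (λ { x y y′ _ refl refl → refl })

  opaque
    img : (a : V) (t : V → V) ⦃ d : Term₁ t ⦄ → V
    img a t ⦃ d ⦄ = proj₁ (img-ex a t d)

    img-e : ∀ {a t y} {d : Term₁ t} → y ∈ img a t ⦃ d ⦄ → ∃[ x ] x ∈ a × y ≡ t x
    img-e {a} {t} {y} {d} = proj₁ (proj₂ (img-ex a t d) y)

    img-i : ∀ {a t x} {d : Term₁ t} → x ∈ a → t x ∈ img a t ⦃ d ⦄
    img-i {a} {t} {x} {d} h = proj₂ (proj₂ (img-ex a t d) (t x)) (x , h , refl)

  infixr 6 _∪_
  _∪_ : V → V → V
  x ∪ y = ⋃ (pr x y)

  ∪-i₁ : ∀ {x y z} → z ∈ x → z ∈ (x ∪ y)
  ∪-i₁ = ⋃-i pr-i₁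

  ∪-i₂ : ∀ {x y z} → z ∈ y → z ∈ (x ∪ y)
  ∪-i₂ = ⋃-i pr-i₂

  ∪-e : ∀ {x y z} → z ∈ (x ∪ y) → z ∈ x ⊎ z ∈ y
  ∪-e h with ⋃-e h
  ... | w , hw , zw with pr-e hw
  ... | inj₁ refl = inj₁ zw
  ... | inj₂ refl = inj₂ zw

  sg : V → V
  sg x = pr x x

  sg-e : ∀ {x z} → z ∈ sg x → z ≡ x
  sg-e h with pr-e h
  ... | inj₁ e = e
  ... | inj₂ e = e

  sg-i : ∀ {x} → x ∈ sg x
  sg-i = pr-i₁

  succ : V → V
  succ x = x ∪ sg x

  succ-e : ∀ {x z} → z ∈ succ x → z ∈ x ⊎ z ≡ x
  succ-e h with ∪-e h
  ... | inj₁ p = inj₁ p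
  ... | inj₂ p = inj₂ (sg-e p)

  succ-i₁ : ∀ {x z} → z ∈ x → z ∈ succ x
  succ-i₁ = ∪-i₁

  succ-i₂ : ∀ {x} → x ∈ succ x
  succ-i₂ = ∪-i₂ sg-i

  opaque
    pair : V → V → V
    pair x y = pr (sg x) (pr x y)

    pair-def : ∀ x y → pair x y ≡ pr (sg x) (pr x y)
    pair-def x y = refl

    pair-inj : ∀ {a b c d} → pair a b ≡ pair c d → a ≡ c × b ≡ d
    pair-inj {a} {b} {c} {d} e = a≡c , b≡d
      where
        elem : ∀ {x} → x ∈ pair a b → x ∈ pair c d
        elem {x} = subst (x ∈_) e
        a≡c : a ≡ c
        a≡c with pr-e (elem pr-i₁)
        ... | inj₁ h = sg-e (subst (a ∈_) h sg-i)
        ... | inj₂ h = sym (sg-e (subst (c ∈_) (sym h) pr-i₁))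
        cd : ∀ {x y} → pr x y ∈ pair x d → (y ≡ x) ⊎ (y ≡ d)
        cd {x} {y} h with pr-e h
        ... | inj₁ k = inj₁ (sg-e (subst (y ∈_) k pr-i₂))
        ... | inj₂ k = pr-e (subst (y ∈_) k pr-i₂)
        b≡d : b ≡ d
        b≡d with a≡c
        b≡d | refl with cd (elem pr-i₂)
        ... | inj₂ h = h
        ... | inj₁ refl with pr-e (subst (pr a d ∈_) (sym e) pr-i₂)
        ... | inj₁ k = sym (sg-e (subst (d ∈_) k pr-i₂))
        ... | inj₂ k = sym (sg-e (subst (d ∈_) k pr-i₂))

  -- Definite description; the value is ∅ unless exactly one set satisfies P.
  opaque
    the : (V → Set ℓ) → V
    the P with em {∃[ y ] P y × (∀ z → P z → z ≡ y)}
    ... | yes (y , _) = y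
    ... | no _        = ∅

    the-≡ : ∀ {P y} → P y → (∀ z → P z → z ≡ y) → the P ≡ y
    the-≡ {P} {y} p u with em {∃[ y ] P y × (∀ z → P z → z ≡ y)}
    ... | yes (z , q , _) = u z q
    ... | no n            = ⊥-elim (n (y , p , u))

    the-∅ : ∀ {P} → ¬ (∃[ y ] P y × (∀ z → P z → z ≡ y)) → the P ≡ ∅
    the-∅ {P} n with em {∃[ y ] P y × (∀ z → P z → z ≡ y)}
    ... | yes p = ⊥-elim (n p)
    ... | no _  = refl

  the-spec : ∀ {P} → (∃[ y ] P y × (∀ z → P z → z ≡ y)) → P (the P)
  the-spec {P} (y , p , u) = subst P (sym (the-≡ {P} p u)) p

  module _ where
    opaque
      instance
        term-pr : ∀ {n} {s t : Env n → V} → ⦃ Term s ⦄ → ⦃ Term t ⦄ → Term (λ ρ → pr (s ρ) (t ρ))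
        term-pr ⦃ c ⦄ ⦃ d ⦄ = term-sub₂ {h = pr} (term-ext {P = λ ρ w → w ≡ head ρ ⊎ w ≡ head (tail ρ)}
          (λ ρ w → pr-e , λ { (inj₁ refl) → pr-i₁ ; (inj₂ refl) → pr-i₂ }) auto) c d

        term-⋃ : ∀ {n} {s : Env n → V} → ⦃ Term s ⦄ → Term (λ ρ → ⋃ (s ρ))
        term-⋃ ⦃ c ⦄ = term-sub₁ {h = ⋃} (term-ext {P = λ ρ w → ∃[ y ] y ∈ head ρ × w ∈ y}
          (λ ρ w → ⋃-e , λ (_ , h , k) → ⋃-i h k) auto) c

        term-𝒫 : ∀ {n} {s : Env n → V} → ⦃ Term s ⦄ → Term (λ ρ → 𝒫 (s ρ))
        term-𝒫 ⦃ c ⦄ = term-sub₁ {h = 𝒫} (term-ext {P = λ ρ w → w ⊆ head ρ}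
          (λ ρ w → 𝒫-e , 𝒫-i) auto) c

        term-pair : ∀ {n} {s t : Env n → V} → ⦃ Term s ⦄ → ⦃ Term t ⦄ → Term (λ ρ → pair (s ρ) (t ρ))
        term-pair {s = s} {t} ⦃ c ⦄ ⦃ d ⦄ = term (c-equiv
          (λ ρ → mk⇔ (λ e → trans e (sym (pair-def _ _))) (λ e → trans e (pair-def _ _)))
          (graph (term-pr {s = λ ρ → sg (s ρ)} {λ ρ → pr (s ρ) (t ρ)})))

        term-the : ∀ {n} {P : Env n → V → Set ℓ} →
                   ⦃ Code {suc n} (λ ρ → P (tail ρ) (head ρ)) ⦄ → Term (λ ρ → the (P ρ))
        term-the {P = P} ⦃ c ⦄ = term (c-equiv
          {P = λ ρ → (P (tail ρ) (head ρ) × (∀ z → P (tail ρ) z → z ≡ head ρ)) ⊎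
                     (¬ (∃[ y ] P (tail ρ) y × (∀ z → P (tail ρ) z → z ≡ y)) × head ρ ≡ ∅)}
          (λ { (y ∷ ρ) → mk⇔
            (λ { (inj₁ (p , u)) → sym (the-≡ {P ρ} p u) ; (inj₂ (n , refl)) → sym (the-∅ {P ρ} n) })
            (λ e → by-cases (∃[ y ] P ρ y × (∀ z → P ρ z → z ≡ y))
              (λ (z , p , u) → inj₁ (subst (λ y → P ρ y × (∀ z → P ρ z → z ≡ y))
                                           (sym (trans e (the-≡ {P ρ} p u))) (p , u)))
              (λ n → inj₂ (n , trans e (the-∅ {P ρ} n)))) })
          (c-or (c-and c uniq₁) (c-and (c-not (c-ex {P = λ ρ y → P (tail ρ) y × (∀ z → P (tail ρ) z → z ≡ y)}
                                                      (c-and c₁ uniq₂))) auto)))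
          where
            c₁ : Code {suc (suc _)} (λ ρ → P (tail (tail ρ)) (head ρ))
            c₁ = c-skip {P = P} c
            uniq₁ : Code {suc _} (λ ρ → ∀ z → P (tail ρ) z → z ≡ head ρ)
            uniq₁ = c-all {P = λ ρ z → P (tail ρ) z → z ≡ head ρ} (c-imp c₁ auto)
            uniq₂ : Code {suc (suc _)} (λ ρ → ∀ z → P (tail (tail ρ)) z → z ≡ head ρ)
            uniq₂ = c-all {P = λ ρ z → P (tail (tail ρ)) z → z ≡ head ρ}
                          (c-imp (c-skip {P = λ ρ → P (tail ρ)} c₁) auto)

  opaque
    instance
      term-sep : ∀ {n} {a : Env n → V} {P : Env n → V → Set ℓ} {d : ∀ ρ → Def₁ (P ρ)} →
                 ⦃ Term a ⦄ → ⦃ Code {suc n} (λ ρ → P (tail ρ) (head ρ)) ⦄ →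
                 Term (λ ρ → sep (a ρ) (P ρ) ⦃ d ρ ⦄)
      term-sep {a = a} {P} ⦃ c ⦄ ⦃ e ⦄ = term-ext {P = λ ρ w → w ∈ a ρ × P ρ w}
        (λ ρ w → sep-e , λ (h , k) → sep-i h k)
        (c-and (def-sub₂ {P = _∈_} {head} {λ ρ → a (tail ρ)} auto auto (term (c-weaken {t = a} (graph c)))) e)

      term-img : ∀ {n} {a : Env n → V} {t : Env n → V → V} {d : ∀ ρ → Term₁ (t ρ)} →
                 ⦃ Term a ⦄ → ⦃ Term {suc n} (λ ρ → t (tail ρ) (head ρ)) ⦄ →
                 Term (λ ρ → img (a ρ) (t ρ) ⦃ d ρ ⦄)
      term-img {a = a} {t} ⦃ c ⦄ ⦃ e ⦄ = term-ext {P = λ ρ w → ∃[ x ] x ∈ a ρ × w ≡ t ρ x}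
        (λ ρ w → img-e , λ { (x , h , refl) → img-i h })
        (c-ex {P = λ ρ x → x ∈ a (tail ρ) × head ρ ≡ t (tail ρ) x}
          (c-and (def-sub₂ {P = _∈_} {head} {λ ρ → a (tail (tail ρ))} auto auto
                   (term (c-weaken {t = λ ρ → a (tail ρ)} (c-weaken {t = a} (graph c)))))
                 (c-swap {P = λ y x ρ → y ≡ t ρ x} (graph e))))

  opaque
    app : V → V → V
    app f x = the (λ y → pair x y ∈ f)

    app-def : ∀ f x → app f x ≡ the (λ y → pair x y ∈ f)
    app-def f x = refl

  opaque
    instance
      term-app : ∀ {n} {s t : Env n → V} → ⦃ Term s ⦄ → ⦃ Term t ⦄ → Term (λ ρ → app (s ρ) (t ρ))
      term-app ⦃ c ⦄ ⦃ d ⦄ = term-sub₂ {h = app} (term (c-equiv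
        (λ { (y ∷ f ∷ x ∷ []) → mk⇔ (λ e → trans e (sym (app-def f x))) (λ e → trans e (app-def f x)) })
        (graph (auto {A = Term₂ (λ f x → the (λ y → pair x y ∈ f))})))) c d

  app-≡ : ∀ {f x y} → pair x y ∈ f → (∀ z → pair x z ∈ f → z ≡ y) → app f x ≡ y
  app-≡ {f} {x} h u = trans (app-def f x) (the-≡ {λ y → pair x y ∈ f} h u)

  app-spec : ∀ {f x} → (∃[ y ] pair x y ∈ f × (∀ z → pair x z ∈ f → z ≡ y)) → pair x (app f x) ∈ f
  app-spec {f} {x} h = subst (λ z → pair x z ∈ f) (sym (app-def f x)) (the-spec {λ y → pair x y ∈ f} h)

  app-value : ∀ f x → pair x (app f x) ∈ f ⊎ app f x ≡ ∅
  app-value f x = by-cases (∃[ y ] pair x y ∈ f × (∀ z → pair x z ∈ f → z ≡ y))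
    (λ h → inj₁ (app-spec h))
    (λ n → inj₂ (trans (app-def f x) (the-∅ {λ y → pair x y ∈ f} n)))

  opaque
    lam : (a : V) (t : V → V) ⦃ d : Term₁ t ⦄ → V
    lam a t ⦃ d ⦄ = img a (λ x → pair x (t x)) ⦃ term-pair {s = head} {λ ρ → t (head ρ)} ⦃ term-v0 ⦄ ⦃ d ⦄ ⦄

    lam-i : {a : V} {t : V → V} {d : Term₁ t} {x : V} → x ∈ a → pair x (t x) ∈ lam a t ⦃ d ⦄
    lam-i {a} {t} {d} {x} h = img-i {a} {λ x → pair x (t x)} {d = term-pair {s = head} {λ ρ → t (head ρ)} ⦃ term-v0 ⦄ ⦃ d ⦄} h

    lam-e : {a : V} {t : V → V} {d : Term₁ t} {u : V} → u ∈ lam a t ⦃ d ⦄ → ∃[ x ] x ∈ a × u ≡ pair x (t x)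
    lam-e {a} {t} {d} h = img-e {a} {λ x → pair x (t x)} {d = term-pair {s = head} {λ ρ → t (head ρ)} ⦃ term-v0 ⦄ ⦃ d ⦄} h

  opaque
    instance
      term-lam : ∀ {n} {a : Env n → V} {t : Env n → V → V} {d : ∀ ρ → Term₁ (t ρ)} →
                 ⦃ Term a ⦄ → ⦃ Term {suc n} (λ ρ → t (tail ρ) (head ρ)) ⦄ →
                 Term (λ ρ → lam (a ρ) (t ρ) ⦃ d ρ ⦄)
      term-lam {a = a} {t} ⦃ c ⦄ ⦃ e ⦄ = term-ext {P = λ ρ w → ∃[ x ] x ∈ a ρ × w ≡ pair x (t ρ x)}
        (λ ρ w → lam-e , λ { (x , h , refl) → lam-i h })
        (c-ex {P = λ ρ x → x ∈ a (tail ρ) × head ρ ≡ pair x (t (tail ρ) x)}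
          (c-and (def-sub₂ {P = _∈_} {head} {λ ρ → a (tail (tail ρ))} auto auto
                   (term (c-weaken {t = λ ρ → a (tail ρ)} (c-weaken {t = a} (graph c)))))
                 (def-sub₃ {P = λ w x y → w ≡ pair x y} {λ ρ → head (tail ρ)} {head}
                           {λ ρ → t (tail (tail ρ)) (head ρ)} auto auto auto
                           (term (c-ren r (λ ρ → head ρ ∷ head (tail ρ) ∷ tail (tail (tail ρ))) r-ok (graph e))))))
        where
          r : ∀ {n} → Fin (suc (suc n)) → Fin (suc (suc (suc n)))
          r zero          = zero
          r (suc zero)    = suc zero
          r (suc (suc i)) = suc (suc (suc i))
          r-ok : ∀ {n} (ρ : Env (suc (suc (suc n)))) i →
                 lookup ρ (r i) ≡ lookup (head ρ ∷ head (tail ρ) ∷ tail (tail (tail ρ))) i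
          r-ok (_ ∷ _ ∷ _ ∷ _) zero          = refl
          r-ok (_ ∷ _ ∷ _ ∷ _) (suc zero)    = refl
          r-ok (_ ∷ _ ∷ _ ∷ _) (suc (suc i)) = refl

  lam-e₂ : ∀ {a t d x y} → pair x y ∈ lam a t ⦃ d ⦄ → x ∈ a × y ≡ t x
  lam-e₂ h with lam-e h
  ... | x′ , x′a , e with pair-inj e
  ... | refl , refl = x′a , refl

  app-lam : ∀ {a t d x} → x ∈ a → app (lam a t ⦃ d ⦄) x ≡ t x
  app-lam h = app-≡ (lam-i h) (λ z k → proj₂ (lam-e₂ k))

  fst snd : V → V
  fst u = the (λ x → ∃[ y ] u ≡ pair x y)
  snd u = the (λ y → ∃[ x ] u ≡ pair x y)

  fst-pair : ∀ {x y} → fst (pair x y) ≡ x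
  fst-pair {x} {y} = the-≡ {λ x′ → ∃[ y′ ] pair x y ≡ pair x′ y′} (y , refl) (λ { z (w , e) → sym (proj₁ (pair-inj e)) })

  snd-pair : ∀ {x y} → snd (pair x y) ≡ y
  snd-pair {x} {y} = the-≡ {λ y′ → ∃[ x′ ] pair x y ≡ pair x′ y′} (x , refl) (λ { z (w , e) → sym (proj₂ (pair-inj e)) })

  -- Well-founded recursion

  -- The relation and the recursion depend on a parameter `c`, and `G c x w` receives the mere set
  -- `w` of the values at the predecessors of `x`. `cover` and `minimal` take the place of
  -- set-likeness and well-foundedness; ∈, its restrictions and membership modulo an ultrafilter all
  -- satisfy them in this form.
  module Recursion
    (E : V → V → V → Set ℓ) (def-E : Def₃ E) (G : V → V → V → V) (term-G : Term₃ G)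
    (cover : ∀ c x → ∃[ T ] x ∈ T × (∀ y z → y ∈ T → E c z y → z ∈ T))
    (minimal : ∀ c T → (∃[ x ] x ∈ T) → ∃[ m ] m ∈ T × (∀ z → E c z m → ¬ z ∈ T))
    where

    private opaque
      instance
        def-E′ : ∀ {n} {s t u : Env n → V} → ⦃ Term s ⦄ → ⦃ Term t ⦄ → ⦃ Term u ⦄ →
                 Code (λ ρ → E (s ρ) (t ρ) (u ρ))
        def-E′ ⦃ c ⦄ ⦃ d ⦄ ⦃ e ⦄ = def-sub₃ {P = E} def-E c d e

        term-G′ : ∀ {n} {s t u : Env n → V} → ⦃ Term s ⦄ → ⦃ Term t ⦄ → ⦃ Term u ⦄ →
                  Term (λ ρ → G (s ρ) (t ρ) (u ρ))
        term-G′ ⦃ c ⦄ ⦃ d ⦄ ⦃ e ⦄ = term-sub₃ {h = G} term-G c d e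

    Values : V → V → V → V → Set ℓ
    Values c h x w = ∀ u → u ∈ w ↔ (∃[ z ] E c z x × u ≡ app h z)

    -- The approximations of the recursion theorem. `h` is any set read through `app`, and only its
    -- values on the closed set `T` count.
    Good : V → V → V → Set ℓ
    Good c T h = (∀ y z → y ∈ T → E c z y → z ∈ T) ×
                 (∀ x → x ∈ T → ∃[ w ] Values c h x w × app h x ≡ G c x w)

    Val : V → V → V → Set ℓ
    Val c x y = ∃[ T ] ∃[ h ] Good c T h × x ∈ T × app h x ≡ y

    opaque
      -- At a minimal point of disagreement of two approximations all earlier values agree, so `G`
      -- is given the same set of values twice.
      val-unique : ∀ {c x y y′} → Val c x y → Val c x y′ → y ≡ y′
      val-unique {c} {x} (T , h , (cl , eq) , xT , refl) (T′ , h′ , (cl′ , eq′) , xT′ , refl) =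
        dne λ n → case minimal c bad (x , sep-i xT (xT′ , n)) of λ (m , mb , min) →
          let (mT , mT′ , ne) = sep-e mb
              same : ∀ z → E c z m → app h z ≡ app h′ z
              same z e = dne λ nz → min z e (sep-i (cl m z mT e) (cl′ m z mT′ e , nz))
              (w , vw , p) = eq m mT
              (w′ , vw′ , p′) = eq′ m mT′
              w≡w′ : w ≡ w′
              w≡w′ = ext
                (λ u uw → let (z , e , q) = proj₁ (vw u) uw in proj₂ (vw′ u) (z , e , trans q (same z e)))
                (λ u uw → let (z , e , q) = proj₁ (vw′ u) uw in proj₂ (vw u) (z , e , trans q (sym (same z e))))
          in ne (trans p (trans (cong (G c m) w≡w′) (sym p′)))
        where
          bad : V
          bad = sep T (λ x → x ∈ T′ × ¬ app h x ≡ app h′ x)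

    opaque
      Valued : V → V → Set ℓ
      Valued c x = ∃[ y ] Val c x y

      valued-i : ∀ {c x y} → Val c x y → Valued c x
      valued-i v = _ , v

      valued-e : ∀ {c x} → Valued c x → ∃[ y ] Val c x y
      valued-e v = v

      def-Valued₂ : Def₂ Valued
      def-Valued₂ = auto

    private opaque
      instance
        def-Valued : ∀ {n} {s t : Env n → V} → ⦃ Term s ⦄ → ⦃ Term t ⦄ → Code (λ ρ → Valued (s ρ) (t ρ))
        def-Valued ⦃ c ⦄ ⦃ d ⦄ = def-sub₂ {P = Valued} def-Valued₂ c d

    opaque
      H : V → V → V
      H c x = the (Val c x)

      H-val : ∀ {c x y} → Val c x y → H c x ≡ y
      H-val {c} {x} v = the-≡ {Val c x} v (λ z k → val-unique k v)

      term-H₂ : Term₂ H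
      term-H₂ = auto

    opaque
      instance
        term-H : ∀ {n} {s t : Env n → V} → ⦃ Term s ⦄ → ⦃ Term t ⦄ → Term (λ ρ → H (s ρ) (t ρ))
        term-H ⦃ c ⦄ ⦃ d ⦄ = term-sub₂ {h = H} term-H₂ c d

    opaque
      -- Let `m` be minimal without a value. The function that is `H c` at the valued points of the
      -- cover and `G c m (w m)` at `m` is then an approximation, so `m` has a value after all.
      all-valued : ∀ c x → Valued c x
      all-valued c x with cover c x
      ... | T , xT , clT = dne λ n → case minimal c bad (x , sep-i xT n) of λ (m , mb , min) →
          let (mT , nm) = sep-e mb
              valued : ∀ z → E c z m → Valued c z
              valued z e = dne λ nz → min z e (sep-i (clT m z mT e) nz)
          in nm (valued-i {y = G c m (w m)} (T₁ m , h₁ m , (closed m mT valued , equation m nm mT valued) ,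
                 sep-i mT (inj₂ refl) , h₁-m m mT))
        where
          bad : V
          bad = sep T (λ x → ¬ Valued c x)
          w T₁ h₁ : V → V
          w m = img (sep T (λ z → E c z m)) (λ z → H c z)
          T₁ m = sep T (λ x → Valued c x ⊎ x ≡ m)
          patched : V → V → V
          patched m v = lam (T₁ m) (λ x → the (λ y → (¬ x ≡ m × y ≡ H c x) ⊎ (x ≡ m × y ≡ v)))
          h₁ m = patched m (G c m (w m))
          h₁-m : ∀ m → m ∈ T → app (h₁ m) m ≡ G c m (w m)
          h₁-m m mT = trans (app-lam (sep-i mT (inj₂ refl)))
            (the-≡ {λ y → (¬ m ≡ m × y ≡ H c m) ⊎ (m ≡ m × y ≡ G c m (w m))} (inj₂ (refl , refl))
                   λ { _ (inj₁ (n , _)) → ⊥-elim (n refl) ; _ (inj₂ (_ , e)) → e })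
          h₁-x : ∀ m x → x ∈ T₁ m → ¬ x ≡ m → app (h₁ m) x ≡ H c x
          h₁-x m x xT ne = trans (app-lam xT)
            (the-≡ {λ y → (¬ x ≡ m × y ≡ H c x) ⊎ (x ≡ m × y ≡ G c m (w m))} (inj₁ (ne , refl))
                   λ { _ (inj₁ (_ , e)) → e ; _ (inj₂ (e , _)) → ⊥-elim (ne e) })
          module _ (m : V) where
            closed : m ∈ T → (∀ z → E c z m → Valued c z) → ∀ y z → y ∈ T₁ m → E c z y → z ∈ T₁ m
            closed mT valued y z yT e with sep-e yT
            ... | yT′ , inj₂ refl = sep-i (clT _ _ mT e) (inj₁ (valued z e))
            ... | yT′ , inj₁ v with valued-e v
            ... | _ , T′ , h′ , (cl , eq) , yT″ , _ =
              sep-i (clT _ _ yT′ e) (inj₁ (valued-i (T′ , h′ , (cl , eq) , cl y z yT″ e , refl)))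
            equation : ¬ Valued c m → m ∈ T → (∀ z → E c z m → Valued c z) →
                       ∀ x → x ∈ T₁ m → ∃[ w ] Values c (h₁ m) x w × app (h₁ m) x ≡ G c x w
            equation nm mT valued x xT with sep-e xT
            ... | _ , inj₂ refl = w m , vals , h₁-m m mT
              where
                at : ∀ z → E c z m → app (h₁ m) z ≡ H c z
                at z e = h₁-x m z (sep-i (clT m z mT e) (inj₁ (valued z e)))
                           (λ { refl → nm (valued z e) })
                vals : Values c (h₁ m) m (w m)
                vals u = (λ uw → let (z , zs , q) = img-e uw ; e = proj₂ (sep-e zs)
                                 in z , e , trans q (sym (at z e))) ,
                         (λ (z , e , q) → subst (_∈ w m) (sym (trans q (at z e)))
                                            (img-i (sep-i (clT m z mT e) e)))
            ... | xT′ , inj₁ vx with valued-e vx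
            ... | y , v@(T′ , h′ , (cl , eq) , xT″ , q) with eq x xT″
            ... | w′ , vals , p = w′ , vals′ , trans (h₁-x m x xT (λ { refl → nm (valued-i v) }))
                                                (trans (H-val v) (trans (sym q) p))
              where
                at : ∀ z → E c z x → app (h₁ m) z ≡ app h′ z
                at z e = let vz : Val c z (app h′ z)
                             vz = T′ , h′ , (cl , eq) , cl x z xT″ e , refl
                         in trans (h₁-x m z (sep-i (clT x z xT′ e) (inj₁ (valued-i vz)))
                                         (λ { refl → nm (valued-i vz) })) (H-val vz)
                vals′ : Values c (h₁ m) x w′
                vals′ u = (λ uw → let (z , e , r) = proj₁ (vals u) uw in z , e , trans r (sym (at z e))) ,
                          (λ (z , e , r) → proj₂ (vals u) (z , e , trans r (at z e)))

    opaque
      H-eq : ∀ c x → ∃[ w ] (∀ u → u ∈ w ↔ (∃[ z ] E c z x × u ≡ H c z)) × H c x ≡ G c x w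
      H-eq c x with valued-e (all-valued c x)
      ... | y , v@(T , h , (cl , eq) , xT , q) with eq x xT
      ... | w , vals , p = w , vals′ , trans (H-val v) (trans (sym q) p)
        where
          at : ∀ z → E c z x → H c z ≡ app h z
          at z e = H-val (T , h , (cl , eq) , cl x z xT e , refl)
          vals′ : ∀ u → u ∈ w ↔ (∃[ z ] E c z x × u ≡ H c z)
          vals′ u = (λ uw → let (z , e , r) = proj₁ (vals u) uw in z , e , trans r (sym (at z e))) ,
                    (λ (z , e , r) → proj₂ (vals u) (z , e , trans r (at z e)))

  record Recursor (E : V → V → V → Set ℓ) (G : V → V → V → V) : Set ℓ where
    no-eta-equality
    field
      H       : V → V → V
      term-H₂ : Term₂ H
      H-eq    : ∀ c x → ∃[ w ] (∀ u → u ∈ w ↔ (∃[ z ] E c z x × u ≡ H c z)) × H c x ≡ G c x w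

    instance
      term-H : ∀ {n} {s t : Env n → V} → ⦃ Term s ⦄ → ⦃ Term t ⦄ → Term (λ ρ → H (s ρ) (t ρ))
      term-H ⦃ c ⦄ ⦃ d ⦄ = term-sub₂ {h = H} term-H₂ c d

  opaque
    recursor : (E : V → V → V → Set ℓ) → Def₃ E → (G : V → V → V → V) → Term₃ G →
               (∀ c x → ∃[ T ] x ∈ T × (∀ y z → y ∈ T → E c z y → z ∈ T)) →
               (∀ c T → (∃[ x ] x ∈ T) → ∃[ m ] m ∈ T × (∀ z → E c z m → ¬ z ∈ T)) → Recursor E G
    recursor E def-E G term-G cover minimal = record
      { H       = Recursion.H E def-E G term-G cover minimal
      ; term-H₂ = Recursion.term-H₂ E def-E G term-G cover minimal
      ; H-eq    = Recursion.H-eq E def-E G term-G cover minimal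
      }

  opaque
    well-founded-induction : (E : V → V → Set ℓ) →
      (∀ x → ∃[ T ] x ∈ T × (∀ y z → y ∈ T → E z y → z ∈ T)) →
      (∀ T → (∃[ x ] x ∈ T) → ∃[ m ] m ∈ T × (∀ z → E z m → ¬ z ∈ T)) →
      (P : V → Set ℓ) → Def₁ P → (∀ x → (∀ z → E z x → P z) → P x) → ∀ x → P x
    well-founded-induction E cover minimal P d step x =
      let (T , xT , cl) = cover x in dne λ n →
      case minimal (sep T (λ x → ¬ P x) ⦃ c-not d ⦄) (x , sep-i xT n) of λ (m , mb , min) →
        let (mT , nm) = sep-e mb
        in nm (step m λ z e → dne λ nz → min z e (sep-i (cl m z mT e) nz))

  -- Agreement with the first-order definitions; foundation and ω

  opaque
    IsUpair⇒ : ∀ {z x y} → R.IsUpair z x y → z ≡ pr x y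
    IsUpair⇒ h = ext (λ w wz → [ (λ { refl → pr-i₁ }) , (λ { refl → pr-i₂ }) ]′ (to (h w tt) wz))
                     (λ w wp → from (h w tt) (pr-e wp))

  opaque
    IsUpair⇐ : ∀ {x y} → R.IsUpair (pr x y) x y
    IsUpair⇐ w _ = mk⇔ pr-e (λ { (inj₁ refl) → pr-i₁ ; (inj₂ refl) → pr-i₂ })

  opaque
    IsPair⇒ : ∀ {p x y} → R.IsPair p x y → p ≡ pair x y
    IsPair⇒ {p} {x} {y} h = trans (ext
      (λ w wp → [ (λ u → subst (_∈ pr (sg x) (pr x y)) (sym (IsUpair⇒ u)) pr-i₁)
                , (λ u → subst (_∈ pr (sg x) (pr x y)) (sym (IsUpair⇒ u)) pr-i₂) ]′ (to (h w tt) wp))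
      (λ w wp → [ (λ { refl → from (h w tt) (inj₁ IsUpair⇐) })
                , (λ { refl → from (h w tt) (inj₂ IsUpair⇐) }) ]′ (pr-e wp)))
      (sym (pair-def x y))

  opaque
    IsPair⇐ : ∀ {x y} → R.IsPair (pair x y) x y
    IsPair⇐ {x} {y} w _ = mk⇔
      (λ h → [ (λ { refl → inj₁ IsUpair⇐ }) , (λ { refl → inj₂ IsUpair⇐ }) ]′
               (pr-e (subst (w ∈_) (pair-def x y) h)))
      (λ h → subst (w ∈_) (sym (pair-def x y))
               ([ (λ u → subst (_∈ pr (sg x) (pr x y)) (sym (IsUpair⇒ u)) pr-i₁)
                , (λ u → subst (_∈ pr (sg x) (pr x y)) (sym (IsUpair⇒ u)) pr-i₂) ]′ h))

  opaque
    App⇒ : ∀ {f x y} → R.App f x y → pair x y ∈ f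
    App⇒ {f} (p , _ , h , pf) = subst (_∈ f) (IsPair⇒ h) pf

  opaque
    App⇐ : ∀ {f x y} → pair x y ∈ f → R.App f x y
    App⇐ h = _ , tt , IsPair⇐ , h

  opaque
    foundation : ∀ T → (∃[ x ] x ∈ T) → ∃[ m ] m ∈ T × (∀ z → z ∈ m → ¬ z ∈ T)
    foundation T (x , xT) with Relative.ZF.foundation (proj₁ zfc) T tt (x , tt , xT)
    ... | m , _ , mT , n = m , mT , λ z zm zT → n (z , tt , zm , zT)

  opaque
    ∈-irrefl : ∀ {x} → ¬ x ∈ x
    ∈-irrefl {x} h with foundation (sg x) (x , sg-i)
    ... | m , ms , n with sg-e ms
    ... | refl = n x h sg-i

  opaque
    ∈-asym : ∀ {x y} → x ∈ y → ¬ y ∈ x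
    ∈-asym {x} {y} h k with foundation (pr x y) (x , pr-i₁)
    ... | m , ms , n with pr-e ms
    ... | inj₁ refl = n y k pr-i₂
    ... | inj₂ refl = n x h pr-i₁

  Trans : V → Set ℓ
  Trans x = ∀ y → y ∈ x → y ⊆ x

  Ind : V → Set ℓ
  Ind u = ∅ ∈ u × (∀ x → x ∈ u → succ x ∈ u)

  IsSucc⇒ : ∀ {s x} → R.IsSucc s x → s ≡ succ x
  IsSucc⇒ h = ext (λ w ws → [ succ-i₁ , (λ { refl → succ-i₂ }) ]′ (to (h w tt) ws))
                  (λ w ws → from (h w tt) (succ-e ws))

  Inductive⇒ : ∀ {u} → R.Inductive u → Ind u
  Inductive⇒ {u} ((e , _ , n , eu) , h) =
    subst (_∈ u) (ext (λ w we → ⊥-elim (n (w , tt , we))) (λ w w∅ → ⊥-elim (∅-e w∅))) eu ,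
    λ x xu → let (s , _ , q , su) = h x tt xu in subst (_∈ u) (IsSucc⇒ q) su

  Inductive⇐ : ∀ {u} → Ind u → R.Inductive u
  Inductive⇐ (e , h) = (∅ , tt , (λ (w , _ , wn) → ∅-e wn) , e) ,
    λ x _ xu → succ x , tt , (λ w _ → mk⇔ succ-e [ succ-i₁ , (λ { refl → succ-i₂ }) ]′) , h x xu

  opaque
    ω : V
    ω = sep (proj₁ (Relative.ZF.infinity (proj₁ zfc))) (λ n → ∀ u → Ind u → n ∈ u)

    ω-Ind : Ind ω
    ω-Ind = let (w , _ , iw) = Relative.ZF.infinity (proj₁ zfc)
                (e , h) = Inductive⇒ iw
            in sep-i e (λ u → proj₁) ,
               λ x xω → let (xw , k) = sep-e xω in sep-i (h x xw) (λ u i → proj₂ i x (k u i))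

    ω-least : ∀ {u} → Ind u → ω ⊆ u
    ω-least i n h = proj₂ (sep-e h) _ i

  opaque
    ω-IsOmega : R.IsOmega ω
    ω-IsOmega = Inductive⇐ ω-Ind , λ u _ i n _ → ω-least (Inductive⇒ i) n

  opaque
    ω-induction : (P : V → Set ℓ) ⦃ d : Def₁ P ⦄ → P ∅ → (∀ n → n ∈ ω → P n → P (succ n)) →
                  ∀ n → n ∈ ω → P n
    ω-induction P z s n h = proj₂ (sep-e (ω-least {sep ω P} (sep-i (proj₁ ω-Ind) z ,
      λ x xs → let (xω , p) = sep-e xs in sep-i (proj₂ ω-Ind x xω) (s x xω p)) n h))

  opaque
    ω-trans : Trans ω
    ω-trans = ω-induction (λ n → n ⊆ ω) (λ w h → ⊥-elim (∅-e h))
      λ n nω h w ws → [ h w , (λ { refl → nω }) ]′ (succ-e ws)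

  -- Transitive covers, ∈-recursion and ranks

  private
    -- ∈-recursion presupposes transitive covers. These are built by ω iterations of the union, for
    -- which recursion along ω is enough; there a cover is at hand because ω is transitive.
    E-ω : V → V → V → Set ℓ
    E-ω c z x = z ∈ x × x ∈ ω

    opaque
      def-E-ω : Def₃ E-ω
      def-E-ω = auto

    G-tc : V → V → V → V
    G-tc c x w = c ∪ ⋃ (⋃ w)

    opaque
      term-G-tc : Term₃ G-tc
      term-G-tc = auto

    opaque
      cover-ω : ∀ c x → ∃[ T ] x ∈ T × (∀ y z → y ∈ T → E-ω c z y → z ∈ T)
      cover-ω c x = ω ∪ sg x , ∪-i₂ sg-i , λ y z _ (zy , yω) → ∪-i₁ (ω-trans y yω z zy)

    opaque
      min-ω : ∀ c T → (∃[ x ] x ∈ T) → ∃[ m ] m ∈ T × (∀ z → E-ω c z m → ¬ z ∈ T)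
      min-ω c T h = let (m , mT , n) = foundation T h in m , mT , λ z (zm , _) → n z zm

    opaque
      tc-recursor : Recursor E-ω G-tc
      tc-recursor = recursor E-ω def-E-ω G-tc term-G-tc cover-ω min-ω

    module TC = Recursor tc-recursor
    open TC using (term-H)

    tc : V → V
    tc c = ⋃ (img ω (λ n → TC.H c n))

    tc-base : ∀ c n → c ⊆ TC.H c n
    tc-base c n y h with TC.H-eq c n
    ... | w , vals , e = subst (y ∈_) (sym e) (∪-i₁ h)

    tc-next : ∀ c n y z → n ∈ ω → y ∈ TC.H c n → z ∈ y → z ∈ TC.H c (succ n)
    tc-next c n y z nω yH zy with TC.H-eq c (succ n)
    ... | w , vals , e = subst (z ∈_) (sym e)
      (∪-i₂ (⋃-i (⋃-i (proj₂ (vals (TC.H c n)) (n , (succ-i₂ , proj₂ ω-Ind n nω) , refl)) yH) zy))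

    ⊆-tc : ∀ c → c ⊆ tc c
    ⊆-tc c x xc = ⋃-i (img-i (proj₁ ω-Ind)) (tc-base c ∅ x xc)

    tc-trans : ∀ c → Trans (tc c)
    tc-trans c y yT z zy with ⋃-e yT
    ... | _ , h , yH with img-e h
    ... | n , nω , refl = ⋃-i (img-i (proj₂ ω-Ind n nω)) (tc-next c n y z nω yH zy)

  opaque
    transitive-cover : ∀ x → ∃[ T ] x ∈ T × Trans T
    transitive-cover x = tc (sg x) , ⊆-tc (sg x) x sg-i , tc-trans (sg x)

  E-∈ : V → V → V → Set ℓ
  E-∈ c z x = z ∈ x

  opaque
    def-E-∈ : Def₃ E-∈
    def-E-∈ = auto

  opaque
    cover-∈ : ∀ c x → ∃[ T ] x ∈ T × (∀ y z → y ∈ T → E-∈ c z y → z ∈ T)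
    cover-∈ c x = let (T , xT , tr) = transitive-cover x in T , xT , λ y z yT zy → tr y yT z zy

  opaque
    min-∈ : ∀ c T → (∃[ x ] x ∈ T) → ∃[ m ] m ∈ T × (∀ z → E-∈ c z m → ¬ z ∈ T)
    min-∈ c T h = foundation T h

  opaque
    ∈-recursor : (G : V → V → V → V) → Term₃ G → Recursor E-∈ G
    ∈-recursor G term-G = recursor E-∈ def-E-∈ G term-G cover-∈ min-∈

  private
    G-V G-rank : V → V → V → V
    G-V c x w = ⋃ (img w 𝒫)
    G-rank c x w = ⋃ (img w succ)

    opaque
      term-G-V : Term₃ G-V
      term-G-V = auto

    opaque
      term-G-rank : Term₃ G-rank
      term-G-rank = auto

    opaque
      stage-recursor : Recursor E-∈ G-V
      stage-recursor = ∈-recursor G-V term-G-V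

      rank-recursor : Recursor E-∈ G-rank
      rank-recursor = ∈-recursor G-rank term-G-rank

    module Stage = Recursor stage-recursor
    module Rank = Recursor rank-recursor

  open Stage using () renaming (term-H to term-stage)
  open Rank using () renaming (term-H to term-rank)

  ∈-induction : (P : V → Set ℓ) ⦃ d : Def₁ P ⦄ → (∀ x → (∀ z → z ∈ x → P z) → P x) → ∀ x → P x
  ∈-induction P ⦃ d ⦄ = well-founded-induction (E-∈ ∅) (cover-∈ ∅) (min-∈ ∅) P d

  -- The cumulative hierarchy, indexed by arbitrary sets.
  stage : V → V
  stage x = Stage.H ∅ x

  opaque
    stage-i : ∀ {x y z} → z ∈ x → y ⊆ stage z → y ∈ stage x
    stage-i {x} {y} {z} zx h with Stage.H-eq ∅ x
    ... | w , vals , e = subst (y ∈_) (sym e) (⋃-i (img-i (proj₂ (vals (stage z)) (z , zx , refl))) (𝒫-i h))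

  rank : V → V
  rank x = Rank.H ∅ x

  opaque
    rank-e : ∀ {x a} → a ∈ rank x → ∃[ z ] z ∈ x × a ∈ succ (rank z)
    rank-e {x} {a} h with Rank.H-eq ∅ x
    ... | w , vals , e with ⋃-e (subst (a ∈_) e h)
    ... | _ , k , as with img-e k
    ... | v , vw , refl with proj₁ (vals v) vw
    ... | z , zx , refl = z , zx , as

  opaque
    rank-i : ∀ {x a z} → z ∈ x → a ∈ succ (rank z) → a ∈ rank x
    rank-i {x} {a} {z} zx h with Rank.H-eq ∅ x
    ... | w , vals , e = subst (a ∈_) (sym e) (⋃-i (img-i (proj₂ (vals (rank z)) (z , zx , refl))) h)

  -- Ordinals

  -- Under foundation a transitive set of transitive sets is well-ordered by ∈. `Ordinal⇒` and
  -- `Ordinal⇐` show the equivalence with the definition by well-orders.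
  O : V → Set ℓ
  O x = Trans x × (∀ y → y ∈ x → Trans y)

  O-elem : ∀ {x y} → O x → y ∈ x → O y
  O-elem {x} {y} (t , h) yx = h y yx , λ z zy → h z (t y yx z zy)

  O-from : ∀ {x} → Trans x → (∀ y → y ∈ x → O y) → O x
  O-from t h = t , λ y yx → proj₁ (h y yx)

  O-succ : ∀ {x} → O x → O (succ x)
  O-succ {x} o@(t , h) =
    (λ y ys z zy → [ (λ yx → succ-i₁ (t y yx z zy)) , (λ { refl → succ-i₁ zy }) ]′ (succ-e ys)) ,
    (λ y ys → [ h y , (λ { refl → t }) ]′ (succ-e ys))

  opaque
    -- Double ∈-induction: if neither ordinal is a member of the other, the two induction hypotheses
    -- show that they have the same members.
    O-trichotomy : ∀ {x y} → O x → O y → x ∈ y ⊎ x ≡ y ⊎ y ∈ x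
    O-trichotomy {x} {y} ox oy = outer x ox y oy
      where
        Tri : V → V → Set ℓ
        Tri x y = x ∈ y ⊎ x ≡ y ⊎ y ∈ x
        inner : ∀ x → O x → (∀ z → z ∈ x → O z → ∀ y → O y → Tri z y) → ∀ y → O y → Tri x y
        inner x ox ih = ∈-induction (λ y → O y → Tri x y) λ y ihy oy →
          by-cases (x ∈ y) inj₁ λ x∉y → by-cases (y ∈ x) (inj₂ ∘ inj₂) λ y∉x → inj₂ (inj₁ (ext
            (λ z zx → case ih z zx (O-elem ox zx) y oy of λ
              { (inj₁ h) → h
              ; (inj₂ (inj₁ refl)) → ⊥-elim (y∉x zx)
              ; (inj₂ (inj₂ h)) → ⊥-elim (y∉x (proj₁ ox z zx y h)) })
            (λ z zy → case ihy z zy (O-elem oy zy) of λ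
              { (inj₁ h) → ⊥-elim (x∉y (proj₁ oy z zy x h))
              ; (inj₂ (inj₁ refl)) → ⊥-elim (x∉y zy)
              ; (inj₂ (inj₂ h)) → h })))
        outer : ∀ x → O x → ∀ y → O y → Tri x y
        outer = ∈-induction (λ x → O x → ∀ y → O y → Tri x y) λ x ih ox → inner x ox ih

  opaque
    O-⊆ : ∀ {x y} → O x → O y → x ⊆ y → x ∈ y ⊎ x ≡ y
    O-⊆ ox oy h with O-trichotomy ox oy
    ... | inj₁ k = inj₁ k
    ... | inj₂ (inj₁ k) = inj₂ k
    ... | inj₂ (inj₂ k) = ⊥-elim (∈-irrefl (h _ k))

  opaque
    O-∉ : ∀ {x y} → O x → O y → ¬ x ∈ y → y ⊆ x
    O-∉ ox oy n with O-trichotomy ox oy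
    ... | inj₁ k = ⊥-elim (n k)
    ... | inj₂ (inj₁ refl) = λ _ z → z
    ... | inj₂ (inj₂ k) = proj₁ ox _ k

  opaque
    O-least : (P : V → Set ℓ) ⦃ d : Def₁ P ⦄ → (∃[ α ] O α × P α) →
              ∃[ α ] O α × P α × (∀ β → β ∈ α → ¬ P β)
    O-least P ⦃ d ⦄ (α , oα , pα) with foundation (sep (succ α) P) (α , sep-i succ-i₂ pα)
    ... | m , mS , n = let (ms , pm) = sep-e mS ; om = O-elem (O-succ oα) ms in
      m , om , pm , λ β βm pβ → n β βm (sep-i (proj₁ (O-succ oα) m ms β βm) pβ)

  opaque
    rank-O : ∀ x → O (rank x)
    rank-O = ∈-induction (λ x → O (rank x)) λ x ih → O-from
      (λ a ar b ba → let (z , zx , as) = rank-e ar in rank-i zx (proj₁ (O-succ (ih z zx)) a as b ba))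
      (λ a ar → let (z , zx , as) = rank-e ar in O-elem (O-succ (ih z zx)) as)

  opaque
    ⊆-stage-rank : ∀ x → x ⊆ stage (rank x)
    ⊆-stage-rank = ∈-induction (λ x → x ⊆ stage (rank x)) λ x ih y yx →
      stage-i (rank-i yx succ-i₂) (ih y yx)

  opaque
    ∈-stage : ∀ x → ∃[ α ] O α × x ∈ stage α
    ∈-stage x = succ (rank x) , O-succ (rank-O x) , stage-i succ-i₂ (⊆-stage-rank x)

  private
    module Choose (A : V) (P : V → V → Set ℓ) (def-P : Def₂ P) where
      private
        opaque
          instance
            def-P′ : ∀ {n} {s t : Env n → V} → ⦃ Term s ⦄ → ⦃ Term t ⦄ → Code (λ ρ → P (s ρ) (t ρ))
            def-P′ ⦃ c ⦄ ⦃ d ⦄ = def-sub₂ {P = P} def-P c d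

      At : V → V → Set ℓ
      At x α = ∃[ y ] y ∈ stage α × P x y

      IsLeast : V → V → Set ℓ
      IsLeast x α = O α × At x α × (∀ β → β ∈ α → ¬ At x β)

      opaque
        least-unique : ∀ {x α β} → IsLeast x α → IsLeast x β → α ≡ β
        least-unique (oα , aα , mα) (oβ , aβ , mβ) with O-trichotomy oα oβ
        ... | inj₁ k = ⊥-elim (mβ _ k aα)
        ... | inj₂ (inj₁ k) = k
        ... | inj₂ (inj₂ k) = ⊥-elim (mα _ k aβ)

      opaque
        B : V → V
        B x = sep (stage (the (IsLeast x))) (P x)

        term-B₁ : Term₁ B
        term-B₁ = auto

        B-e : ∀ {x y} → y ∈ B x → P x y
        B-e h = proj₂ (sep-e h)

        B-nonempty : ∀ {x} → (∃[ y ] P x y) → ∃[ y ] y ∈ B x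
        B-nonempty {x} (y , p) =
          let (α , oα , yα) = ∈-stage y
              (β , oβ , (z , zβ , q) , mβ) = O-least (At x) (α , oα , y , yα , p)
          in z , sep-i (subst (λ γ → z ∈ stage γ)
                         (sym (the-≡ {IsLeast x} {β} (oβ , (z , zβ , q) , mβ)
                           (λ γ l → least-unique l (oβ , (z , zβ , q) , mβ)))) zβ) q

      private
        opaque
          instance
            term-B : ∀ {n} {s : Env n → V} → ⦃ Term s ⦄ → Term (λ ρ → B (s ρ))
            term-B ⦃ c ⦄ = term-sub₁ {h = B} term-B₁ c

      opaque
        result : (∀ x → x ∈ A → ∃[ y ] P x y) → ∃[ f ] (∀ x → x ∈ A → P x (app f x))
        result h with proj₂ zfc (img A B) tt (λ X _ XF → let (x , xA , e) = img-e XF ; (y , yB) = B-nonempty (h x xA)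
                                                 in y , tt , subst (y ∈_) (sym e) yB)
        ... | g , _ , (_ , fun) , sel = lam A (λ x → app g (B x)) , λ x xA →
          let (y , _ , a , u) = fun (B x) tt (img-i xA)
              e : app g (B x) ≡ y
              e = app-≡ (App⇒ a) (λ z k → u z tt (App⇐ k))
          in subst (P x) (sym (trans (app-lam xA) e)) (B-e (sel (B x) y tt tt (img-i xA) a))

  -- Choice of witnesses from proper classes: the witnesses of least rank form a set.
  opaque
    choose : (A : V) (P : V → V → Set ℓ) ⦃ d : Def₂ P ⦄ → (∀ x → x ∈ A → ∃[ y ] P x y) →
             ∃[ f ] (∀ x → x ∈ A → P x (app f x))
    choose A P ⦃ d ⦄ = Choose.result A P d

  opaque
    Ordinal⇒ : ∀ {x} → R.Ordinal x → O x
    Ordinal⇒ {x} (t , wo) = (λ y yx z zy → t y tt yx z tt zy) , λ y yx z zy w wz →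
      let zx = t y tt yx z tt zy
      in R.WellOrderedBy∈.trans wo w z y tt tt tt (t z tt zx w tt wz) zx yx wz zy

  opaque
    Ordinal⇐ : ∀ {x} → O x → R.Ordinal x
    Ordinal⇐ {x} o@(t , h) = (λ y _ yx z _ zy → t y yx z zy) , record
      { irrefl     = λ y _ _ → ∈-irrefl
      ; trans      = λ y z w _ _ _ _ _ wx yz zw → h w wx z zw y yz
      ; trichotomy = λ y z _ _ yx zx → O-trichotomy (O-elem o yx) (O-elem o zx)
      ; least      = λ s _ s⊆x (e , _ , es) →
          let (m , ms , n) = foundation s (e , es) ; mx = s⊆x m tt ms in
          m , tt , ms , λ y _ ys → case O-trichotomy (O-elem o (s⊆x y tt ys)) (O-elem o mx) of λ
            { (inj₁ k) → ⊥-elim (n y k ys) ; (inj₂ k) → k }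
      }

  -- Cardinals

  -- Here `f` may be any set, read through `app`; `Eqn⇐` trims it to a set of pairs with domain `a`.
  Bij : V → V → V → Set ℓ
  Bij f a b = (∀ x → x ∈ a → app f x ∈ b) ×
              (∀ x x′ → x ∈ a → x′ ∈ a → app f x ≡ app f x′ → x ≡ x′) ×
              (∀ y → y ∈ b → ∃[ x ] x ∈ a × app f x ≡ y)

  Eqn : V → V → Set ℓ
  Eqn a b = ∃[ f ] Bij f a b

  opaque
    lam-FunctionOn : ∀ {a t d} → R.FunctionOn (lam a t ⦃ d ⦄) a
    lam-FunctionOn {t = t} =
      (λ p _ pf → let (x , xa , e) = lam-e pf in
         x , t x , tt , tt , xa , subst (λ p → R.IsPair p x (t x)) (sym e) IsPair⇐) ,
      (λ x _ xa → t x , tt , App⇐ (lam-i xa) , λ y′ _ h → proj₂ (lam-e₂ (App⇒ h)))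

  opaque
    fun-app : ∀ {f a x y} → R.FunctionOn f a → x ∈ a → pair x y ∈ f → app f x ≡ y
    fun-app (_ , h) xa k = let (_ , _ , _ , u) = h _ tt xa in
      app-≡ k λ z kz → trans (u z tt (App⇐ kz)) (sym (u _ tt (App⇐ k)))

  opaque
    fun-pair : ∀ {f a x} → R.FunctionOn f a → x ∈ a → pair x (app f x) ∈ f
    fun-pair {f} fo@(_ , h) xa = let (y , _ , k , u) = h _ tt xa in
      app-spec (y , App⇒ k , λ z kz → u z tt (App⇐ kz))

  opaque
    Eqn⇒ : ∀ {a b} → R.Equinumerous a b → Eqn a b
    Eqn⇒ (f , _ , ((fo , into) , inj) , sur) = f ,
      (λ x xa → into x _ tt tt (App⇐ (fun-pair fo xa))) ,
      (λ x x′ xa xa′ e → inj x x′ _ tt tt tt (App⇐ (fun-pair fo xa))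
                            (App⇐ (subst (λ y → pair x′ y ∈ f) (sym e) (fun-pair fo xa′)))) ,
      (λ y yb → let (x , _ , xa , k) = sur y tt yb in x , xa , fun-app fo xa (App⇒ k))

  opaque
    Eqn⇐ : ∀ {a b} → Eqn a b → R.Equinumerous a b
    Eqn⇐ {a} {b} (f , into , inj , sur) = lam a (λ x → app f x) , tt ,
      ((lam-FunctionOn , λ x y _ _ h → let (xa , e) = lam-e₂ (App⇒ h) in subst (_∈ b) (sym e) (into x xa)) ,
       λ x x′ y _ _ _ h h′ → let (xa , e) = lam-e₂ (App⇒ h) ; (xa′ , e′) = lam-e₂ (App⇒ h′)
                             in inj x x′ xa xa′ (trans (sym e) e′)) ,
      λ y _ yb → let (x , xa , e) = sur y yb in
        x , tt , xa , App⇐ (subst (λ y → pair x y ∈ lam a (λ x → app f x)) e (lam-i xa))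

  opaque
    Eqn-refl : ∀ {a} → Eqn a a
    Eqn-refl {a} = lam a (λ x → x) ,
      (λ x xa → subst (_∈ a) (sym (app-lam xa)) xa) ,
      (λ x x′ xa xa′ e → trans (sym (app-lam xa)) (trans e (app-lam xa′))) ,
      (λ y ya → y , ya , app-lam ya)

  opaque
    Eqn-trans : ∀ {a b c} → Eqn a b → Eqn b c → Eqn a c
    Eqn-trans {a} {b} {c} (f , f₁ , f₂ , f₃) (g , g₁ , g₂ , g₃) = lam a (λ x → app g (app f x)) ,
      (λ x xa → subst (_∈ c) (sym (app-lam xa)) (g₁ _ (f₁ x xa))) ,
      (λ x x′ xa xa′ e → f₂ x x′ xa xa′ (g₂ _ _ (f₁ x xa) (f₁ x′ xa′)
                            (trans (sym (app-lam xa)) (trans e (app-lam xa′))))) ,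
      (λ z zc → let (y , yb , e) = g₃ z zc ; (x , xa , e′) = f₃ y yb
                in x , xa , trans (app-lam xa) (trans (cong (app g) e′) e))

  opaque
    Eqn-sym : ∀ {a b} → Eqn a b → Eqn b a
    Eqn-sym {a} {b} (f , f₁ , f₂ , f₃) = lam b (λ y → the (λ x → x ∈ a × app f x ≡ y)) ,
      (λ y yb → subst (_∈ a) (sym (app-lam yb)) (proj₁ (inv y yb))) ,
      (λ y y′ yb yb′ e → trans (sym (proj₂ (inv y yb))) (trans (cong (app f)
          (trans (sym (app-lam yb)) (trans e (app-lam yb′)))) (proj₂ (inv y′ yb′)))) ,
      (λ x xa → app f x , f₁ x xa , trans (app-lam (f₁ x xa))
          (the-≡ {λ x′ → x′ ∈ a × app f x′ ≡ app f x} (xa , refl) λ z (za , e) → f₂ z x za xa e))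
      where
        inv : ∀ y → y ∈ b → the (λ x → x ∈ a × app f x ≡ y) ∈ a ×
                            app f (the (λ x → x ∈ a × app f x ≡ y)) ≡ y
        inv y yb = let (x , xa , e) = f₃ y yb in the-spec {λ x → x ∈ a × app f x ≡ y}
          (x , (xa , e) , λ z (za , e′) → f₂ z x za xa (trans e′ (sym e)))

  -- Schröder-Bernstein, well-ordering and cardinalities

  opaque
    -- The bijection is `f` on the points that arise from outside `β` by iterating `f`, and the
    -- identity elsewhere.
    bernstein : ∀ {θ β} → β ⊆ θ → ∀ f → (∀ x → x ∈ θ → app f x ∈ β) →
                (∀ x x′ → x ∈ θ → x′ ∈ θ → app f x ≡ app f x′ → x ≡ x′) → Eqn θ β
    bernstein {θ} {β} β⊆θ f f₁ f₂ = lam θ g ,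
        (λ x xθ → subst (_∈ β) (sym (app-lam xθ)) (g-into x xθ)) ,
        (λ x x′ xθ xθ′ e → g-inj x x′ xθ xθ′ (trans (sym (app-lam xθ)) (trans e (app-lam xθ′)))) ,
        λ y yβ → let (x , xθ , e) = g-sur y yβ in x , xθ , trans (app-lam xθ) e
      where
        Closed : V → Set ℓ
        Closed D = ∀ x → x ∈ θ → (¬ x ∈ β ⊎ (∃[ z ] z ∈ D × x ≡ app f z)) → x ∈ D
        -- The least superset of θ ∖ β closed under f.
        opaque
          C : V
          C = sep θ (λ x → ∀ D → Closed D → x ∈ D)
          C-e : ∀ {x} → x ∈ C → x ∈ θ × (∀ D → Closed D → x ∈ D)
          C-e = sep-e
          C-i : ∀ {x} → x ∈ θ → (∀ D → Closed D → x ∈ D) → x ∈ C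
          C-i = sep-i
        g : V → V
        g x = the (λ y → (x ∈ C × y ≡ app f x) ⊎ (¬ x ∈ C × y ≡ x))
        g-C : ∀ {x} → x ∈ C → g x ≡ app f x
        g-C {x} h = the-≡ {λ y → (x ∈ C × y ≡ app f x) ⊎ (¬ x ∈ C × y ≡ x)} (inj₁ (h , refl))
          λ { _ (inj₁ (_ , e)) → e ; _ (inj₂ (n , _)) → ⊥-elim (n h) }
        g-¬C : ∀ {x} → ¬ x ∈ C → g x ≡ x
        g-¬C {x} n = the-≡ {λ y → (x ∈ C × y ≡ app f x) ⊎ (¬ x ∈ C × y ≡ x)} (inj₂ (n , refl))
          λ { _ (inj₁ (h , _)) → ⊥-elim (n h) ; _ (inj₂ (_ , e)) → e }
        C-out : ∀ {x} → x ∈ θ → ¬ x ∈ β → x ∈ C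
        C-out xθ n = C-i xθ λ D cl → cl _ xθ (inj₁ n)
        C-f : ∀ {x} → x ∈ C → app f x ∈ C
        C-f {x} h = let (xθ , k) = C-e h in C-i (β⊆θ _ (f₁ x xθ)) λ D cl →
          cl _ (β⊆θ _ (f₁ x xθ)) (inj₂ (x , k D cl , refl))
        C-β : ∀ {x} → x ∈ C → x ∈ β → ∃[ z ] z ∈ C × x ≡ app f z
        C-β {x} h xβ = dne λ n →
          -- If `x` were not a value of `f` on `C`, then `C` without `x` would still be closed,
          -- against the minimality of `C`.
          let D = sep C (λ y → ¬ y ≡ x)
              cl : Closed D
              cl y yθ k = sep-i
                (case k of λ { (inj₁ nβ) → C-out yθ nβ ; (inj₂ (z , zD , refl)) → C-f (proj₁ (sep-e zD)) })
                (λ { refl → case k of λ { (inj₁ nβ) → nβ xβ ; (inj₂ (z , zD , e)) → n (z , proj₁ (sep-e zD) , e) } })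
          in proj₂ (sep-e (proj₂ (C-e h) D cl)) refl
        g-into : ∀ x → x ∈ θ → g x ∈ β
        g-into x xθ = by-cases (x ∈ C) (λ h → subst (_∈ β) (sym (g-C h)) (f₁ x xθ))
          λ n → subst (_∈ β) (sym (g-¬C n)) (dne λ nβ → n (C-out xθ nβ))
        g-inj : ∀ x x′ → x ∈ θ → x′ ∈ θ → g x ≡ g x′ → x ≡ x′
        g-inj x x′ xθ xθ′ e = by-cases (x ∈ C)
          (λ h → by-cases (x′ ∈ C)
            (λ h′ → f₂ x x′ xθ xθ′ (trans (sym (g-C h)) (trans e (g-C h′))))
            (λ n′ → ⊥-elim (n′ (subst (_∈ C) (trans (sym (g-C h)) (trans e (g-¬C n′))) (C-f h)))))
          (λ n → by-cases (x′ ∈ C)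
            (λ h′ → ⊥-elim (n (subst (_∈ C) (sym (trans (sym (g-¬C n)) (trans e (g-C h′)))) (C-f h′))))
            (λ n′ → trans (sym (g-¬C n)) (trans e (g-¬C n′))))
        g-sur : ∀ y → y ∈ β → ∃[ x ] x ∈ θ × g x ≡ y
        g-sur y yβ = by-cases (y ∈ C)
          (λ h → let (z , zC , e) = C-β h yβ in z , proj₁ (C-e zC) , trans (g-C zC) (sym e))
          (λ n → y , β⊆θ y yβ , g-¬C n)

  -- Zermelo's transfinite enumeration: `en ξ` is the chosen element among those not yet listed. The
  -- choice function is a parameter because `Cover` enumerates with one that prefers elements of an
  -- early stage.
  module Enumeration (A ch : V) (ch-∈ : ∀ Y → Y ⊆ A → (∃[ y ] y ∈ Y) → app ch Y ∈ Y) where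
    private
      G : V → V → V → V
      G c x w = app ch (sep A (λ y → ¬ y ∈ w))

      opaque
        term-G : Term₃ G
        term-G = auto

      opaque
        en-recursor : Recursor E-∈ G
        en-recursor = ∈-recursor G term-G

      module E = Recursor en-recursor
      open E using () renaming (term-H to term-en)

    opaque
      en : V → V
      en x = E.H ∅ x

      term-en₁ : Term₁ en
      term-en₁ = auto

    private opaque
      instance
        term-en′ : ∀ {n} {s : Env n → V} → ⦃ Term s ⦄ → Term (λ ρ → en (s ρ))
        term-en′ ⦃ c ⦄ = term-sub₁ {h = en} term-en₁ c

    opaque
      Rem : V → V
      Rem x = sep A (λ y → ¬ (∃[ z ] z ∈ x × y ≡ en z))

      Rem-e : ∀ {x y} → y ∈ Rem x → y ∈ A × ¬ (∃[ z ] z ∈ x × y ≡ en z)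
      Rem-e = sep-e

      Rem-i : ∀ {x y} → y ∈ A → ¬ (∃[ z ] z ∈ x × y ≡ en z) → y ∈ Rem x
      Rem-i = sep-i

    opaque
      unfolding en
      en-≡ : ∀ x → en x ≡ app ch (Rem x)
      en-≡ x = let (w , vals , e) = E.H-eq ∅ x in trans e (cong (app ch) (ext
        (λ y h → let (yA , n) = sep-e h in Rem-i yA λ (z , zx , q) → n (proj₂ (vals y) (z , zx , q)))
        (λ y h → let (yA , n) = Rem-e h in sep-i yA λ yw → let (z , zx , q) = proj₁ (vals y) yw in n (z , zx , q))))

    opaque
      en-∈ : ∀ {x} → (∃[ y ] y ∈ Rem x) → en x ∈ Rem x
      en-∈ {x} h = subst (_∈ Rem x) (sym (en-≡ x)) (ch-∈ (Rem x) (λ y k → proj₁ (Rem-e k)) h)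

    opaque
      en-inj : ∀ {α β} → O α → O β → (∃[ y ] y ∈ Rem α) → (∃[ y ] y ∈ Rem β) → en α ≡ en β → α ≡ β
      en-inj oα oβ nα nβ e = case O-trichotomy oα oβ of λ
        { (inj₁ k) → ⊥-elim (proj₂ (Rem-e (en-∈ nβ)) (_ , k , sym e))
        ; (inj₂ (inj₁ k)) → k
        ; (inj₂ (inj₂ k)) → ⊥-elim (proj₂ (Rem-e (en-∈ nα)) (_ , k , e)) }

    opaque
      -- The Burali-Forti argument: if elements remained at every ordinal, `en` would be injective
      -- on all ordinals, and replacement along its inverse would collect them into a set.
      en-exhausts : ∃[ θ ] O θ × (¬ (∃[ y ] y ∈ Rem θ)) × (∀ ξ → ξ ∈ θ → ∃[ y ] y ∈ Rem ξ)
      en-exhausts =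
        let (θ , oθ , n , least) = O-least (λ θ → ∀ y → y ∈ A → ∃[ z ] z ∈ θ × y ≡ en z) (dne burali-forti)
        in θ , oθ , (λ (y , h) → let (yA , k) = Rem-e h in k (n y yA)) ,
           λ ξ ξθ → dne λ k → least ξ ξθ λ y yA → dne λ q → k (y , Rem-i yA q)
        where
          burali-forti : ¬ ¬ (∃[ θ ] O θ × (∀ y → y ∈ A → ∃[ z ] z ∈ θ × y ≡ en z))
          burali-forti none =
            let left : ∀ {ξ} → O ξ → ∃[ y ] y ∈ Rem ξ
                left {ξ} oξ = dne λ k → none (ξ , oξ , λ y yA → dne λ q → k (y , Rem-i yA q))
                (S , hS) = repl A (λ y ξ → O ξ × y ≡ en ξ)
                  (λ y ξ ξ′ _ (o , e) (o′ , e′) → en-inj o o′ (left o) (left o′) (trans (sym e) e′))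
                all : ∀ ξ → O ξ → ξ ∈ S
                all ξ o = proj₂ (hS ξ) (en ξ , proj₁ (Rem-e (en-∈ (left o))) , o , refl)
                ord : ∀ ξ → ξ ∈ S → O ξ
                ord ξ h = let (_ , _ , o , _) = proj₁ (hS ξ) h in o
                oS : O S
                oS = O-from (λ ξ h ζ ζξ → all ζ (O-elem (ord ξ h) ζξ)) ord
            in ∈-irrefl (all S oS)

    opaque
      en-Bij : ∃[ θ ] O θ × Eqn θ A
      en-Bij =
        let (θ , oθ , n , left) = en-exhausts in θ , oθ , lam θ en ⦃ term-en₁ ⦄ ,
          (λ ξ ξθ → subst (_∈ A) (sym (app-lam ξθ)) (proj₁ (Rem-e (en-∈ (left ξ ξθ))))) ,
          (λ ξ ζ ξθ ζθ e → en-inj (O-elem oθ ξθ) (O-elem oθ ζθ) (left ξ ξθ) (left ζ ζθ)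
                             (trans (sym (app-lam ξθ)) (trans e (app-lam ζθ)))) ,
          λ y yA → let (z , zθ , e) = dne (λ q → n (y , Rem-i yA q)) in z , zθ , trans (app-lam zθ) (sym e)

  opaque
    choice-function : (A : V) (P : V → V → Set ℓ) ⦃ d : Def₂ P ⦄ →
                      (∀ Y → Y ⊆ A → (∃[ y ] y ∈ Y) → ∃[ y ] y ∈ Y × P Y y) →
                      ∃[ ch ] (∀ Y → Y ⊆ A → (∃[ y ] y ∈ Y) → app ch Y ∈ Y × P Y (app ch Y))
    choice-function A P ⦃ d ⦄ h =
      let (f , hf) = choose (𝒫 A) (λ Y y → (∃[ y ] y ∈ Y) → y ∈ Y × P Y y) ⦃ def ⦄
            (λ Y YA → by-cases (∃[ y ] y ∈ Y) (λ ne → let (y , r) = h Y (𝒫-e YA) ne in y , λ _ → r)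
                                              (λ n → ∅ , λ ne → ⊥-elim (n ne)))
      in f , λ Y Y⊆A ne → hf Y (𝒫-i Y⊆A) ne
      where
        def : Def₂ (λ Y y → (∃[ y ] y ∈ Y) → y ∈ Y × P Y y)
        def = c-imp auto (c-and auto d)

  opaque
    well-ordering : ∀ A → ∃[ θ ] O θ × Eqn θ A
    well-ordering A = let (ch , h) = choice-function A (λ Y y → y ≡ y) (λ Y _ (y , yY) → y , yY , refl)
                      in Enumeration.en-Bij A ch (λ Y s ne → proj₁ (h Y s ne))

  Card : V → Set ℓ
  Card μ = O μ × (∀ β → β ∈ μ → ¬ Eqn β μ)

  Cardinal⇐ : ∀ {μ} → Card μ → R.Cardinal μ
  Cardinal⇐ (o , h) = Ordinal⇐ o , λ β _ βμ e → h β βμ (Eqn⇒ e)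

  Cardinal⇒ : ∀ {μ} → R.Cardinal μ → Card μ
  Cardinal⇒ (o , h) = Ordinal⇒ o , λ β βμ e → h β tt βμ (Eqn⇐ e)

  opaque
    cardinality : ∀ A → ∃[ μ ] Card μ × Eqn A μ × (∀ β → O β → Eqn A β → ¬ β ∈ μ)
    cardinality A =
      let (θ , oθ , e) = well-ordering A
          (μ , oμ , q , least) = O-least (λ μ → Eqn A μ) (θ , oθ , Eqn-sym e)
      in μ , (oμ , λ β βμ e → least β βμ (Eqn-trans q (Eqn-sym e))) , q , λ β _ e βμ → least β βμ e

  -- Size is bounded by a map whose values on `β` include `A`. In this form the bound passes
  -- directly to subsets and images, including empty ones.
  _≼_ : V → V → Set ℓ
  A ≼ β = ∃[ h ] (∀ y → y ∈ A → ∃[ ξ ] ξ ∈ β × app h ξ ≡ y)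

  opaque
    Eqn⇒≼ : ∀ {A β} → Eqn β A → A ≼ β
    Eqn⇒≼ (f , _ , _ , sur) = f , sur

  opaque
    -- A right inverse of the covering map injects `A` into `β`. Were `β` below the least ordinal
    -- `μ` equinumerous with `A`, `bernstein` would make `A` equinumerous with `β`.
    cardinality-≼ : ∀ {A β} → O β → A ≼ β → ∃[ μ ] Card μ × Eqn A μ × (μ ∈ β ⊎ μ ≡ β)
    cardinality-≼ {A} {β} oβ (h , sur) =
      let (μ , cμ , e , least) = cardinality A
          (g , g₁ , g₂ , g₃) = Eqn-sym e
          (s , hs) = choose A (λ y ξ → ξ ∈ β × app h ξ ≡ y) sur
          f = lam μ (λ x → app s (app g x))
          f-app : ∀ {x} → x ∈ μ → app f x ≡ app s (app g x)
          f-app xμ = app-lam xμ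
      in μ , cμ , e , (case O-trichotomy (proj₁ cμ) oβ of λ
        { (inj₁ k) → inj₁ k
        ; (inj₂ (inj₁ k)) → inj₂ k
        ; (inj₂ (inj₂ k)) → ⊥-elim (least β oβ (Eqn-trans e (bernstein (proj₁ (proj₁ cμ) β k) f
             (λ x xμ → subst (_∈ β) (sym (f-app xμ)) (proj₁ (hs _ (g₁ x xμ))))
             (λ x x′ xμ xμ′ q → g₂ x x′ xμ xμ′ (trans (sym (proj₂ (hs _ (g₁ x xμ))))
                (trans (cong (app h) (trans (sym (f-app xμ)) (trans q (f-app xμ′)))) (proj₂ (hs _ (g₁ x′ xμ′)))))))) k) })

  opaque
    ≼⇒CardLess : ∀ {A β κ} → O κ → β ∈ κ → A ≼ β → R.CardLess A κ
    ≼⇒CardLess oκ βκ h = let (μ , cμ , e , le) = cardinality-≼ (O-elem oκ βκ) h in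
      μ , tt , Cardinal⇐ cμ , Eqn⇐ e , [ (λ k → proj₁ oκ _ βκ μ k) , (λ q → subst (_∈ _) (sym q) βκ) ]′ le

  opaque
    CardLess⇒≼ : ∀ {A κ} → R.CardLess A κ → ∃[ β ] β ∈ κ × A ≼ β
    CardLess⇒≼ (μ , _ , _ , e , μκ) = μ , μκ , Eqn⇒≼ (Eqn-sym (Eqn⇒ e))

  opaque
    cantor : ∀ {x} → ¬ 𝒫 x ≼ x
    cantor {x} (h , sur) =
      let D = sep x (λ ξ → ¬ ξ ∈ app h ξ)
          (ξ , ξx , e) = sur D (𝒫-i λ z zD → proj₁ (sep-e zD))
          no : ¬ ξ ∈ D
          no ξD = proj₂ (sep-e ξD) (subst (ξ ∈_) (sym e) ξD)
      in no (sep-i ξx λ k → no (subst (ξ ∈_) e k))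

  opaque
    -- Cantor's theorem provides a cardinal above `κ`, hence a least one; an ordinal below that one
    -- has cardinality at most `κ`.
    successor-cardinal : ∀ κ → O κ → ∃[ κ⁺ ] IsSuccessorCardinal κ⁺ κ × O κ⁺ × (∀ α → α ∈ κ⁺ → α ≼ κ)
    successor-cardinal κ oκ =
      let (μ , cμ , e , _) = cardinality (𝒫 κ)
          big : ¬ (μ ⊆ κ)
          big s = let (h , sur) = Eqn⇒≼ (Eqn-sym e) in
                  cantor (h , λ y yP → let (ξ , ξμ , q) = sur y yP in ξ , s ξ ξμ , q)
          κμ : κ ∈ μ
          κμ = case O-trichotomy oκ (proj₁ cμ) of λ
            { (inj₁ k) → k ; (inj₂ (inj₁ q)) → ⊥-elim (big λ z → subst (z ∈_) (sym q))
            ; (inj₂ (inj₂ k)) → ⊥-elim (big (proj₁ oκ μ k)) }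
          (κ⁺ , o⁺ , (c⁺ , κ∈) , least) = O-least (λ μ → Card μ × κ ∈ μ) (μ , proj₁ cμ , cμ , κμ)
      in κ⁺ , (Cardinal⇐ c⁺ , κ∈ , λ ν cν κν → case O-trichotomy o⁺ (proj₁ (Cardinal⇒ cν)) of λ
                 { (inj₁ k) → inj₂ k ; (inj₂ (inj₁ k)) → inj₁ k
                 ; (inj₂ (inj₂ k)) → ⊥-elim (least ν k (Cardinal⇒ cν , κν)) }) ,
         o⁺ , λ α α⁺ →
           let oα = O-elem o⁺ α⁺
               (ν , cν , q , lν) = cardinality α
               ν⁺ : ν ∈ κ⁺
               ν⁺ = case O-trichotomy (proj₁ cν) oα of λ
                 { (inj₁ k) → proj₁ o⁺ α α⁺ ν k ; (inj₂ (inj₁ r)) → subst (_∈ κ⁺) (sym r) α⁺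
                 ; (inj₂ (inj₂ k)) → ⊥-elim (lν α oα Eqn-refl k) }
               ν⊆κ : ν ⊆ κ
               ν⊆κ = O-∉ oκ (proj₁ cν) (λ k → least ν ν⁺ (cν , k))
               (h , sur) = Eqn⇒≼ (Eqn-sym q)
           in h , λ y yα → let (ξ , ξν , r) = sur y yα in ξ , ν⊆κ ξ ξν , r

  -- Sets of size less than κ

  module Compact (κ : V)
                 (κ-compact-cardinal : Relative.Cardinal Univ κ × Uncountable κ × Regular κ × IsCompact κ) where

    κ-card : Relative.Cardinal Univ κ
    κ-card = proj₁ κ-compact-cardinal

    κ-unc : Uncountable κ
    κ-unc = proj₁ (proj₂ κ-compact-cardinal)

    κ-reg : Regular κ
    κ-reg = proj₁ (proj₂ (proj₂ κ-compact-cardinal))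

    κ-compact : IsCompact κ
    κ-compact = proj₂ (proj₂ (proj₂ κ-compact-cardinal))

    _∖_ : V → V → V
    A ∖ B = sep A (λ x → ¬ x ∈ B)

    meet : V → V → V
    meet A 𝒳 = sep A (λ p → ∀ X → X ∈ 𝒳 → p ∈ X)

    oκ : O κ
    oκ = Ordinal⇒ (proj₁ κ-card)

    opaque
      ω-O : O ω
      ω-O = O-from ω-trans (λ n nω → ω-induction O ((λ y h → ⊥-elim (∅-e h)) , λ y h → ⊥-elim (∅-e h))
                                      (λ n _ → O-succ) n nω)

    opaque
      ω∈κ : ω ∈ κ
      ω∈κ = dne λ n →
        let κ⊆ω = O-∉ ω-O oκ n in
        κ-unc ω ω-IsOmega (lam κ (λ x → x) , (lam-FunctionOn ,
          λ x y _ _ h → let (xκ , e) = lam-e₂ (App⇒ h) in subst (_∈ ω) (sym e) (κ⊆ω x xκ)) ,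
          λ x x′ y _ _ _ h h′ → trans (sym (proj₂ (lam-e₂ (App⇒ h)))) (proj₂ (lam-e₂ (App⇒ h′))))

    ∅∈κ : ∅ ∈ κ
    ∅∈κ = proj₁ oκ ω ω∈κ ∅ (proj₁ ω-Ind)

    opaque
      ≼-⊆ : ∀ {A B β} → A ⊆ B → B ≼ β → A ≼ β
      ≼-⊆ s (h , sur) = h , λ y yA → sur y (s y yA)

    opaque
      ≼-img : ∀ {A β} (t : V → V) ⦃ d : Term₁ t ⦄ → A ≼ β → img A t ≼ β
      ≼-img {A} {β} t ⦃ d ⦄ (h , sur) = lam β (λ ξ → t (app h ξ)) ⦃ th ⦄ , λ y yi →
        let (x , xA , e) = img-e yi ; (ξ , ξβ , q) = sur x xA in
        ξ , ξβ , trans (app-lam ξβ) (trans (cong t q) (sym e))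
        where
          th : Term₁ (λ ξ → t (app h ξ))
          th = term-sub₁ {h = t} d auto

    opaque
      ≼-refl : ∀ {β} → β ≼ β
      ≼-refl {β} = lam β (λ x → x) , λ y yβ → y , yβ , app-lam yβ

    Small : V → Set ℓ
    Small x = ∃[ β ] β ∈ κ × x ≼ β

    opaque
      small-⊆ : ∀ {A B} → A ⊆ B → Small B → Small A
      small-⊆ s (β , βκ , h) = β , βκ , ≼-⊆ s h

    opaque
      small-img : ∀ {A} (t : V → V) ⦃ d : Term₁ t ⦄ → Small A → Small (img A t)
      small-img t (β , βκ , h) = β , βκ , ≼-img t h

    opaque
      small-∈κ : ∀ {β} → β ∈ κ → Small β
      small-∈κ βκ = _ , βκ , ≼-refl

    opaque
      small-CardLess : ∀ {x} → Small x → R.CardLess x κ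
      small-CardLess (β , βκ , h) = ≼⇒CardLess oκ βκ h

    opaque
      CardLess-small : ∀ {x} → R.CardLess x κ → Small x
      CardLess-small h = CardLess⇒≼ h

    opaque
      small-pr : ∀ {x y} → Small (pr x y)
      small-pr {x} {y} = succ (succ ∅) , proj₁ oκ ω ω∈κ _ (proj₂ ω-Ind _ (proj₂ ω-Ind _ (proj₁ ω-Ind))) ,
        two (succ (succ ∅)) , λ z zp → case pr-e zp of λ
          { (inj₁ e) → ∅ , succ-i₁ succ-i₂ , trans (app-lam (succ-i₁ succ-i₂))
              (the-≡ {Q ∅} (inj₁ (refl , e)) λ { _ (inj₁ (_ , q)) → trans q (sym e) ; _ (inj₂ (n , _)) → ⊥-elim (n refl) })
          ; (inj₂ e) → succ ∅ , succ-i₂ , trans (app-lam succ-i₂)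
              (the-≡ {Q (succ ∅)} (inj₂ (ne , e)) λ { _ (inj₁ (q , _)) → ⊥-elim (ne q) ; _ (inj₂ (_ , q)) → trans q (sym e) }) }
        where
          Q : V → V → Set ℓ
          Q ξ z = (ξ ≡ ∅ × z ≡ x) ⊎ (¬ ξ ≡ ∅ × z ≡ y)
          two : V → V
          two β = lam β (λ ξ → the (Q ξ))
          ne : ¬ succ ∅ ≡ ∅
          ne e = ∅-e (subst (∅ ∈_) e succ-i₂)

    opaque
      bounded : ∀ {Y} → Y ⊆ κ → Small Y → ∃[ γ ] γ ∈ κ × (∀ y → y ∈ Y → y ∈ γ)
      bounded {Y} Yκ (β , βκ , h , sur) =
        let (γ , γκ , b) = κ-reg β βκ f (lam-FunctionOn , λ x y _ _ k →
                             let (xβ , e) = lam-e₂ (App⇒ k) in subst (_∈ κ) (sym e) (g-κ x))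
        in γ , γκ , λ y yY → let (ξ , ξβ , e) = sur y yY in
             b ξ y (App⇐ (subst (λ y → pair ξ y ∈ f) (trans (g-≡ (subst (_∈ κ) (sym e) (Yκ y yY))) e) (lam-i ξβ)))
        where
          -- Values of `h` outside κ are replaced by `∅`, so that regularity can be applied to a
          -- function into κ.
          Q : V → V → Set ℓ
          Q ξ z = (app h ξ ∈ κ × z ≡ app h ξ) ⊎ (¬ app h ξ ∈ κ × z ≡ ∅)
          g : V → V
          g ξ = the (Q ξ)
          f : V
          f = lam β g
          g-≡ : ∀ {ξ} → app h ξ ∈ κ → g ξ ≡ app h ξ
          g-≡ {ξ} k = the-≡ {Q ξ} (inj₁ (k , refl)) λ { _ (inj₁ (_ , e)) → e ; _ (inj₂ (n , _)) → ⊥-elim (n k) }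
          g-κ : ∀ ξ → g ξ ∈ κ
          g-κ ξ = by-cases (app h ξ ∈ κ) (λ k → subst (_∈ κ) (sym (g-≡ k)) k)
            λ n → subst (_∈ κ) (sym (the-≡ {Q ξ} (inj₂ (n , refl))
                    λ { _ (inj₁ (k , _)) → ⊥-elim (n k) ; _ (inj₂ (_ , e)) → e })) ∅∈κ

    opaque
      κ-not-small : ¬ Small κ
      κ-not-small s = let (γ , γκ , b) = bounded (λ _ z → z) s in ∈-irrefl (b γ γκ)

    opaque
      succ-κ : ∀ {γ} → γ ∈ κ → succ γ ∈ κ
      succ-κ {γ} γκ =
        let (δ , δκ , b) = bounded {sg γ} (λ y ys → subst (_∈ κ) (sym (sg-e ys)) γκ) small-pr
            γδ = b γ sg-i
        in case O-trichotomy (O-succ (O-elem oκ γκ)) oκ of λ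
          { (inj₁ k) → k
          ; (inj₂ (inj₁ e)) → case succ-e (subst (δ ∈_) (sym e) δκ) of λ
              { (inj₁ δγ) → ⊥-elim (∈-asym γδ δγ) ; (inj₂ q) → ⊥-elim (∈-irrefl (subst (γ ∈_) q γδ)) }
          ; (inj₂ (inj₂ k)) → case succ-e k of λ
              { (inj₁ κγ) → ⊥-elim (∈-asym κγ γκ) ; (inj₂ refl) → ⊥-elim (∈-irrefl γκ) } }

    -- κ-complete ultrafilters

    IsU : V → Set ℓ
    IsU U = IsUltrafilter U κ × IsComplete κ U κ

    -- A witnessing set is carried along because `P` is an arbitrary predicate, from which no set
    -- can be separated; `ae-set` recovers the set of all points satisfying `P` when `P` is
    -- definable.
    Large : V → (V → Set ℓ) → Set ℓ
    Large U P = ∃[ X ] X ∈ U × (∀ p → p ∈ X → P p)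

    -- The sets of `p` in κ with `B b p` form a base in which fewer than κ members always include a
    -- common one, so the filter they generate is κ-complete, and proper as they are nonempty.
    -- Compactness then extends it.
    module FilterBase (𝔅 : V) (B : V → V → Set ℓ) (def-B : Def₂ B)
      (directed : ∀ Y → Y ⊆ 𝔅 → Small Y → ∃[ b ] b ∈ 𝔅 × (∀ p → p ∈ κ → B b p → ∀ y → y ∈ Y → B y p))
      (inhabited : ∀ b → b ∈ 𝔅 → ∃[ p ] p ∈ κ × B b p) where

      private opaque
        instance
          def-B′ : ∀ {n} {s t : Env n → V} → ⦃ Term s ⦄ → ⦃ Term t ⦄ → Code (λ ρ → B (s ρ) (t ρ))
          def-B′ ⦃ c ⦄ ⦃ d ⦄ = def-sub₂ {P = B} def-B c d

      private opaque
        F : V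
        F = sep (𝒫 κ) (λ X → ∃[ b ] b ∈ 𝔅 × (∀ p → p ∈ κ → B b p → p ∈ X))

        F-e : ∀ {X} → X ∈ F → X ⊆ κ × ∃[ b ] b ∈ 𝔅 × (∀ p → p ∈ κ → B b p → p ∈ X)
        F-e h = let (a , b) = sep-e h in 𝒫-e a , b

        F-i : ∀ {X b} → X ⊆ κ → b ∈ 𝔅 → (∀ p → p ∈ κ → B b p → p ∈ X) → X ∈ F
        F-i a b c = sep-i (𝒫-i a) (_ , b , c)

      private
        opaque
          F-complete : IsComplete κ F κ
          F-complete 𝒳 𝒳F small I hI =
            let (f , hf) = choose 𝒳 (λ X b → b ∈ 𝔅 × (∀ p → p ∈ κ → B b p → p ∈ X))
                             (λ X X𝒳 → proj₂ (F-e (𝒳F X tt X𝒳)))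
                (b , b𝔅 , hb) = directed (img 𝒳 (λ X → app f X))
                  (λ y yi → let (X , X𝒳 , e) = img-e yi in subst (_∈ 𝔅) (sym e) (proj₁ (hf X X𝒳)))
                  (small-img (λ X → app f X) (CardLess-small small))
            in F-i (λ z zI → proj₁ (to (hI z) zI)) b𝔅
                 λ p pκ bp → from (hI p) (pκ , λ X X𝒳 → proj₂ (hf X X𝒳) p pκ (hb p pκ bp _ (img-i X𝒳)))

        opaque
          F-filter : IsFilter F κ
          F-filter = record
            { subsets      = λ X h z _ → proj₁ (F-e h) z
            ; whole        = let (b , b𝔅 , _) = directed ∅ (λ y h → ⊥-elim (∅-e h)) (small-⊆ (λ y h → ⊥-elim (∅-e h)) (small-∈κ ∅∈κ))
                             in F-i (λ _ z → z) b𝔅 (λ p pκ _ → pκ)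
            ; nonempty     = λ X h → let (_ , b , b𝔅 , k) = F-e h ; (p , pκ , bp) = inhabited b b𝔅 in p , tt , k p pκ bp
            ; upward       = λ X Y h X⊆Y Y⊆κ → let (_ , b , b𝔅 , k) = F-e h in
                               F-i (λ z → Y⊆κ z tt) b𝔅 (λ p pκ bp → X⊆Y p tt (k p pκ bp))
            ; intersection = λ X Y Z hX hY hZ →
                let (Xκ , b , b𝔅 , k) = F-e hX ; (_ , c , c𝔅 , l) = F-e hY
                    (d , d𝔅 , m) = directed (pr b c) (λ y yp → [ (λ { refl → b𝔅 }) , (λ { refl → c𝔅 }) ]′ (pr-e yp)) small-pr
                in F-i (λ z zZ → Xκ z (proj₁ (to (hZ z) zZ))) d𝔅
                     λ p pκ dp → from (hZ p) (k p pκ (m p pκ dp b pr-i₁) , l p pκ (m p pκ dp c pr-i₂))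
            }

      opaque
        ultrafilter : ∃[ U ] IsU U × (∀ b → b ∈ 𝔅 → Large U (B b))
        ultrafilter =
          let (U , F⊆U , u , c) = κ-compact F F-filter F-complete
          in U , (u , c) , λ b b𝔅 → sep κ (λ p → B b p) ,
               F⊆U _ tt (F-i (λ z zs → proj₁ (sep-e zs)) b𝔅 (λ p pκ bp → sep-i pκ bp)) , λ p ps → proj₂ (sep-e ps)

    -- The sequence of the iterates of `g` at `f₀`. The recursion hands over only the set of earlier
    -- values, so each value is stored together with its index, by which the preceding one is
    -- recognised.
    module Descent (g f₀ : V) where
      private
        Next : V → V → V → Set ℓ
        Next n w f = (n ≡ ∅ × f ≡ f₀) ⊎ (∃[ m ] ∃[ f′ ] n ≡ succ m × pair m f′ ∈ w × f ≡ app g f′)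

        G : V → V → V → V
        G c n w = pair n (the (Next n w))

        opaque
          term-G : Term₃ G
          term-G = auto

        opaque
          seq-recursor : Recursor E-∈ G
          seq-recursor = ∈-recursor G term-G

        module D = Recursor seq-recursor
        open D using () renaming (term-H to term-seq)

        opaque
          succ-inj : ∀ {m n} → succ m ≡ succ n → m ≡ n
          succ-inj {m} {n} e = case succ-e (subst (m ∈_) e succ-i₂) of λ
            { (inj₂ k) → k
            ; (inj₁ mn) → case succ-e (subst (n ∈_) (sym e) succ-i₂) of λ
                { (inj₂ k) → sym k ; (inj₁ nm) → ⊥-elim (∈-asym mn nm) } }

      opaque
        seq : V → V
        seq n = snd (D.H ∅ n)

        term-seq₁ : Term₁ seq
        term-seq₁ = auto

        private
          seq-pair : ∀ n → D.H ∅ n ≡ pair n (seq n)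
          seq-pair n = let (w , _ , e) = D.H-eq ∅ n in
            trans e (cong (pair n) (sym (trans (cong snd e) snd-pair)))

        seq-∅ : seq ∅ ≡ f₀
        seq-∅ = let (w , _ , e) = D.H-eq ∅ ∅ in trans (cong snd e) (trans snd-pair
          (the-≡ {Next ∅ w} (inj₁ (refl , refl)) λ
            { _ (inj₁ (_ , q)) → q
            ; _ (inj₂ (m , _ , q , _)) → ⊥-elim (∅-e (subst (m ∈_) (sym q) succ-i₂)) }))

        seq-succ : ∀ n → seq (succ n) ≡ app g (seq n)
        seq-succ n = let (w , vals , e) = D.H-eq ∅ (succ n) in trans (cong snd e) (trans snd-pair
          (the-≡ {Next (succ n) w}
            (inj₂ (n , seq n , refl , subst (_∈ w) (seq-pair n) (proj₂ (vals _) (n , succ-i₂ , refl)) , refl)) λ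
            { _ (inj₁ (q , _)) → ⊥-elim (∅-e (subst (n ∈_) q succ-i₂))
            ; _ (inj₂ (m , f′ , q , k , r)) →
                let (z , _ , k′) = proj₁ (vals _) k
                    (m≡z , f≡) = pair-inj (trans k′ (seq-pair z))
                in trans r (cong (app g) (trans f≡ (cong seq (trans (sym m≡z) (sym (succ-inj q)))))) }))

    module Measure (U : V) (isU : IsU U) where
      private
        module IF = IsFilter (proj₁ (proj₁ isU))

      AE : (V → Set ℓ) → Set ℓ
      AE P = Large U P

      opaque
        ae-full : {P : V → Set ℓ} → (∀ p → p ∈ κ → P p) → AE P
        ae-full h = κ , IF.whole , h

      opaque
        ae-mono : {P Q : V → Set ℓ} → AE P → (∀ p → p ∈ κ → P p → Q p) → AE Q
        ae-mono (X , XU , h) k = X , XU , λ p pX → k p (IF.subsets X XU p tt pX) (h p pX)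

      opaque
        ae-and : {P Q : V → Set ℓ} → AE P → AE Q → AE (λ p → P p × Q p)
        ae-and (X , XU , h) (Y , YU , k) = sep X (λ p → p ∈ Y) ,
          IF.intersection X Y _ XU YU (λ z → mk⇔ sep-e (λ (a , b) → sep-i a b)) ,
          λ p ps → h p (proj₁ (sep-e ps)) , k p (proj₂ (sep-e ps))

      opaque
        ae-mono₂ : {P Q S : V → Set ℓ} → AE P → AE Q → (∀ p → p ∈ κ → P p → Q p → S p) → AE S
        ae-mono₂ a b k = ae-mono (ae-and a b) λ p pκ (x , y) → k p pκ x y

      opaque
        ae-wit : {P : V → Set ℓ} → AE P → ∃[ p ] p ∈ κ × P p
        ae-wit (X , XU , h) = let (p , _ , pX) = IF.nonempty X XU in p , IF.subsets X XU p tt pX , h p pX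

      opaque
        ae-em : (P : V → Set ℓ) ⦃ d : Def₁ P ⦄ → AE P ⊎ AE (λ p → ¬ P p)
        ae-em P with proj₂ (proj₁ isU) (sep κ P) (κ ∖ sep κ P) (λ z _ zs → proj₁ (sep-e zs))
                        (λ z → mk⇔ sep-e (λ (a , b) → sep-i a b))
        ... | inj₁ h = inj₁ (_ , h , λ p ps → proj₂ (sep-e ps))
        ... | inj₂ h = inj₂ (_ , h , λ p ps Pp → let (pκ , n) = sep-e ps in n (sep-i pκ Pp))

      opaque
        ae-not : (P : V → Set ℓ) ⦃ d : Def₁ P ⦄ → ¬ AE P → AE (λ p → ¬ P p)
        ae-not P n = [ (λ h → ⊥-elim (n h)) , (λ h → h) ]′ (ae-em P)

      opaque
        ae-consistent : {P : V → Set ℓ} → AE P → AE (λ p → ¬ P p) → ∀ {A : Set ℓ} → A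
        ae-consistent h k = let (_ , _ , a , b) = ae-wit (ae-and h k) in ⊥-elim (b a)

      private
        opaque
          ae-all′ : ∀ {Y} → Small Y → (P : V → V → Set ℓ) (d : Def₂ P) →
                   (∀ y → y ∈ Y → AE (λ p → P y p)) → AE (λ p → ∀ y → y ∈ Y → P y p)
          ae-all′ {Y} small P d h = meet κ (img Y S) ,
            proj₂ isU (img Y S) inU (small-CardLess (small-img S small)) _
              (λ z → mk⇔ sep-e (λ (a , b) → sep-i a b)) ,
            λ p ps y yY → proj₂ (sep-e (proj₂ (sep-e ps) (S y) (img-i yY)))
            where
              opaque
                instance
                  def-P : ∀ {n} {s t : Env n → V} → ⦃ Term s ⦄ → ⦃ Term t ⦄ → Code (λ ρ → P (s ρ) (t ρ))
                  def-P ⦃ c ⦄ ⦃ e ⦄ = def-sub₂ {P = P} d c e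
              S : V → V
              S y = sep κ (λ p → P y p)
              inU : R._⊆_ (img Y S) U
              inU X _ Xi = let (y , yY , e) = img-e Xi ; (Z , ZU , k) = h y yY in
                subst (_∈ U) (sym e) (IF.upward Z (S y) ZU
                  (λ p _ pZ → sep-i (IF.subsets Z ZU p tt pZ) (k p pZ)) (λ p _ ps → proj₁ (sep-e ps)))

      opaque
        ae-all : ∀ {Y} → Small Y → (P : V → V → Set ℓ) ⦃ d : Def₂ P ⦄ →
                 (∀ y → y ∈ Y → AE (λ p → P y p)) → AE (λ p → ∀ y → y ∈ Y → P y p)
        ae-all small P ⦃ d ⦄ = ae-all′ small P d

      opaque
        -- If every single value in `Y` were avoided almost everywhere, completeness would allow all
        -- of them to be avoided at once.
        ae-const : ∀ {Y h} → Small Y → AE (λ p → app h p ∈ Y) → ∃[ y ] y ∈ Y × AE (λ p → app h p ≡ y)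
        ae-const {Y} {h} small a = dne λ n →
          let (p , _ , hY , all) = ae-wit (ae-and a (ae-all small (λ y p → ¬ app h p ≡ y)
                                     (λ y yY → ae-not (λ p → app h p ≡ y) λ k → n (y , yY , k))))
          in all (app h p) hY refl

      opaque
        ae-choose : (P : V → V → Set ℓ) ⦃ d : Def₂ P ⦄ → AE (λ p → ∃[ y ] P p y) → ∃[ F ] AE (λ p → P p (app F p))
        ae-choose P (X , XU , h) = let (F , hF) = choose X P h in F , X , XU , hF

      opaque
        -- An infinite descent modulo the ultrafilter has countably many steps. By completeness they
        -- all hold at one common point `p`, where they contradict foundation.
        ae-wf : ∀ Y → (∃[ f ] f ∈ Y) → ∃[ m ] m ∈ Y × (∀ f → AE (λ p → app f p ∈ app m p) → ¬ f ∈ Y)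
        ae-wf Y (f₀ , f₀Y) = dne λ none →
          let (g , hg) = choose Y (λ m f → f ∈ Y × AE (λ p → app f p ∈ app m p))
                           (λ m mY → dne λ n → none (m , mY , λ f a fY → n (f , fY , a)))
          in contra g hg
          where
            module _ (g : V) (hg : ∀ m → m ∈ Y → app g m ∈ Y × AE (λ p → app (app g m) p ∈ app m p)) where
              open Descent g f₀
              opaque
                instance
                  term-seq : ∀ {n} {s : Env n → V} → ⦃ Term s ⦄ → Term (λ ρ → seq (s ρ))
                  term-seq ⦃ c ⦄ = term-sub₁ {h = seq} term-seq₁ c
              in-Y : ∀ n → n ∈ ω → seq n ∈ Y
              in-Y = ω-induction (λ n → seq n ∈ Y) (subst (_∈ Y) (sym seq-∅) f₀Y)
                λ n _ h → subst (_∈ Y) (sym (seq-succ n)) (proj₁ (hg _ h))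
              desc : AE (λ p → ∀ n → n ∈ ω → app (app g (seq n)) p ∈ app (seq n) p)
              desc = ae-all (small-∈κ ω∈κ) (λ n p → app (app g (seq n)) p ∈ app (seq n) p)
                       λ n nω → proj₂ (hg _ (in-Y n nω))
              contra : ⊥₀
              contra = let (p , _ , h) = ae-wit desc
                           (m , mT , min) = foundation (img ω (λ n → app (seq n) p)) (_ , img-i (proj₁ ω-Ind))
                           (n , nω , e) = img-e mT
                       in min (app (seq (succ n)) p)
                            (subst₂ _∈_ (cong (λ f → app f p) (sym (seq-succ n))) (sym e) (h n nω))
                            (img-i (proj₂ ω-Ind n nω))

      opaque
        ae-set : (P : V → Set ℓ) ⦃ d : Def₁ P ⦄ → AE P → sep κ P ∈ U
        ae-set P (X , XU , h) = IF.upward X (sep κ P) XU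
          (λ p _ pX → sep-i (IF.subsets X XU p tt pX) (h p pX)) (λ p _ ps → proj₁ (sep-e ps))

    -- The ultrafilter U, and κ as a regular strong limit

    private
      opaque
        tails : ∃[ U ] IsU U × (∀ γ → γ ∈ κ → Large U (λ p → γ ∈ p))
        tails = FilterBase.ultrafilter κ (λ γ p → γ ∈ p) auto
          (λ Y Yκ small → let (γ , γκ , b) = bounded Yκ small in
             γ , γκ , λ p pκ γp y yY → proj₁ (O-elem oκ pκ) γ γp y (b y yY))
          (λ γ γκ → succ γ , succ-κ γκ , succ-i₂)

    opaque
      U : V
      U = proj₁ tails

      U-isU : IsU U
      U-isU = proj₁ (proj₂ tails)

      U-tail : ∀ γ → γ ∈ κ → Large U (λ p → γ ∈ p)
      U-tail = proj₂ (proj₂ tails)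

    open module MU = Measure U U-isU

    opaque
      small-inj : ∀ {A B} f → (∀ x → x ∈ A → app f x ∈ B) →
                  (∀ x x′ → x ∈ A → x′ ∈ A → app f x ≡ app f x′ → x ≡ x′) → Small B → Small A
      small-inj {A} {B} f f₁ f₂ small = small-⊆
        (λ x xA → subst (_∈ img B (λ y → the (λ x → x ∈ A × app f x ≡ y)))
                    (the-≡ {λ x′ → x′ ∈ A × app f x′ ≡ app f x} (xA , refl) λ z (zA , e) → f₂ z x zA xA e)
                    (img-i (f₁ x xA)))
        (small-img (λ y → the (λ x → x ∈ A × app f x ≡ y)) small)

    -- A measurable cardinal is a strong limit: an injection f of κ into 𝒫 x with
    -- x small would be constant on a large set, each of its bits being so.
    opaque
      small-𝒫 : ∀ {x} → Small x → Small (𝒫 x)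
      small-𝒫 {x} small =
        let (θ , oθ , f , f₁ , f₂ , f₃) = well-ordering (𝒫 x)
        in case O-trichotomy oθ oκ of λ
          { (inj₁ k) → θ , k , f , f₃
          ; (inj₂ (inj₁ e)) → ⊥-elim (impossible f (λ p pκ → subst (p ∈_) (sym e) pκ) f₁ f₂)
          ; (inj₂ (inj₂ k)) → ⊥-elim (impossible f (proj₁ oθ κ k) f₁ f₂) }
        where
          impossible : ∀ {θ} f → κ ⊆ θ → (∀ p → p ∈ θ → app f p ∈ 𝒫 x) →
               (∀ p p′ → p ∈ θ → p′ ∈ θ → app f p ≡ app f p′ → p ≡ p′) → ⊥₀
          impossible {θ} f κθ f₁ f₂ =
            let decided : AE (λ p → ∀ y → y ∈ x → (y ∈ app f p) ↔ AE (λ r → y ∈ app f r))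
                decided = ae-all small (λ y p → (y ∈ app f p) ↔ AE (λ r → y ∈ app f r)) λ y yx →
                  by-cases (AE (λ r → y ∈ app f r))
                    (λ a → ae-mono a (λ p _ h → (λ _ → a) , (λ _ → h)))
                    (λ n → ae-mono (ae-not (λ r → y ∈ app f r) n) (λ p _ h → (λ k → ⊥-elim (h k)) , (λ a → ⊥-elim (n a))))
                (p , pκ , hp) = ae-wit decided
                (p′ , p′κ , hp′ , pp′) = ae-wit (ae-and decided (U-tail p pκ))
                half : ∀ {p p′} → p ∈ κ →
                       (∀ y → y ∈ x → (y ∈ app f p) ↔ AE (λ r → y ∈ app f r)) →
                       (∀ y → y ∈ x → (y ∈ app f p′) ↔ AE (λ r → y ∈ app f r)) → app f p ⊆ app f p′
                half pκ hp hp′ y yf = let yx = 𝒫-e (f₁ _ (κθ _ pκ)) y yf in proj₂ (hp′ y yx) (proj₁ (hp y yx) yf)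
            in ∈-irrefl (subst (p ∈_) (sym (f₂ p p′ (κθ p pκ) (κθ p′ p′κ) (ext (half pκ hp hp′) (half p′κ hp′ hp)))) pp′)

    opaque
      prod : V → V → V
      prod A B = ⋃ (img A (λ a → img B (λ b → pair a b)))

      prod-i : ∀ {A B a b} → a ∈ A → b ∈ B → pair a b ∈ prod A B
      prod-i {A} {B} {a} h k = ⋃-i (img-i {A} {λ a → img B (λ b → pair a b)} h) (img-i {B} {λ b → pair a b} k)

      prod-e : ∀ {A B u} → u ∈ prod A B → ∃[ a ] ∃[ b ] a ∈ A × b ∈ B × u ≡ pair a b
      prod-e {A} {B} h =
        let (y , yi , uy) = ⋃-e h ; (a , aA , e) = img-e yi ; (b , bB , q) = img-e (subst (_ ∈_) e uy)
        in a , b , aA , bB , q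

      term-prod₂ : Term₂ prod
      term-prod₂ = auto

    opaque
      fst-≡ : ∀ {u a b} → u ≡ pair a b → fst u ≡ a
      fst-≡ e = trans (cong fst e) fst-pair

    opaque
      snd-≡ : ∀ {u a b} → u ≡ pair a b → snd u ≡ b
      snd-≡ e = trans (cong snd e) snd-pair

    opaque
      κ-max : ∀ {α β} → α ∈ κ → β ∈ κ → ∃[ δ ] δ ∈ κ × α ⊆ δ × β ⊆ δ
      κ-max {α} {β} ακ βκ = case O-trichotomy (O-elem oκ ακ) (O-elem oκ βκ) of λ
        { (inj₁ k) → β , βκ , proj₁ (O-elem oκ βκ) α k , λ _ z → z
        ; (inj₂ (inj₁ e)) → β , βκ , (λ z → subst (z ∈_) e) , λ _ z → z
        ; (inj₂ (inj₂ k)) → α , ακ , (λ _ z → z) , proj₁ (O-elem oκ ακ) β k }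

    opaque
      pair-𝒫𝒫 : ∀ {δ x y} → x ∈ δ → y ∈ δ → pair x y ∈ 𝒫 (𝒫 δ)
      pair-𝒫𝒫 {δ} {x} {y} h k = 𝒫-i λ w wp → 𝒫-i λ z zw →
        [ (λ e → subst (_∈ δ) (sym (sg-e (subst (z ∈_) e zw))) h)
        , (λ e → [ (λ q → subst (_∈ δ) (sym q) h) , (λ q → subst (_∈ δ) (sym q) k) ]′ (pr-e (subst (z ∈_) e zw))) ]′
          (pr-e (subst (w ∈_) (pair-def x y) wp))

    opaque
      -- Pairs from `δ` lie in `𝒫 (𝒫 δ)`, so the strong limit property replaces cardinal
      -- multiplication.
      small-prod : ∀ {A B} → Small A → Small B → Small (prod A B)
      small-prod {A} {B} (α , ακ , h , h₁) (β , βκ , k , k₁) =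
        let (δ , δκ , αδ , βδ) = κ-max ακ βκ
            t : V → V
            t u = pair (app h (fst u)) (app k (snd u))
            sm : Small (prod α β)
            sm = small-⊆ (λ u uP → let (a , b , aα , bβ , e) = prod-e uP in
                            subst (_∈ 𝒫 (𝒫 δ)) (sym e) (pair-𝒫𝒫 (αδ a aα) (βδ b bβ)))
                         (small-𝒫 (small-𝒫 (small-∈κ δκ)))
        in small-⊆ (λ u uP → let (a , b , aA , bB , e) = prod-e uP
                                 (ξ , ξα , p) = h₁ a aA ; (ζ , ζβ , q) = k₁ b bB
                             in subst (_∈ img (prod α β) t)
                                  (trans (cong₂ pair (trans (cong (app h) fst-pair) p) (trans (cong (app k) snd-pair) q)) (sym e))
                                  (img-i (prod-i ξα ζβ)))
                   (small-img t sm)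

    private
      module SmallUnion (Y s γ : V) where
        opaque
          t : V → V
          t u = app (snd (app s (fst u))) (snd u)

          term-t₁ : Term₁ t
          term-t₁ = auto

          t-pair : ∀ {y ξ} → t (pair y ξ) ≡ app (snd (app s y)) ξ
          t-pair = cong₂ (λ y ξ → app (snd (app s y)) ξ) fst-pair snd-pair

        S : V
        S = img (prod Y γ) t ⦃ term-t₁ ⦄

        opaque
          S-small : Small Y → γ ∈ κ → Small S
          S-small small γκ = small-img t ⦃ term-t₁ ⦄ (small-prod small (small-∈κ γκ))

        opaque
          S-i : ∀ {y ξ z} → y ∈ Y → ξ ∈ γ → app (snd (app s y)) ξ ≡ z → z ∈ S
          S-i {y} {ξ} yY ξγ e = subst (_∈ S) (trans t-pair e) (img-i {d = term-t₁} (prod-i yY ξγ))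

    private
      Covers : V → V → Set ℓ
      Covers y r = fst r ∈ κ × (∀ z → z ∈ y → ∃[ ξ ] ξ ∈ fst r × app (snd r) ξ ≡ z)

      opaque
        covers : ∀ {y} → Small y → ∃[ r ] Covers y r
        covers (β , βκ , h , sur) = pair β h , subst (_∈ κ) (sym fst-pair) βκ , λ z zy →
          let (ξ , ξβ , e) = sur z zy in
          ξ , subst (ξ ∈_) (sym fst-pair) ξβ , trans (cong (λ h → app h ξ) snd-pair) e

      opaque
        lengths-bounded : ∀ {Y} s → Small Y → (∀ y → y ∈ Y → Covers y (app s y)) →
                          ∃[ γ ] γ ∈ κ × (∀ y → y ∈ Y → fst (app s y) ∈ γ)
        lengths-bounded {Y} s small hs =
          let (γ , γκ , b) = bounded {img Y (λ y → fst (app s y))}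
                (λ z zi → let (y , yY , e) = img-e zi in subst (_∈ κ) (sym e) (proj₁ (hs y yY)))
                (small-img (λ y → fst (app s y)) small)
          in γ , γκ , λ y yY → b _ (img-i yY)

      opaque
        union-covered : ∀ {Y s γ} → γ ∈ κ → (∀ y → y ∈ Y → Covers y (app s y)) →
                        (∀ y → y ∈ Y → fst (app s y) ∈ γ) → ⋃ Y ⊆ SmallUnion.S Y s γ
        union-covered {Y} {s} {γ} γκ hs b z zU =
          let (y , yY , zy) = ⋃-e zU ; (ξ , ξr , e) = proj₂ (hs y yY) z zy
          in SmallUnion.S-i Y s γ yY (proj₁ (O-elem oκ γκ) _ (b y yY) ξ ξr) e

    opaque
      -- Choose a covering map for each member. Regularity bounds their domains by one `γ`, and the
      -- union is covered by an image of the product of `Y` and `γ`.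
      small-⋃ : ∀ {Y} → Small Y → (∀ y → y ∈ Y → Small y) → Small (⋃ Y)
      small-⋃ {Y} small each =
        let (s , hs) = choose Y Covers (λ y yY → covers (each y yY))
            (γ , γκ , b) = lengths-bounded s small hs
        in small-⊆ (union-covered γκ hs b) (SmallUnion.S-small Y s γ small γκ)

    -- The minimal unbounded function

    private
      Unbounded : V → Set ℓ
      Unbounded h = (∀ p → p ∈ κ → app h p ∈ κ × app h p ⊆ p) × (∀ ξ → ξ ∈ κ → AE (λ p → ξ ∈ app h p))

      candidates : V → V
      candidates P = sep (𝒫 P) Unbounded

      opaque
        lam-𝒫 : (t : V → V) ⦃ d : Term₁ t ⦄ → (∀ p → p ∈ κ → t p ∈ κ) → lam κ t ∈ 𝒫 (prod κ κ)
        lam-𝒫 t h = 𝒫-i λ u ul → let (p , pκ , e) = lam-e ul in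
                      subst (_∈ prod κ κ) (sym e) (prod-i pκ (h p pκ))

      opaque
        id-unbounded : Unbounded (lam κ (λ p → p))
        id-unbounded = (λ p pκ → subst (_∈ κ) (sym (app-lam pκ)) pκ , λ z → subst (z ∈_) (app-lam pκ)) ,
                       λ ξ ξκ → ae-mono (U-tail ξ ξκ) λ p pκ → subst (ξ ∈_) (sym (app-lam pκ))

      -- A function below `g` almost everywhere is set to `∅` at the exceptional points, which makes
      -- it a set of pairs lying below the identity everywhere. If it is no candidate, it is bounded
      -- by some ξ < κ on a large set, hence constant there up to a further large set.
      module Truncate (g : V) (g-below : ∀ p → p ∈ κ → app g p ∈ κ × app g p ⊆ p)
                      (h : V) (a : AE (λ p → app h p ∈ app g p)) where
        Q : V → V → Set ℓ
        Q p y = (app h p ∈ app g p × y ≡ app h p) ⊎ (¬ app h p ∈ app g p × y ≡ ∅)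

        opaque
          t : V → V
          t p = the (Q p)

          term-t₁ : Term₁ t
          term-t₁ = auto

          t-≡ : ∀ {p} → app h p ∈ app g p → t p ≡ app h p
          t-≡ {p} k = the-≡ {Q p} (inj₁ (k , refl)) λ { _ (inj₁ (_ , e)) → e ; _ (inj₂ (n , _)) → ⊥-elim (n k) }

          t-∅ : ∀ {p} → ¬ app h p ∈ app g p → t p ≡ ∅
          t-∅ {p} n = the-≡ {Q p} (inj₂ (n , refl)) λ { _ (inj₁ (k , _)) → ⊥-elim (n k) ; _ (inj₂ (_ , e)) → e }

        opaque
          t-below : ∀ p → p ∈ κ → t p ∈ κ × t p ⊆ p
          t-below p pκ = by-cases (app h p ∈ app g p)
            (λ k → let hp = proj₂ (g-below p pκ) (app h p) k in
                   subst (λ y → y ∈ κ × y ⊆ p) (sym (t-≡ k)) (proj₁ oκ p pκ _ hp , proj₁ (O-elem oκ pκ) _ hp))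
            (λ n → subst (λ y → y ∈ κ × y ⊆ p) (sym (t-∅ n)) (∅∈κ , λ z h → ⊥-elim (∅-e h)))

        opaque
          h′ : V
          h′ = lam κ t ⦃ term-t₁ ⦄

          h′-𝒫 : h′ ∈ 𝒫 (prod κ κ)
          h′-𝒫 = lam-𝒫 t ⦃ term-t₁ ⦄ (λ p pκ → proj₁ (t-below p pκ))

          h′-app : ∀ p → p ∈ κ → app h′ p ≡ t p
          h′-app p pκ = app-lam pκ

        opaque
          h′≡h : AE (λ p → app h′ p ≡ app h p)
          h′≡h = ae-mono a λ p pκ k → trans (h′-app p pκ) (t-≡ k)

        opaque
          h′-below : ∀ p → p ∈ κ → app h′ p ∈ κ × app h′ p ⊆ p
          h′-below p pκ = subst (λ y → y ∈ κ × y ⊆ p) (sym (h′-app p pκ)) (t-below p pκ)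

        opaque
          h′-less : AE (λ p → app h′ p ∈ app g p)
          h′-less = ae-mono₂ h′≡h a λ p _ e k → subst (_∈ app g p) (sym e) k

        opaque
          constant : ¬ h′ ∈ candidates (prod κ κ) → ∃[ y ] AE (λ p → app h p ≡ y)
          constant not =
            let (ξ , k) = ¬∀⇒∃¬ {A = V} {λ ξ → ξ ∈ κ → AE (λ p → ξ ∈ app h′ p)}
                            (λ all → not (sep-i h′-𝒫 (h′-below , all)))
                ξκ : ξ ∈ κ
                ξκ = dne λ n → k λ ξκ → ⊥-elim (n ξκ)
                (y , _ , c) = ae-const (small-∈κ (succ-κ ξκ)) (bd ξ ξκ (λ b → k λ _ → b))
            in y , ae-mono₂ h′≡h c λ p _ e q → trans (sym e) q
            where
              bd : ∀ ξ → ξ ∈ κ → ¬ AE (λ p → ξ ∈ app h′ p) → AE (λ p → app h′ p ∈ succ ξ)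
              bd ξ ξκ k = ae-mono (ae-not (λ p → ξ ∈ app h′ p) k) λ p pκ n →
                case O-trichotomy (O-elem oκ (proj₁ (h′-below p pκ))) (O-elem oκ ξκ) of λ
                  { (inj₁ l) → succ-i₁ l ; (inj₂ (inj₁ l)) → subst (_∈ succ ξ) (sym l) succ-i₂
                  ; (inj₂ (inj₂ l)) → ⊥-elim (n l) }

      -- The normalizing function: ultrafilter-minimal among the functions below the
      -- identity that are not bounded on a large set.
      opaque
        normalizer : ∃[ g ] Unbounded g × (∀ h → AE (λ p → app h p ∈ app g p) → ∃[ y ] AE (λ p → app h p ≡ y))
        normalizer =
          let (g , gC , min) = ae-wf (candidates (prod κ κ))
                                 (_ , sep-i (lam-𝒫 (λ p → p) (λ _ k → k)) id-unbounded)
              unb = proj₂ (sep-e gC)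
          in g , unb , λ h a → let open Truncate g (proj₁ unb) h a in constant (min h′ h′-less)

    opaque
      g : V
      g = proj₁ normalizer

      g-κ : ∀ {q} → q ∈ κ → app g q ∈ κ
      g-κ qκ = proj₁ (proj₁ (proj₁ (proj₂ normalizer)) _ qκ)

      g-unbounded : ∀ {ξ} → ξ ∈ κ → AE (λ q → ξ ∈ app g q)
      g-unbounded = proj₂ (proj₁ (proj₂ normalizer)) _

      g-normal : ∀ h → AE (λ q → app h q ∈ app g q) → ∃[ y ] AE (λ q → app h q ≡ y)
      g-normal = proj₂ (proj₂ normalizer)

    -- Indexing the triples by κ

    private
      -- The increasing union of the small sets `K θ` is enumerated so that an element of least
      -- stage always comes next. If some `r` in `K θ` were never reached, all values would have to
      -- lie in `K θ`, and κ would inject into a small set.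
      module Cover (K : V → V) (term-K : Term₁ K) (K-mono : ∀ {θ θ′} → θ ⊆ θ′ → K θ ⊆ K θ′)
                   (K-small : ∀ θ → θ ∈ κ → Small (K θ)) where
        private opaque
          instance
            term-K′ : ∀ {n} {s : Env n → V} → ⦃ Term s ⦄ → Term (λ ρ → K (s ρ))
            term-K′ ⦃ c ⦄ = term-sub₁ {h = K} term-K c

        private
          A : V
          A = ⋃ (img κ (λ θ → K θ))

          Early : V → V → Set ℓ
          Early Y y = ∀ θ → θ ∈ κ → (∃[ z ] z ∈ Y × z ∈ K θ) → y ∈ K θ

          opaque
            early : ∀ Y → Y ⊆ A → (∃[ y ] y ∈ Y) → ∃[ y ] y ∈ Y × Early Y y
            early Y YA (y , yY) =
              let (_ , k , l) = ⋃-e (YA y yY) ; (θ₀ , θ₀κ , e) = img-e k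
                  (θ , oθ , (θκ , z , zY , zK) , least) = O-least (λ θ → θ ∈ κ × (∃[ z ] z ∈ Y × z ∈ K θ))
                    (θ₀ , O-elem oκ θ₀κ , θ₀κ , y , yY , subst (y ∈_) e l)
              in z , zY , λ θ′ θ′κ h → K-mono (O-∉ (O-elem oκ θ′κ) oθ (λ m → least θ′ m (θ′κ , h))) z zK

          opaque
            early-choice : ∃[ ch ] (∀ Y → Y ⊆ A → (∃[ y ] y ∈ Y) → app ch Y ∈ Y × Early Y (app ch Y))
            early-choice = choice-function A Early early

          module En = Enumeration A (proj₁ early-choice) (λ Y s ne → proj₁ (proj₂ early-choice Y s ne))

        opaque
          surjection : ∃[ e ] (∀ r θ → θ ∈ κ → r ∈ K θ → ∃[ p ] p ∈ κ × app e p ≡ r)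
          surjection = e , λ r θ θκ rK → dne λ n →
            let rem : ∀ ξ → ξ ∈ κ → r ∈ En.Rem ξ
                rem ξ ξκ = En.Rem-i (⋃-i (img-i θκ) rK) λ (z , zξ , q) →
                  n (z , proj₁ oκ ξ ξκ z zξ , trans (app-lam (proj₁ oκ ξ ξκ z zξ)) (sym q))
                into : ∀ ξ → ξ ∈ κ → app e ξ ∈ K θ
                into ξ ξκ = subst (_∈ K θ) (sym (trans (app-lam ξκ) (En.en-≡ ξ)))
                  (proj₂ (proj₂ early-choice (En.Rem ξ) (λ y k → proj₁ (En.Rem-e k)) (r , rem ξ ξκ)) θ θκ (r , rem ξ ξκ , rK))
            in κ-not-small (small-inj e into
                 (λ ξ ζ ξκ ζκ q → En.en-inj (O-elem oκ ξκ) (O-elem oκ ζκ) (r , rem ξ ξκ) (r , rem ζ ζκ)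
                    (trans (sym (app-lam ξκ)) (trans q (app-lam ζκ))))
                 (K-small θ θκ))
            where
              e : V
              e = lam κ En.en ⦃ En.term-en₁ ⦄

      -- Both δ and a belong to `𝒫 θ`, as θ is transitive. A pair costs two powersets, so their pair
      -- is in the third power of θ and the pair with q in the fifth.
      𝒫⁵ : V → V
      𝒫⁵ θ = 𝒫 (𝒫 (𝒫 (𝒫 (𝒫 θ))))

      𝒫-mono : ∀ {x y} → x ⊆ y → 𝒫 x ⊆ 𝒫 y
      𝒫-mono h z zx = 𝒫-i λ w wz → h w (𝒫-e zx w wz)

      opaque
        triples : ∃[ e ] (∀ r θ → θ ∈ κ → r ∈ 𝒫⁵ θ → ∃[ p ] p ∈ κ × app e p ≡ r)
        triples = Cover.surjection 𝒫⁵ auto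
          (λ h → 𝒫-mono (𝒫-mono (𝒫-mono (𝒫-mono (𝒫-mono h)))))
          (λ θ θκ → small-𝒫 (small-𝒫 (small-𝒫 (small-𝒫 (small-𝒫 (small-∈κ θκ))))))

    -- Filters live on κ, so the intended index set of triples ⟨q , δ , a⟩, with q , δ ∈ κ
    -- and a a bounded subset of κ, is enumerated by κ.
    opaque
      triple : V
      triple = proj₁ triples

      triple-onto : ∀ {q δ a θ} → θ ∈ κ → q ∈ θ → δ ∈ θ → a ⊆ θ → ∃[ p ] p ∈ κ × app triple p ≡ pair q (pair δ a)
      triple-onto {q} {δ} {a} {θ} θκ qθ δθ aθ =
        let tr : ∀ {x} → Trans x → x ⊆ 𝒫 x
            tr t y yx = 𝒫-i (t y yx)
            tr-𝒫 : ∀ {x} → Trans x → Trans (𝒫 x)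
            tr-𝒫 t y yP z zy = 𝒫-i (t z (𝒫-e yP z zy))
            tθ = proj₁ (O-elem oκ θκ)
            q₁ : q ∈ 𝒫 θ
            q₁ = tr tθ q qθ
        in proj₂ triples _ θ θκ (pair-𝒫𝒫 (tr (tr-𝒫 (tr-𝒫 tθ)) q (tr (tr-𝒫 tθ) q q₁))
                                         (pair-𝒫𝒫 (tr tθ δ δθ) (𝒫-i aθ)))

    -- Canonical functions for the ordinals below κ⁺

    private
      opaque
        covering-maps : ∃[ κ⁺ ] IsSuccessorCardinal κ⁺ κ × O κ⁺ ×
                           (∃[ b ] (∀ α → α ∈ κ⁺ → ∀ y → y ∈ α → ∃[ ξ ] ξ ∈ κ × app (app b α) ξ ≡ y))
        covering-maps =
          let (κ⁺ , s , o , h) = successor-cardinal κ oκ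
              (b , hb) = choose κ⁺ (λ α h → ∀ y → y ∈ α → ∃[ ξ ] ξ ∈ κ × app h ξ ≡ y) h
          in κ⁺ , s , o , b , hb

    opaque
      κ⁺ : V
      κ⁺ = proj₁ covering-maps

      κ⁺-successor : IsSuccessorCardinal κ⁺ κ
      κ⁺-successor = proj₁ (proj₂ covering-maps)

      κ⁺-O : O κ⁺
      κ⁺-O = proj₁ (proj₂ (proj₂ covering-maps))

      enum : V
      enum = proj₁ (proj₂ (proj₂ (proj₂ covering-maps)))

      enum-onto : ∀ {α} → α ∈ κ⁺ → ∀ y → y ∈ α → ∃[ ξ ] ξ ∈ κ × app (app enum α) ξ ≡ y
      enum-onto {α} = proj₂ (proj₂ (proj₂ (proj₂ covering-maps))) α

    κ∈κ⁺ : κ ∈ κ⁺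
    κ∈κ⁺ = proj₁ (proj₂ κ⁺-successor)

    κ⊆κ⁺ : κ ⊆ κ⁺
    κ⊆κ⁺ = proj₁ κ⁺-O κ κ∈κ⁺

    private
      E-col : V → V → V → Set ℓ
      E-col a z x = z ∈ x × z ∈ a

      opaque
        def-E-col : Def₃ E-col
        def-E-col = auto

      G-col : V → V → V → V
      G-col a x w = w

      opaque
        term-G-col : Term₃ G-col
        term-G-col = term-v2

      opaque
        cover-col : ∀ a x → ∃[ T ] x ∈ T × (∀ y z → y ∈ T → E-col a z y → z ∈ T)
        cover-col a x = let (T , xT , tr) = transitive-cover x in T , xT , λ y z yT (zy , _) → tr y yT z zy

      opaque
        min-col : ∀ a T → (∃[ x ] x ∈ T) → ∃[ m ] m ∈ T × (∀ z → E-col a z m → ¬ z ∈ T)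
        min-col a T h = let (m , mT , n) = foundation T h in m , mT , λ z (zm , _) → n z zm

      opaque
        col-recursor : Recursor E-col G-col
        col-recursor = recursor E-col def-E-col G-col term-G-col cover-col min-col

      module Col = Recursor col-recursor
      open Col using () renaming (term-H to term-Col)

    -- The Mostowski collapse of a, extended to all x by collapsing x ∩ a.
    opaque
      col : V → V → V
      col a x = Col.H a x

      term-col₂ : Term₂ col
      term-col₂ = auto

      col-e : ∀ {a x u} → u ∈ col a x → ∃[ z ] z ∈ x × z ∈ a × u ≡ col a z
      col-e {a} {x} {u} h = let (w , vals , e) = Col.H-eq a x ; (z , (zx , za) , q) = proj₁ (vals u) (subst (u ∈_) e h)
                            in z , zx , za , q

      col-i : ∀ {a x z} → z ∈ x → z ∈ a → col a z ∈ col a x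
      col-i {a} {x} {z} zx za = let (w , vals , e) = Col.H-eq a x in
        subst (col a z ∈_) (sym e) (proj₂ (vals (col a z)) (z , (zx , za) , refl))

    opaque
      instance
        term-col : ∀ {n} {s t : Env n → V} → ⦃ Term s ⦄ → ⦃ Term t ⦄ → Term (λ ρ → col (s ρ) (t ρ))
        term-col ⦃ c ⦄ ⦃ d ⦄ = term-sub₂ {h = col} term-col₂ c d

    opaque
      col-O : ∀ a x → O x → O (col a x)
      col-O a = ∈-induction (λ x → O x → O (col a x)) λ x ih ox → O-from
        (λ u uc v vu → let (z , zx , za , e) = col-e uc ; (y , yz , ya , q) = col-e (subst (v ∈_) e vu)
                       in subst (_∈ col a x) (sym q) (col-i (proj₁ ox z zx y yz) ya))
        (λ u uc → let (z , zx , za , e) = col-e uc in subst O (sym e) (ih z zx (O-elem ox zx)))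

    private
      img-app : V → V → V
      img-app h x = img x (λ ξ → app h ξ)

      opaque
        img-app-small : ∀ {h x} → Small x → Small (img-app h x)
        img-app-small {h} s = small-img (λ ξ → app h ξ) s

      img-col : V → V → V
      img-col a x = img x (λ z → col a z)

      opaque
        img-col-small : ∀ {a x} → Small x → Small (img-col a x)
        img-col-small {a} s = small-img (λ z → col a z) s

    opaque
      -- Since `g` represents κ in the ultrapower by `U`, this represents the pointwise image of
      -- b_α[κ] under the embedding, which includes the pointwise image of α.
      trace : V → V → V
      trace α q = img-app (app enum α) (app g q)

      term-trace₂ : Term₂ trace
      term-trace₂ = auto

      trace-e : ∀ {α q y} → y ∈ trace α q → ∃[ ξ ] ξ ∈ app g q × y ≡ app (app enum α) ξ
      trace-e = img-e

      trace-i : ∀ {α q ξ} → ξ ∈ app g q → app (app enum α) ξ ∈ trace α q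
      trace-i = img-i

      trace-small : ∀ {α q} → q ∈ κ → Small (trace α q)
      trace-small {α} qκ = img-app-small (small-∈κ (g-κ qκ))

    opaque
      instance
        term-trace : ∀ {n} {s t : Env n → V} → ⦃ Term s ⦄ → ⦃ Term t ⦄ → Term (λ ρ → trace (s ρ) (t ρ))
        term-trace ⦃ c ⦄ ⦃ d ⦄ = term-sub₂ {h = trace} term-trace₂ c d

    -- canonical α (base p) represents i(α) in M (π-collapse below).
    opaque
      canonical : V → V → V
      canonical α q = col (trace α q) α

      canonical-≡ : ∀ α q → canonical α q ≡ col (trace α q) α
      canonical-≡ α q = refl

      term-canonical₂ : Term₂ canonical
      term-canonical₂ = auto

    opaque
      instance
        term-canonical : ∀ {n} {s t : Env n → V} → ⦃ Term s ⦄ → ⦃ Term t ⦄ → Term (λ ρ → canonical (s ρ) (t ρ))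
        term-canonical ⦃ c ⦄ ⦃ d ⦄ = term-sub₂ {h = canonical} term-canonical₂ c d

    opaque
      small-col : ∀ {a x} → Small a → Small (col a x)
      small-col {a} s = small-⊆ {B = img-col a a}
        (λ u uc → let (z , _ , za , e) = col-e uc in subst (_∈ img-col a a) (sym e) (img-i za)) (img-col-small s)

    opaque
      -- The collapse is an ordinal of small size; an ordinal not below κ would include κ, which is
      -- not small.
      canonical-κ : ∀ {α q} → α ∈ κ⁺ → q ∈ κ → canonical α q ∈ κ
      canonical-κ {α} {q} α⁺ qκ = subst (_∈ κ) (sym (canonical-≡ α q))
        (case O-trichotomy oc oκ of λ
          { (inj₁ k) → k
          ; (inj₂ (inj₁ k)) → ⊥-elim (κ-not-small (small-⊆ (λ u → subst (u ∈_) (sym k)) sm))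
          ; (inj₂ (inj₂ k)) → ⊥-elim (κ-not-small (small-⊆ (proj₁ oc κ k) sm)) })
        where
          oc : O (col (trace α q) α)
          oc = col-O (trace α q) α (O-elem κ⁺-O α⁺)
          sm : Small (col (trace α q) α)
          sm = small-col (trace-small qκ)

    -- The ultrafilter W

    opaque
      -- The components q, δ and a of the triple with index `p`.
      base dlt fam : V → V
      base p = fst (app triple p)
      dlt p = fst (snd (app triple p))
      fam p = snd (snd (app triple p))

      term-base₁ : Term₁ base
      term-base₁ = auto

      term-dlt₁ : Term₁ dlt
      term-dlt₁ = auto

      term-fam₁ : Term₁ fam
      term-fam₁ = auto

      decode : ∀ {q δ a θ} → θ ∈ κ → q ∈ θ → δ ∈ θ → a ⊆ θ → ∃[ p ] p ∈ κ × base p ≡ q × dlt p ≡ δ × fam p ≡ a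
      decode θκ qθ δθ aθ = let (p , pκ , e) = triple-onto θκ qθ δθ aθ ; e₂ = snd-≡ e in
        p , pκ , fst-≡ e , fst-≡ e₂ , snd-≡ e₂

    opaque
      instance
        term-base : ∀ {n} {s : Env n → V} → ⦃ Term s ⦄ → Term (λ ρ → base (s ρ))
        term-base ⦃ c ⦄ = term-sub₁ {h = base} term-base₁ c

        term-dlt : ∀ {n} {s : Env n → V} → ⦃ Term s ⦄ → Term (λ ρ → dlt (s ρ))
        term-dlt ⦃ c ⦄ = term-sub₁ {h = dlt} term-dlt₁ c

        term-fam : ∀ {n} {s : Env n → V} → ⦃ Term s ⦄ → Term (λ ρ → fam (s ρ))
        term-fam ⦃ c ⦄ = term-sub₁ {h = fam} term-fam₁ c

    private
      -- A base set is named by some Z in `U` and a small subset T of κ⁺. Smallness makes the base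
      -- directed, and singletons T reach every α < κ⁺. One T serves both demands on a triple: all
      -- its elements concern a, those below κ also δ.
      𝔅 : V
      𝔅 = sep (prod U (𝒫 κ⁺)) (λ b → Small (snd b))

      B : V → V → Set ℓ
      B b p = base p ∈ fst b × dlt p ∈ app g (base p) ×
              (∀ α → α ∈ snd b → canonical α (base p) ∈ fam p × (α ∈ κ → α ∈ dlt p)) ×
              (∃[ β ] β ∈ app g (base p) × fam p ≼ β)

      opaque
        def-B : Def₂ B
        def-B = auto

      opaque
        𝔅-e : ∀ {b} → b ∈ 𝔅 → fst b ∈ U × snd b ⊆ κ⁺ × Small (snd b)
        𝔅-e h = let (bp , s) = sep-e h ; (Z , T , ZU , TP , e) = prod-e bp in
          subst (_∈ U) (sym (fst-≡ e)) ZU , 𝒫-e (subst (_∈ 𝒫 κ⁺) (sym (snd-≡ e)) TP) , s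

      opaque
        𝔅-i : ∀ {Z T} → Z ∈ U → T ⊆ κ⁺ → Small T → pair Z T ∈ 𝔅
        𝔅-i ZU Tκ s = sep-i (prod-i ZU (𝒫-i Tκ)) (subst Small (sym snd-pair) s)

      ∩κ : V → V
      ∩κ T = sep T (λ α → α ∈ κ)

      values : V → V → V
      values T q = img T (λ α → canonical α q)

      opaque
        values-bounded : ∀ {T q} → T ⊆ κ⁺ → Small T → q ∈ κ → ∃[ γ ] γ ∈ κ × values T q ⊆ γ
        values-bounded {T} {q} T⁺ small qκ = bounded
          (λ y k → let (α , αT , e) = img-e k in subst (_∈ κ) (sym e) (canonical-κ (T⁺ α αT) qκ))
          (small-img (λ α → canonical α q) small)

      opaque
        encode : ∀ {q δ a γ} → q ∈ κ → δ ∈ κ → γ ∈ κ → a ⊆ γ → ∃[ p ] p ∈ κ × base p ≡ q × dlt p ≡ δ × fam p ≡ a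
        encode {q} {δ} qκ δκ γκ aγ =
          let (θ₁ , θ₁κ , qθ₁ , δθ₁) = κ-max (succ-κ qκ) (succ-κ δκ)
              (θ , θκ , θ₁θ , γθ) = κ-max θ₁κ γκ
          in decode θκ (θ₁θ q (qθ₁ q succ-i₂)) (θ₁θ δ (δθ₁ δ succ-i₂)) (λ y k → γθ y (aγ y k))

      opaque
        B-at : ∀ {b p q δ μ} → q ∈ fst b → δ ∈ app g q → μ ∈ app g q → snd b ≼ μ → ∩κ (snd b) ⊆ δ →
               base p ≡ q → dlt p ≡ δ → fam p ≡ values (snd b) q → B b p
        B-at {b} {p} {q} {δ} {μ} qZ δg μg T≼μ bδ eq eδ ea =
          subst (_∈ fst b) (sym eq) qZ ,
          subst₂ (λ δ q → δ ∈ app g q) (sym eδ) (sym eq) δg ,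
          (λ α αT → subst₂ (λ q a → canonical α q ∈ a) (sym eq) (sym ea) (img-i αT) ,
                    λ ακ → subst (α ∈_) (sym eδ) (bδ α (sep-i αT ακ))) ,
          μ , subst (λ q → μ ∈ app g q) (sym eq) μg ,
          subst (_≼ μ) (sym ea) (≼-img (λ α → canonical α q) T≼μ)

      opaque
        large-point : ∀ {Z δ μ} → Z ∈ U → δ ∈ κ → μ ∈ κ → ∃[ q ] q ∈ κ × q ∈ Z × δ ∈ app g q × μ ∈ app g q
        large-point {Z} ZU δκ μκ = ae-wit (ae-and {P = λ q → q ∈ Z} (Z , ZU , λ _ k → k)
                                                  (ae-and (g-unbounded δκ) (g-unbounded μκ)))

      opaque
        -- Take δ bounding T ∩ κ and μ bounding the size of T. As `g` is unbounded, some q in Z has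
        -- both below g(q), and a is then the set of the f_α(q) with α in T; it is bounded in κ, so
        -- the triple has an index.
        inhabited : ∀ b → b ∈ 𝔅 → ∃[ p ] p ∈ κ × B b p
        inhabited b b𝔅 with 𝔅-e b𝔅
        ... | ZU , T⁺ , small@(μ , μκ , T≼μ)
          with bounded {∩κ (snd b)} (λ y k → proj₂ (sep-e k)) (small-⊆ (λ y k → proj₁ (sep-e k)) small)
        ... | δ , δκ , bδ with large-point ZU δκ μκ
        ... | q , qκ , qZ , δg , μg with values-bounded T⁺ small qκ
        ... | γ , γκ , bγ with encode qκ δκ γκ bγ
        ... | p , pκ , eq , eδ , ea = p , pκ , B-at qZ δg μg T≼μ bδ eq eδ ea

      opaque
        -- The sets Z are intersected and the sets T united; the remaining conditions in `B` do not
        -- depend on the name.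
        directed : ∀ Y → Y ⊆ 𝔅 → Small Y → ∃[ b ] b ∈ 𝔅 × (∀ p → p ∈ κ → B b p → ∀ y → y ∈ Y → B y p)
        directed Y Y𝔅 small = pair Z T , 𝔅-i ZU T⁺ sT , λ p pκ (qZ , δg , all , card) y yY →
            proj₂ (sep-e (subst (base p ∈_) fst-pair qZ)) y yY , δg ,
            (λ α αy → all α (subst (α ∈_) (sym snd-pair) (⋃-i (img-i yY) αy))) , card
          where
            Z T : V
            Z = sep κ (λ q → ∀ y → y ∈ Y → q ∈ fst y)
            T = ⋃ (img Y (λ y → snd y))
            ZU : Z ∈ U
            ZU = ae-set (λ q → ∀ y → y ∈ Y → q ∈ fst y)
                   (ae-all small (λ y q → q ∈ fst y) λ y yY → fst y , proj₁ (𝔅-e (Y𝔅 y yY)) , λ _ k → k)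
            T⁺ : T ⊆ κ⁺
            T⁺ α αT = let (X , Xi , αX) = ⋃-e αT ; (y , yY , e) = img-e Xi in
              proj₁ (proj₂ (𝔅-e (Y𝔅 y yY))) α (subst (α ∈_) e αX)
            sT : Small T
            sT = small-⋃ (small-img (λ y → snd y) small) λ X Xi → let (y , yY , e) = img-e Xi in
              subst Small (sym e) (proj₂ (proj₂ (𝔅-e (Y𝔅 y yY))))

      opaque
        measure : ∃[ W ] IsU W × (∀ b → b ∈ 𝔅 → Large W (B b))
        measure = FilterBase.ultrafilter 𝔅 B def-B directed inhabited

      κ∈U : κ ∈ U
      κ∈U = IsFilter.whole (proj₁ (proj₁ U-isU))

    opaque
      W : V
      W = proj₁ measure

      W-isU : IsU W
      W-isU = proj₁ (proj₂ measure)

      W-large : ∀ b → b ∈ 𝔅 → Large W (B b)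
      W-large = proj₂ (proj₂ measure)

    module MW = Measure W W-isU

    private
      W-Spec : V → V → V → Set ℓ
      W-Spec Z T p = base p ∈ Z × dlt p ∈ app g (base p) ×
                     (∀ α → α ∈ T → canonical α (base p) ∈ fam p × (α ∈ κ → α ∈ dlt p)) ×
                     (∃[ β ] β ∈ app g (base p) × fam p ≼ β)

      opaque
        B⇒ : ∀ {Z T p} → B (pair Z T) p → W-Spec Z T p
        B⇒ {Z} {T} {p} (h , k , l , m) = subst (base p ∈_) fst-pair h , k ,
          (λ α αT → l α (subst (α ∈_) (sym snd-pair) αT)) , m

      opaque
        W-spec : ∀ {Z T} → Z ∈ U → T ⊆ κ⁺ → Small T → MW.AE (W-Spec Z T)
        W-spec {Z} {T} ZU T⁺ sT = MW.ae-mono (W-large (pair Z T) (𝔅-i ZU T⁺ sT)) λ p _ → B⇒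

      ∅-small : Small ∅
      ∅-small = small-∈κ ∅∈κ

      opaque
        W-∅ : ∀ {Z} → Z ∈ U → MW.AE (W-Spec Z ∅)
        W-∅ ZU = W-spec ZU (λ y h → ⊥-elim (∅-e h)) ∅-small

      opaque
        W-sg : ∀ {α} → α ∈ κ⁺ → MW.AE (W-Spec κ (sg α))
        W-sg α⁺ = W-spec κ∈U (λ y h → subst (_∈ κ⁺) (sym (sg-e h)) α⁺) small-pr

    opaque
      W-base : (P : V → Set ℓ) → AE P → MW.AE (λ p → P (base p))
      W-base P (Z , ZU , h) = MW.ae-mono (W-∅ ZU) λ p _ s → h (base p) (proj₁ s)

    opaque
      W-base-κ : MW.AE (λ p → base p ∈ κ)
      W-base-κ = MW.ae-mono (W-∅ κ∈U) λ p _ → proj₁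

    opaque
      W-dlt : MW.AE (λ p → dlt p ∈ app g (base p))
      W-dlt = MW.ae-mono (W-∅ κ∈U) λ p _ s → proj₁ (proj₂ s)

    opaque
      W-canonical : ∀ {α} → α ∈ κ⁺ → MW.AE (λ p → canonical α (base p) ∈ fam p)
      W-canonical {α} α⁺ = MW.ae-mono (W-sg α⁺) λ p _ s → proj₁ (proj₁ (proj₂ (proj₂ s)) α sg-i)

    opaque
      W-unbounded : ∀ {ξ} → ξ ∈ κ → MW.AE (λ p → ξ ∈ dlt p)
      W-unbounded {ξ} ξκ = MW.ae-mono (W-sg (κ⊆κ⁺ ξ ξκ)) λ p _ s → proj₂ (proj₁ (proj₂ (proj₂ s)) ξ sg-i) ξκ

    opaque
      W-fam : MW.AE (λ p → ∃[ β ] β ∈ app g (base p) × fam p ≼ β)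
      W-fam = MW.ae-mono (W-∅ κ∈U) λ p _ s → proj₂ (proj₂ (proj₂ s))

    all-at : ∀ {n} {P : V → Set ℓ} {xs : Vec V n} → All P xs → ∀ i → P (lookup xs i)
    all-at (p ∷ ps) zero    = p
    all-at (p ∷ ps) (suc i) = all-at ps i

    -- Relativised formulas

    -- While `Code` speaks of truth in V and allows parameters, here a single formula has to express
    -- the predicate in every class `C`, so that its truth can be carried from V to an ultrapower.
    record Pure {n} (P : Class → Env n → Set ℓ) : Set (lsuc ℓ) where
      no-eta-equality
      constructor pure
      field
        formula : Formula n
        correct : ∀ C ρ → P C ρ ⇔ Sat C formula ρ

    open Pure

    opaque
      p-eq : ∀ {n} (i j : Fin n) → Pure (λ C ρ → lookup ρ i ≡ lookup ρ j)
      p-eq i j = pure (i ≐ j) λ C ρ → mk⇔ id id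

      p-mem : ∀ {n} (i j : Fin n) → Pure (λ C ρ → lookup ρ i ∈ lookup ρ j)
      p-mem i j = pure (i ∈̇ j) λ C ρ → mk⇔ id id

      p-imp : ∀ {n} {P Q : Class → Env n → Set ℓ} → Pure P → Pure Q → Pure (λ C ρ → P C ρ → Q C ρ)
      p-imp p q = pure (formula p ⇒̇ formula q) λ C ρ →
        mk⇔ (λ h s → to (correct q C ρ) (h (from (correct p C ρ) s)))
            (λ h s → from (correct q C ρ) (h (to (correct p C ρ) s)))

      p-all : ∀ {n} {P : Class → Env (suc n) → Set ℓ} → Pure P → Pure (λ C ρ → ∀ x → C x → P C (x ∷ ρ))
      p-all p = pure (∀̇ formula p) λ C ρ →
        mk⇔ (λ h x Cx → to (correct p C (x ∷ ρ)) (h x Cx)) (λ h x Cx → from (correct p C (x ∷ ρ)) (h x Cx))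

      p-equiv : ∀ {n} {P Q : Class → Env n → Set ℓ} → (∀ C ρ → P C ρ → Q C ρ) → (∀ C ρ → Q C ρ → P C ρ) → Pure P → Pure Q
      p-equiv f g p = pure (formula p) λ C ρ →
        mk⇔ (λ h → to (correct p C ρ) (g C ρ h)) (λ h → f C ρ (from (correct p C ρ) h))

      p-not : ∀ {n} {P : Class → Env n → Set ℓ} → Pure P → Pure (λ C ρ → ¬ P C ρ)
      p-not p = p-equiv (λ C ρ h x → lower (h x)) (λ C ρ h x → lift (h x)) (p-imp p (pure ⊥̇ λ C ρ → mk⇔ id id))

    opaque
      p-and : ∀ {n} {P Q : Class → Env n → Set ℓ} → Pure P → Pure Q → Pure (λ C ρ → P C ρ × Q C ρ)
      p-and p q = p-equiv (λ C ρ h → dne λ n → h λ a b → n (a , b)) (λ C ρ (a , b) h → h a b)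
                          (p-not (p-imp p (p-not q)))

      p-or : ∀ {n} {P Q : Class → Env n → Set ℓ} → Pure P → Pure Q → Pure (λ C ρ → P C ρ ⊎ Q C ρ)
      p-or {P = P} p q = p-equiv (λ C ρ h → by-cases (P C ρ) inj₁ (inj₂ ∘ h))
                         (λ { C ρ (inj₁ a) n → ⊥-elim (n a) ; C ρ (inj₂ b) _ → b }) (p-imp (p-not p) q)

      p-iff : ∀ {n} {P Q : Class → Env n → Set ℓ} → Pure P → Pure Q → Pure (λ C ρ → P C ρ ⇔ Q C ρ)
      p-iff p q = p-equiv (λ C ρ (f , g) → mk⇔ f g) (λ C ρ h → to h , from h) (p-and (p-imp p q) (p-imp q p))

      p-ex : ∀ {n} {P : Class → Env (suc n) → Set ℓ} → Pure P → Pure (λ C ρ → ∃[ x ] C x × P C (x ∷ ρ))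
      p-ex p = p-equiv (λ C ρ h → dne λ n → h λ x Cx a → n (x , Cx , a)) (λ C ρ (x , Cx , a) h → h x Cx a)
                       (p-not (p-all (p-not p)))

    ren : ∀ {n m} → (Fin n → Fin m) → Formula n → Formula m
    ren r (i ≐ j) = r i ≐ r j
    ren r (i ∈̇ j) = r i ∈̇ r j
    ren r ⊥̇       = ⊥̇
    ren r (φ ⇒̇ ψ) = ren r φ ⇒̇ ren r ψ
    ren r (∀̇ φ)   = ∀̇ ren (λ { zero → zero ; (suc i) → suc (r i) }) φ

    sat-ren : ∀ {n m} C (r : Fin n → Fin m) φ (σ : Env m) (ρ : Env n) →
              (∀ i → lookup σ (r i) ≡ lookup ρ i) → Sat C φ ρ ⇔ Sat C (ren r φ) σ
    sat-ren C r (i ≐ j) σ ρ e = mk⇔ (subst₂ _≡_ (sym (e i)) (sym (e j))) (subst₂ _≡_ (e i) (e j))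
    sat-ren C r (i ∈̇ j) σ ρ e = mk⇔ (subst₂ _∈_ (sym (e i)) (sym (e j))) (subst₂ _∈_ (e i) (e j))
    sat-ren C r ⊥̇       σ ρ e = mk⇔ id id
    sat-ren C r (φ ⇒̇ ψ) σ ρ e =
      mk⇔ (λ h s → to (sat-ren C r ψ σ ρ e) (h (from (sat-ren C r φ σ ρ e) s)))
          (λ h s → from (sat-ren C r ψ σ ρ e) (h (to (sat-ren C r φ σ ρ e) s)))
    sat-ren C r (∀̇ φ)   σ ρ e = mk⇔ (λ h x Cx → to (ih x) (h x Cx)) (λ h x Cx → from (ih x) (h x Cx))
      where
        ih : ∀ x → _
        ih x = sat-ren C _ φ (x ∷ σ) (x ∷ ρ) λ { zero → refl ; (suc i) → e i }

    p-sat : ∀ {n m} (φ : Formula n) (r : Fin n → Fin m) (f : Env m → Env n) →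
            (∀ σ i → lookup σ (r i) ≡ lookup (f σ) i) → Pure (λ C σ → Sat C φ (f σ))
    p-sat φ r f h = pure (ren r φ) λ C σ → sat-ren C r φ σ (f σ) (h σ)

    opaque
      -- There is no truth definition; the recursion is over a fixed formula of the metatheory, with
      -- environments given by definable terms.
      def-Sat : ∀ {k n} (φ : Formula n) (σ : Env k → Vec V n) → (∀ i → Term (λ ρ → lookup (σ ρ) i)) →
                Code (λ ρ → Sat Univ φ (σ ρ))
      def-Sat (i ≐ j) σ T = def-eq ⦃ T i ⦄ ⦃ T j ⦄
      def-Sat (i ∈̇ j) σ T = def-mem ⦃ T i ⦄ ⦃ T j ⦄
      def-Sat ⊥̇       σ T = def-bot
      def-Sat (φ ⇒̇ ψ) σ T = c-imp (def-Sat φ σ T) (def-Sat ψ σ T)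
      def-Sat (∀̇ φ)   σ T = c-all {P = λ ρ x → Univ x → Sat Univ φ (x ∷ σ ρ)} (c-imp def-top
        (def-Sat φ (λ ρ → head ρ ∷ σ (tail ρ)) λ
          { zero → term-v0 ; (suc i) → term (c-weaken {t = λ ρ → lookup (σ ρ) i} (graph (T i))) }))

      term-cong : ∀ {n} {s t : Env n → V} → (∀ ρ → s ρ ≡ t ρ) → Term s → Term t
      term-cong h c = term (c-equiv (λ { (y ∷ ρ) → mk⇔ (λ e → trans e (h ρ)) (λ e → trans e (sym (h ρ))) }) (graph c))

    -- Functions on κ: constants, pairs, compositions and sequences

    opaque
      cst : V → V
      cst x = lam κ (λ _ → x)

      term-cst₁ : Term₁ cst
      term-cst₁ = auto

      cst-app : ∀ {x p} → p ∈ κ → app (cst x) p ≡ x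
      cst-app = app-lam

      _⟨,⟩_ : V → V → V
      F ⟨,⟩ G = lam κ (λ p → pair (app F p) (app G p))

      ⟨,⟩-app : ∀ {F G p} → p ∈ κ → app (F ⟨,⟩ G) p ≡ pair (app F p) (app G p)
      ⟨,⟩-app = app-lam

      _⊚_ : V → V → V
      h ⊚ F = lam κ (λ p → app h (app F p))

      ⊚-app : ∀ {h F p} → p ∈ κ → app (h ⊚ F) p ≡ app h (app F p)
      ⊚-app = app-lam

    opaque
      instance
        term-cst : ∀ {n} {s : Env n → V} → ⦃ Term s ⦄ → Term (λ ρ → cst (s ρ))
        term-cst ⦃ c ⦄ = term-sub₁ {h = cst} term-cst₁ c

    -- Packing finitely many functions into one lets Skolem functions of a single argument suffice
    -- in Łoś's theorem.
    tuple : ∀ {n} → Vec V n → V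
    tuple []       = cst ∅
    tuple (F ∷ Fs) = F ⟨,⟩ tuple Fs

    untuple : ∀ n → V → Vec V n
    untuple zero    v = []
    untuple (suc n) v = fst v ∷ untuple n (snd v)

    opaque
      untuple-tuple : ∀ {n p} (Fs : Vec V n) → p ∈ κ → untuple n (app (tuple Fs) p) ≡ map (λ F → app F p) Fs
      untuple-tuple []       pκ = refl
      untuple-tuple (F ∷ Fs) pκ = cong₂ _∷_ (fst-≡ (⟨,⟩-app pκ))
        (trans (cong (untuple _) (snd-≡ (⟨,⟩-app pκ))) (untuple-tuple Fs pκ))

    opaque
      term-untuple : ∀ {k} n (t : Env k → V) → Term t → ∀ i → Term (λ ρ → lookup (untuple n (t ρ)) i)
      term-untuple (suc n) t c zero    = term-sub₁ {h = fst} auto c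
      term-untuple (suc n) t c (suc i) = term-untuple n (λ ρ → snd (t ρ)) (term-sub₁ {h = snd} auto c) i

    opaque
      sequence : V → V → V
      sequence D Φ = lam κ (λ p → lam (app D p) (λ ν → app (app Φ ν) p))

      sequence-app : ∀ {D Φ p} → p ∈ κ → app (sequence D Φ) p ≡ lam (app D p) (λ ν → app (app Φ ν) p)
      sequence-app = app-lam

    opaque
      definable : {P : V → Set ℓ} → Def₁ P → Definable P
      definable {P} c = Code.m c , Code.fm c (_↑ˡ _) (1 ↑ʳ_) , tabulate (Code.pm c) , λ x →
        Code.ok c (_↑ˡ _) (1 ↑ʳ_) (x ∷ tabulate (Code.pm c)) (x ∷ []) (λ { zero → refl }) (lookup∘tabulate (Code.pm c))

    opaque
      definable-on : {D : Class} {f : V → V} {Q : V → V → Set ℓ} → Def₂ Q →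
                     (∀ x y → D x → (f x ≡ y) ⇔ Q x y) → DefinableOn D f
      definable-on {Q = Q} c h = Code.m c , Code.fm c (_↑ˡ _) (2 ↑ʳ_) , tabulate (Code.pm c) , λ x y Dx →
        let k = Code.ok c (_↑ˡ _) (2 ↑ʳ_) (x ∷ y ∷ tabulate (Code.pm c)) (x ∷ y ∷ [])
                  (λ { zero → refl ; (suc zero) → refl }) (lookup∘tabulate (Code.pm c))
        in mk⇔ (λ e → to k (to (h x y Dx) e)) (λ s → from (h x y Dx) (from k s))

    private
      i₀ : ∀ {n} → Fin (1 +ℕ n)
      i₀ = zero

      i₁ : ∀ {n} → Fin (2 +ℕ n)
      i₁ = suc zero

      i₂ : ∀ {n} → Fin (3 +ℕ n)
      i₂ = suc (suc zero)

      i₃ : ∀ {n} → Fin (4 +ℕ n)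
      i₃ = suc (suc (suc zero))

      sat-sep : ∀ {n} (φ : Formula (1 +ℕ n)) → Pure {3 +ℕ n} (λ C σ → Sat C φ (head σ ∷ tail (tail (tail σ))))
      sat-sep φ = p-sat φ (λ { zero → i₀ ; (suc i) → suc (suc (suc i)) }) _
        λ { (_ ∷ _ ∷ _ ∷ _) zero → refl ; (_ ∷ _ ∷ _ ∷ _) (suc i) → refl }

      sat-rep₁ : ∀ {n} (φ : Formula (2 +ℕ n)) →
        Pure {4 +ℕ n} (λ C σ → Sat C φ (head (tail (tail σ)) ∷ head (tail σ) ∷ tail (tail (tail (tail σ)))))
      sat-rep₁ φ = p-sat φ (λ { zero → i₂ ; (suc zero) → i₁ ; (suc (suc i)) → suc (suc (suc (suc i))) }) _
        λ { (_ ∷ _ ∷ _ ∷ _ ∷ _) zero → refl ; (_ ∷ _ ∷ _ ∷ _ ∷ _) (suc zero) → refl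
          ; (_ ∷ _ ∷ _ ∷ _ ∷ _) (suc (suc i)) → refl }

      sat-rep₂ : ∀ {n} (φ : Formula (2 +ℕ n)) →
        Pure {4 +ℕ n} (λ C σ → Sat C φ (head (tail (tail σ)) ∷ head σ ∷ tail (tail (tail (tail σ)))))
      sat-rep₂ φ = p-sat φ (λ { zero → i₂ ; (suc zero) → i₀ ; (suc (suc i)) → suc (suc (suc (suc i))) }) _
        λ { (_ ∷ _ ∷ _ ∷ _ ∷ _) zero → refl ; (_ ∷ _ ∷ _ ∷ _ ∷ _) (suc zero) → refl
          ; (_ ∷ _ ∷ _ ∷ _ ∷ _) (suc (suc i)) → refl }

      sat-rep₃ : ∀ {n} (φ : Formula (2 +ℕ n)) →
        Pure {4 +ℕ n} (λ C σ → Sat C φ (head σ ∷ head (tail σ) ∷ tail (tail (tail (tail σ)))))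
      sat-rep₃ φ = p-sat φ (λ { zero → i₀ ; (suc zero) → i₁ ; (suc (suc i)) → suc (suc (suc (suc i))) }) _
        λ { (_ ∷ _ ∷ _ ∷ _ ∷ _) zero → refl ; (_ ∷ _ ∷ _ ∷ _ ∷ _) (suc zero) → refl
          ; (_ ∷ _ ∷ _ ∷ _ ∷ _) (suc (suc i)) → refl }

      RelO : Class → V → Set ℓ
      RelO C x = (∀ y → C y → y ∈ x → ∀ z → C z → z ∈ y → z ∈ x) ×
                 (∀ y → C y → y ∈ x → ∀ z → C z → z ∈ y → ∀ w → C w → w ∈ z → w ∈ y)

      opaque
        p-RelO : Pure {1} (λ C ρ → RelO C (lookup ρ zero))
        p-RelO = p-and
          (p-all (p-imp (p-mem zero (suc zero)) (p-all (p-imp (p-mem zero (suc zero)) (p-mem zero (suc (suc zero)))))))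
          (p-all (p-imp (p-mem zero (suc zero)) (p-all (p-imp (p-mem zero (suc zero))
            (p-all (p-imp (p-mem zero (suc zero)) (p-mem zero (suc (suc zero)))))))))

    -- Ultrapowers and Łoś's theorem

    -- The witnesses in Łoś's theorem can be taken of the form h ∘ ⟨F₁ , ... , Fₙ⟩ with h a set,
    -- which is why closure under pairing and composition is demanded.
    record FunctionClass (𝒟 : V → Set ℓ) : Set ℓ where
      no-eta-equality
      field
        def-𝒟  : Def₁ 𝒟
        𝒟-≈    : ∀ {F G} → 𝒟 F → MW.AE (λ p → app F p ≡ app G p) → 𝒟 G
        𝒟-pair : ∀ {F G} → 𝒟 F → 𝒟 G → 𝒟 (F ⟨,⟩ G)
        𝒟-comp : ∀ {h F} → 𝒟 F → 𝒟 (h ⊚ F)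
        𝒟-cst  : ∀ x → 𝒟 (cst x)

    -- The ultrapower by W restricted to a class 𝒟 of functions on κ.  Any set F
    -- stands for the function p ↦ app F p.
    module Ultrapower (𝒟 : V → Set ℓ) (class : FunctionClass 𝒟) where

      open FunctionClass class
      open MW using () renaming (AE to AEW)

      private opaque
        instance
          def-𝒟′ : ∀ {n} {s : Env n → V} → ⦃ Term s ⦄ → Code (λ ρ → 𝒟 (s ρ))
          def-𝒟′ ⦃ c ⦄ = def-sub₁ {P = 𝒟} def-𝒟 c

      -- The representatives are cut down to subsets of Σₚ F(p), which makes the
      -- relation set-like.
      ε : V → V → V → Set ℓ
      ε c z F = 𝒟 z × (∀ u → u ∈ z → ∃[ p ] ∃[ v ] u ≡ pair p v × p ∈ κ × v ∈ app F p) ×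
                AEW (λ p → app z p ∈ app F p)

      private
        opaque
          def-ε : Def₃ ε
          def-ε = auto

        opaque
          -- If T₀ is transitive and contains F, all predecessors of F are subsets of κ × T₀.
          -- Transitivity of T₀ keeps the values of such subsets, and the members of these values,
          -- inside T₀, so the predecessors of predecessors are of the same kind.
          cover : ∀ c F → ∃[ T ] F ∈ T × (∀ y z → y ∈ T → ε c z y → z ∈ T)
          cover c F = let (T₀ , FT₀ , tr) = transitive-cover F in
            sg F ∪ 𝒫 (prod κ T₀) , ∪-i₁ sg-i , λ y z yT (_ , h , _) → ∪-i₂ (𝒫-i λ u uz →
              let (p , v , e , pκ , vy) = h u uz in subst (_∈ prod κ T₀) (sym e) (prod-i pκ
                (case ∪-e yT of λ
                  { (inj₁ ys) → in-F T₀ FT₀ tr p v (subst (λ y → v ∈ app y p) (sg-e ys) vy)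
                  ; (inj₂ yP) → in-P T₀ tr y p v yP vy })))
            where
              in-F : ∀ T₀ → F ∈ T₀ → Trans T₀ → ∀ p v → v ∈ app F p → v ∈ T₀
              in-F T₀ FT₀ tr p v vF = case app-value F p of λ
                { (inj₁ k) → let pT = tr F FT₀ _ k
                                 q : pr p (app F p) ∈ pair p (app F p)
                                 q = subst (pr p (app F p) ∈_) (sym (pair-def _ _)) pr-i₂
                             in tr _ (tr _ (tr _ pT _ q) _ pr-i₂) v vF
                ; (inj₂ e) → ⊥-elim (∅-e (subst (v ∈_) e vF)) }
              in-P : ∀ T₀ → Trans T₀ → ∀ y p v → y ∈ 𝒫 (prod κ T₀) → v ∈ app y p → v ∈ T₀
              in-P T₀ tr y p v yP vy = case app-value y p of λ
                { (inj₁ k) → let (a , b , _ , bT , e) = prod-e (𝒫-e yP _ k) in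
                             tr _ (subst (_∈ T₀) (sym (proj₂ (pair-inj e))) bT) v vy
                ; (inj₂ e) → ⊥-elim (∅-e (subst (v ∈_) e vy)) }

        opaque
          min : ∀ c T → (∃[ x ] x ∈ T) → ∃[ m ] m ∈ T × (∀ z → ε c z m → ¬ z ∈ T)
          min c T ne = let (m , mT , h) = MW.ae-wf T ne in m , mT , λ z (_ , _ , a) → h z a

        G : V → V → V → V
        G c x w = w

        opaque
          term-G : Term₃ G
          term-G = term-v2

        opaque
          π-recursor : Recursor ε G
          π-recursor = recursor ε def-ε G term-G cover min

        module Π = Recursor π-recursor
        open Π using () renaming (term-H to term-Π)

      opaque
        -- The transitive collapse of the ultrapower, taken on functions in place of their
        -- equivalence classes; `π-cong` and `π-inj` show that it identifies exactly the functions
        -- of `𝒟` that agree almost everywhere.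
        π : V → V
        π F = Π.H ∅ F

        term-π₁ : Term₁ π
        term-π₁ = auto

        π-e : ∀ {F u} → u ∈ π F → ∃[ z ] ε ∅ z F × u ≡ π z
        π-e {F} {u} h = let (w , vals , e) = Π.H-eq ∅ F in proj₁ (vals u) (subst (u ∈_) e h)

        π-i : ∀ {F z} → ε ∅ z F → π z ∈ π F
        π-i {F} {z} h = let (w , vals , e) = Π.H-eq ∅ F in subst (π z ∈_) (sym e) (proj₂ (vals (π z)) (z , h , refl))

      opaque
        instance
          term-π : ∀ {n} {s : Env n → V} → ⦃ Term s ⦄ → Term (λ ρ → π (s ρ))
          term-π ⦃ c ⦄ = term-sub₁ {h = π} term-π₁ c

      ε-induction : (P : V → Set ℓ) ⦃ d : Def₁ P ⦄ → (∀ F → (∀ z → ε ∅ z F → P z) → P F) → ∀ F → P F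
      ε-induction P ⦃ d ⦄ = well-founded-induction (ε ∅) (cover ∅) (min ∅) P d

      opaque
        ε-𝒟 : ∀ {z F} → ε ∅ z F → 𝒟 z
        ε-𝒟 = proj₁

      opaque
        ε-AE : ∀ {z F} → ε ∅ z F → AEW (λ p → app z p ∈ app F p)
        ε-AE (_ , _ , h) = h

      opaque
        cut : ∀ {G F} → 𝒟 G → AEW (λ p → app G p ∈ app F p) → ∃[ z ] ε ∅ z F × AEW (λ p → app z p ≡ app G p)
        cut {G} {F} DG a = z , (𝒟-≈ DG (MW.ae-mono z≡ λ p _ e → sym e) ,
            (λ u uz → let (p , pX , e) = lam-e uz ; (pκ , h) = sep-e pX in p , app G p , e , pκ , h) ,
            MW.ae-mono₂ z≡ a (λ p _ e h → subst (_∈ app F p) (sym e) h)) , z≡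
          where
            z : V
            z = lam (sep κ (λ p → app G p ∈ app F p)) (λ p → app G p)
            z≡ : AEW (λ p → app z p ≡ app G p)
            z≡ = MW.ae-mono a λ p pκ h → app-lam (sep-i pκ h)

      opaque
        π-cong : ∀ F F′ → AEW (λ p → app F p ≡ app F′ p) → π F ≡ π F′
        π-cong = ε-induction (λ F → ∀ F′ → AEW (λ p → app F p ≡ app F′ p) → π F ≡ π F′) λ F ih F′ a → ext
          (λ u h → let (z , zF , e) = π-e h
                       (z′ , z′F′ , b) = cut (ε-𝒟 zF) (MW.ae-mono₂ (ε-AE zF) a λ p _ h q → subst (app z p ∈_) q h)
                   in subst (_∈ π F′) (sym (trans e (ih z zF z′ (MW.ae-mono b λ p _ → sym)))) (π-i z′F′))
          (λ u h → let (z′ , z′F′ , e) = π-e h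
                       (z , zF , b) = cut (ε-𝒟 z′F′) (MW.ae-mono₂ (ε-AE z′F′) a λ p _ h q → subst (app z′ p ∈_) (sym q) h)
                   in subst (_∈ π F) (trans (ih z zF z′ b) (sym e)) (π-i zF))

      opaque
        -- The witness is chosen as a function of the value F(p), not of p. It thus has the form h ∘
        -- F and stays in `𝒟`.
        skolem : ∀ {F} (R : V → V → Set ℓ) ⦃ d : Def₂ R ⦄ → 𝒟 F → AEW (λ p → ∃[ y ] R (app F p) y) →
                 ∃[ K ] 𝒟 K × AEW (λ p → R (app F p) (app K p))
        skolem {F} R ⦃ d ⦄ DF a =
          let (h , hh) = choose (img κ (λ p → app F p)) (λ v y → (∃[ z ] R v z) → R v y) ⦃ def ⦄
                (λ v _ → by-cases (∃[ z ] R v z) (λ (z , r) → z , λ _ → r) (λ n → ∅ , λ r → ⊥-elim (n r)))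
          in h ⊚ F , 𝒟-comp DF , MW.ae-mono a λ p pκ r → subst (R (app F p)) (sym (⊚-app pκ)) (hh _ (img-i pκ) r)
          where
            def : Def₂ (λ v y → (∃[ z ] R v z) → R v y)
            def = c-imp (c-ex {P = λ ρ z → R (head ρ) z} (def-sub₂ {P = R} d auto auto)) d

      opaque
        𝒟-differ : ∀ {F F′} → 𝒟 F → 𝒟 F′ → AEW (λ p → ∃[ v ] v ∈ app F p × ¬ v ∈ app F′ p) →
                   ∃[ K ] 𝒟 K × AEW (λ p → app K p ∈ app F p × ¬ app K p ∈ app F′ p)
        𝒟-differ {F} {F′} DF DF′ a =
          let (K , DK , b) = skolem (λ v y → y ∈ fst v × ¬ y ∈ snd v) (𝒟-pair DF DF′)
                (MW.ae-mono a λ p pκ (v , h , n) → v ,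
                  subst (v ∈_) (sym (fst-≡ (⟨,⟩-app pκ))) h , λ k → n (subst (v ∈_) (snd-≡ (⟨,⟩-app pκ)) k))
          in K , DK , MW.ae-mono b λ p pκ (h , n) →
               subst (app K p ∈_) (fst-≡ (⟨,⟩-app pκ)) h , λ k → n (subst (app K p ∈_) (sym (snd-≡ (⟨,⟩-app pκ))) k)

      opaque
        -- If the values differed on a large set, `𝒟` would contain a function selecting elements of
        -- the difference. Its collapse is a member of both sides, and the induction hypothesis
        -- applied to it gives a contradiction.
        π-inj : ∀ F → 𝒟 F → ∀ F′ → 𝒟 F′ → π F ≡ π F′ → AEW (λ p → app F p ≡ app F′ p)
        π-inj = ε-induction (λ F → 𝒟 F → ∀ F′ → 𝒟 F′ → π F ≡ π F′ → AEW (λ p → app F p ≡ app F′ p)) step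
          where
            step : ∀ F → (∀ z → ε ∅ z F → 𝒟 z → ∀ F′ → 𝒟 F′ → π z ≡ π F′ → AEW (λ p → app z p ≡ app F′ p)) →
                   𝒟 F → ∀ F′ → 𝒟 F′ → π F ≡ π F′ → AEW (λ p → app F p ≡ app F′ p)
            step F ih DF F′ DF′ e = MW.ae-mono₂
              (MW.ae-not (λ p → ∃[ v ] v ∈ app F p × ¬ v ∈ app F′ p) no₁)
              (MW.ae-not (λ p → ∃[ v ] v ∈ app F′ p × ¬ v ∈ app F p) no₂)
              λ p _ n₁ n₂ → ext (λ v h → dne λ k → n₁ (v , h , k)) (λ v h → dne λ k → n₂ (v , h , k))
              where
                no₁ : ¬ AEW (λ p → ∃[ v ] v ∈ app F p × ¬ v ∈ app F′ p)
                no₁ a =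
                  let (K , DK , b) = 𝒟-differ DF DF′ a
                      (z , zF , q) = cut DK (MW.ae-mono b λ p _ → proj₁)
                      (z′ , z′F′ , r) = π-e (subst (π z ∈_) e (π-i zF))
                      s = ih z zF (ε-𝒟 zF) z′ (ε-𝒟 z′F′) r
                      (p , _ , b₁ , q₁ , s₁ , t₁) = MW.ae-wit (MW.ae-and b (MW.ae-and q (MW.ae-and s (ε-AE z′F′))))
                  in proj₂ b₁ (subst (_∈ app F′ p) (trans (sym s₁) q₁) t₁)
                no₂ : ¬ AEW (λ p → ∃[ v ] v ∈ app F′ p × ¬ v ∈ app F p)
                no₂ a =
                  let (K , DK , b) = 𝒟-differ DF′ DF a
                      (z′ , z′F′ , q) = cut DK (MW.ae-mono b λ p _ → proj₁)
                      (z , zF , r) = π-e (subst (π z′ ∈_) (sym e) (π-i z′F′))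
                      s = ih z zF (ε-𝒟 zF) z′ (ε-𝒟 z′F′) (sym r)
                      (p , _ , b₁ , q₁ , s₁ , t₁) = MW.ae-wit (MW.ae-and b (MW.ae-and q (MW.ae-and s (ε-AE zF))))
                  in proj₂ b₁ (subst (_∈ app F p) (trans s₁ q₁) t₁)

      opaque
        π-mem : ∀ {G F} → 𝒟 G → AEW (λ p → app G p ∈ app F p) → π G ∈ π F
        π-mem {G} {F} DG a = let (z , zF , e) = cut DG a in subst (_∈ π F) (π-cong z G e) (π-i zF)

      opaque
        π-mem⁻ : ∀ {G F} → 𝒟 G → π G ∈ π F → AEW (λ p → app G p ∈ app F p)
        π-mem⁻ {G} {F} DG h = let (z , zF , e) = π-e h in
          MW.ae-mono₂ (π-inj G DG z (ε-𝒟 zF) e) (ε-AE zF) λ p _ q k → subst (_∈ app F p) (sym q) k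

      M : Class
      M x = ∃[ F ] 𝒟 F × x ≡ π F

      opaque
        M-π : ∀ {F} → 𝒟 F → M (π F)
        M-π DF = _ , DF , refl

      opaque
        M-trans : ∀ x y → M x → y ∈ x → M y
        M-trans x y (F , DF , e) yx = let (z , zF , q) = π-e (subst (y ∈_) e yx) in z , ε-𝒟 zF , q

      private
        opaque
          def-at : ∀ {n} (φ : Formula n) (Fs : Vec V n) → Def₁ (λ p → Sat Univ φ (map (λ F → app F p) Fs))
          def-at φ Fs = def-Sat φ (λ ρ → map (λ F → app F (head ρ)) Fs) λ i →
            term-cong (λ ρ → sym (lookup-map i (λ F → app F (head ρ)) Fs)) auto

        opaque
          def-witness : ∀ {n} (φ : Formula (suc n)) → Def₂ (λ v y → ¬ Sat Univ φ (y ∷ untuple n v))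
          def-witness {n} φ = c-not (def-Sat φ (λ ρ → head (tail ρ) ∷ untuple n (head ρ)) λ
            { zero → term-v1 ; (suc i) → term-untuple n head term-v0 i })

      𝒟-tuple : ∀ {n} (Fs : Vec V n) → All 𝒟 Fs → 𝒟 (tuple Fs)
      𝒟-tuple []       []         = 𝒟-cst ∅
      𝒟-tuple (F ∷ Fs) (DF ∷ DFs) = 𝒟-pair DF (𝒟-tuple Fs DFs)

      łoś : ∀ {n} (φ : Formula n) (Fs : Vec V n) → All 𝒟 Fs →
            Sat M φ (map π Fs) ⇔ AEW (λ p → Sat Univ φ (map (λ F → app F p) Fs))
      łoś (i ≐ j) Fs DFs = mk⇔
        (λ h → MW.ae-mono (π-inj _ (all-at DFs i) _ (all-at DFs j) (subst₂ _≡_ (lookup-map i π Fs) (lookup-map j π Fs) h))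
                 λ p _ → subst₂ _≡_ (sym (lookup-map i _ Fs)) (sym (lookup-map j _ Fs)))
        (λ a → subst₂ _≡_ (sym (lookup-map i π Fs)) (sym (lookup-map j π Fs))
                 (π-cong _ _ (MW.ae-mono a λ p _ → subst₂ _≡_ (lookup-map i _ Fs) (lookup-map j _ Fs))))
      łoś (i ∈̇ j) Fs DFs = mk⇔
        (λ h → MW.ae-mono (π-mem⁻ (all-at DFs i) (subst₂ _∈_ (lookup-map i π Fs) (lookup-map j π Fs) h))
                 λ p _ → subst₂ _∈_ (sym (lookup-map i _ Fs)) (sym (lookup-map j _ Fs)))
        (λ a → subst₂ _∈_ (sym (lookup-map i π Fs)) (sym (lookup-map j π Fs))
                 (π-mem (all-at DFs i) (MW.ae-mono a λ p _ → subst₂ _∈_ (lookup-map i _ Fs) (lookup-map j _ Fs))))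
      łoś ⊥̇ Fs DFs = mk⇔ (λ h → ⊥-elim (lower h)) (λ a → lift (lower (proj₂ (proj₂ (MW.ae-wit a)))))
      łoś (φ ⇒̇ ψ) Fs DFs = mk⇔
        (λ h → [ (λ a → MW.ae-mono (to (łoś ψ Fs DFs) (h (from (łoś φ Fs DFs) a))) λ _ _ s _ → s)
               , (λ a → MW.ae-mono a λ _ _ n s → ⊥-elim (n s)) ]′ (MW.ae-em _ ⦃ def-at φ Fs ⦄))
        (λ a s → from (łoś ψ Fs DFs) (MW.ae-mono₂ a (to (łoś φ Fs DFs) s) λ _ _ f x → f x))
      łoś (∀̇ φ) Fs DFs = mk⇔
        (λ h → dne λ n →
          let T = tuple Fs
              fails = MW.ae-not _ ⦃ def-at (∀̇ φ) Fs ⦄ n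
              -- The counterexample is chosen from the tuple of values alone, which keeps `K` inside
              -- `𝒟` and makes `π K` an instance of the hypothesis.
              (K , DK , b) = skolem {T} (λ v y → ¬ Sat Univ φ (y ∷ untuple _ v)) ⦃ def-witness φ ⦄ (𝒟-tuple Fs DFs)
                (MW.ae-mono fails λ p pκ k → let (y , q) = ¬∀⇒∃¬ {A = V} (λ all → k λ x _ → all x) in
                  y , λ s → q (subst (λ σ → Sat Univ φ (y ∷ σ)) (untuple-tuple Fs pκ) s))
              sat = to (łoś φ (K ∷ Fs) (DK ∷ DFs)) (h (π K) (K , DK , refl))
          in lower (MW.ae-consistent sat (MW.ae-mono b λ p pκ k s →
               k (subst (λ σ → Sat Univ φ (app K p ∷ σ)) (sym (untuple-tuple Fs pκ)) s)) {⊥}))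
        (λ { a x (F , DF , refl) → from (łoś φ (F ∷ Fs) (DF ∷ DFs)) (MW.ae-mono a λ p _ s → s (app F p) tt) })

      represent : ∀ {n} (ρ : Vec V n) → All M ρ → ∃[ Fs ] All 𝒟 Fs × ρ ≡ map π Fs
      represent []      []                  = [] , [] , refl
      represent (x ∷ ρ) ((F , DF , e) ∷ Mρ) = let (Fs , DFs , e′) = represent ρ Mρ in F ∷ Fs , DF ∷ DFs , cong₂ _∷_ e e′

      opaque
        reflect : ∀ {n} {P : Class → Env n → Set ℓ} → Pure P → (Fs : Vec V n) → All 𝒟 Fs →
                  AEW (λ p → P Univ (map (λ F → app F p) Fs)) → P M (map π Fs)
        reflect p Fs DFs a = from (correct p M _) (from (łoś (formula p) Fs DFs)
          (MW.ae-mono a λ q _ h → to (correct p Univ _) h))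

      opaque
        transfer : ∀ {n} {P : Class → Env n → Set ℓ} → Pure P → (∀ ρ → P Univ ρ) → ∀ ρ → All M ρ → P M ρ
        transfer {P = P} p h ρ Mρ = let (Fs , DFs , e) = represent ρ Mρ in
          subst (P M) (sym e) (reflect p Fs DFs (MW.ae-full λ q _ → h _))

      ultrapower-ZF : Relative.ZF M
      ultrapower-ZF = record
        { extensionality = λ x y Mx My → transfer
            (p-imp (p-all (p-iff (p-mem i₀ i₁) (p-mem i₀ i₂))) (p-eq i₀ i₁))
            (λ { (x ∷ y ∷ []) → ZF.extensionality x y tt tt }) (x ∷ y ∷ []) (Mx ∷ My ∷ [])
        ; foundation = λ x Mx → transfer
            (p-imp (p-ex (p-mem i₀ i₁))
                   (p-ex (p-and (p-mem i₀ i₁) (p-not (p-ex (p-and (p-mem i₀ i₁) (p-mem i₀ i₂)))))))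
            (λ { (x ∷ []) → ZF.foundation x tt }) (x ∷ []) (Mx ∷ [])
        ; pairing = λ x y Mx My → transfer
            (p-ex (p-all (p-iff (p-mem i₀ i₁) (p-or (p-eq i₀ i₂) (p-eq i₀ i₃)))))
            (λ { (x ∷ y ∷ []) → ZF.pairing x y tt tt }) (x ∷ y ∷ []) (Mx ∷ My ∷ [])
        ; union = λ x Mx → transfer
            (p-ex (p-all (p-iff (p-mem i₀ i₁) (p-ex (p-and (p-mem i₀ i₃) (p-mem i₁ i₀))))))
            (λ { (x ∷ []) → ZF.union x tt }) (x ∷ []) (Mx ∷ [])
        ; powerset = λ x Mx → transfer
            (p-ex (p-all (p-iff (p-mem i₀ i₁) (p-all (p-imp (p-mem i₀ i₁) (p-mem i₀ i₃))))))
            (λ { (x ∷ []) → ZF.powerset x tt }) (x ∷ []) (Mx ∷ [])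
        ; infinity = transfer
            (p-ex (p-and (p-ex (p-and (p-not (p-ex (p-mem i₀ i₁))) (p-mem i₀ i₁)))
                         (p-all (p-imp (p-mem i₀ i₁)
                           (p-ex (p-and (p-all (p-iff (p-mem i₀ i₁) (p-or (p-mem i₀ i₂) (p-eq i₀ i₂))))
                                        (p-mem i₀ i₂)))))))
            (λ { [] → ZF.infinity }) [] []
        ; separation = λ φ ρ Mρ a Ma → transfer
            (p-ex (p-all (p-iff (p-mem i₀ i₁) (p-and (p-mem i₀ i₂) (sat-sep φ)))))
            (λ { (a ∷ ρ) → ZF.separation φ ρ (all-univ ρ) a tt }) (a ∷ ρ) (Ma ∷ Mρ)
        ; replacement = λ φ ρ Mρ a Ma fun → transfer
            (p-imp (p-all (p-all (p-all (p-imp (p-mem i₂ i₃)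
                     (p-imp (sat-rep₁ φ) (p-imp (sat-rep₂ φ) (p-eq i₁ i₀)))))))
                   (p-ex (p-all (p-iff (p-mem i₀ i₁) (p-ex (p-and (p-mem i₀ i₃) (sat-rep₃ φ)))))))
            (λ { (a ∷ ρ) fun → ZF.replacement φ ρ (all-univ ρ) a tt λ x y y′ _ _ _ → fun x tt y tt y′ tt })
            (a ∷ ρ) (Ma ∷ Mρ) (λ x Mx y My y′ My′ → fun x y y′ Mx My My′)
        }
        where
          module ZF = Relative.ZF (proj₁ zfc)

      opaque
        π-O : ∀ {F} → 𝒟 F → AEW (λ p → O (app F p)) → O (π F)
        π-O {F} DF a =
          let (t , h) = reflect p-RelO (F ∷ []) (DF ∷ []) (MW.ae-mono a λ p _ (t , h) →
                          (λ y _ yx z _ zy → t y yx z zy) , λ y _ yx z _ zy w _ wz → h y yx z zy w wz)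
              M₁ : ∀ {y} → y ∈ π F → M y
              M₁ = M-trans _ _ (M-π DF)
          in (λ y yx z zy → t y (M₁ yx) yx z (M-trans _ _ (M₁ yx) zy) zy) ,
             λ y yx z zy w wz → let Mz = M-trans _ _ (M₁ yx) zy in
               h y (M₁ yx) yx z Mz zy w (M-trans _ _ Mz wz) wz

      j : V → V
      j x = π (cst x)

      opaque
        j-∈ : ∀ {x y} → x ∈ y → j x ∈ j y
        j-∈ {x} {y} h = π-mem (𝒟-cst x) (MW.ae-full λ p pκ → subst₂ _∈_ (sym (cst-app pκ)) (sym (cst-app pκ)) h)

      opaque
        j-O : ∀ {α} → O α → O (j α)
        j-O oα = π-O (𝒟-cst _) (MW.ae-full λ p pκ → subst O (sym (cst-app pκ)) oα)

      opaque
        ⊆-j : ∀ α → O α → α ⊆ j α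
        ⊆-j = ∈-induction (λ α → O α → α ⊆ j α) λ α ih oα β βα →
          let oβ = O-elem oα βα in case O-⊆ oβ (j-O oβ) (ih β βα oβ) of λ
            { (inj₁ k) → proj₁ (j-O oα) (j β) (j-∈ βα) β k
            ; (inj₂ e) → subst (_∈ j α) (sym e) (j-∈ βα) }

      opaque
        M-ordinals : ∀ α → R.Ordinal α → M α
        M-ordinals α h = let oα = Ordinal⇒ h in case O-⊆ oα (j-O oα) (⊆-j α oα) of λ
          { (inj₁ k) → M-trans _ _ (M-π (𝒟-cst α)) k
          ; (inj₂ e) → subst M (sym e) (M-π (𝒟-cst α)) }

      opaque
        -- By completeness a function with values in ξ < κ is constant almost everywhere, so the
        -- members of `j ξ` are the `j ζ` with ζ in ξ.
        j-fixes : ∀ ξ → ξ ∈ κ → j ξ ≡ ξ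
        j-fixes = ∈-induction (λ ξ → ξ ∈ κ → j ξ ≡ ξ) λ ξ ih ξκ → ext
          (λ u h → let (z , zF , e) = π-e h
                       (ζ , ζξ , a) = MW.ae-const (small-∈κ ξκ)
                         (MW.ae-mono (ε-AE zF) λ p pκ → subst (app z p ∈_) (cst-app pκ))
                       q : π z ≡ j ζ
                       q = π-cong z (cst ζ) (MW.ae-mono a λ p pκ r → trans r (sym (cst-app pκ)))
                   in subst (_∈ ξ) (sym (trans e (trans q (ih ζ ζξ (proj₁ oκ ξ ξκ ζ ζξ))))) ζξ)
          (λ ζ ζξ → subst (_∈ j ξ) (ih ζ ζξ (proj₁ oκ ξ ξκ ζ ζξ)) (j-∈ ζξ))

      opaque
        M-definable : Definable M
        M-definable = definable auto

      opaque
        M-inner : InnerModel M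
        M-inner = record { definable = M-definable ; transitive = M-trans ; ordinals = M-ordinals ; zf = ultrapower-ZF }

      private
        opaque
          map-cst : ∀ {n p} (ρ : Vec V n) → p ∈ κ → map (λ F → app F p) (map cst ρ) ≡ ρ
          map-cst []      pκ = refl
          map-cst (x ∷ ρ) pκ = cong₂ _∷_ (cst-app pκ) (map-cst ρ pκ)

        all-cst : ∀ {n} (ρ : Vec V n) → All 𝒟 (map cst ρ)
        all-cst []      = []
        all-cst (x ∷ ρ) = 𝒟-cst x ∷ all-cst ρ

        opaque
          elementary : ∀ {n} (φ : Formula n) (ρ : Vec V n) → Sat Univ φ ρ ⇔ Sat M φ (map j ρ)
          elementary φ ρ = mk⇔
            (λ s → subst (Sat M φ) (sym (map-∘ π cst ρ)) (from (łoś φ (map cst ρ) (all-cst ρ))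
                     (MW.ae-full λ p pκ → subst (Sat Univ φ) (sym (map-cst ρ pκ)) s)))
            (λ s → let (p , pκ , h) = MW.ae-wit (to (łoś φ (map cst ρ) (all-cst ρ)) (subst (Sat M φ) (map-∘ π cst ρ) s))
                   in subst (Sat Univ φ) (map-cst ρ pκ) h)

      opaque
        j-embedding : ElementaryEmbedding Univ M j
        j-embedding = record
          { definable  = definable-on {Q = λ x y → π (cst x) ≡ y} auto (λ x y _ → mk⇔ id id)
          ; maps       = λ x _ → M-π (𝒟-cst x)
          ; elementary = λ φ ρ _ → elementary φ ρ
          }

      opaque
        π-pr : ∀ {F G H} → 𝒟 F → 𝒟 G → AEW (λ p → app H p ≡ pr (app F p) (app G p)) → π H ≡ pr (π F) (π G)
        π-pr {F} {G} {H} DF DG a = ext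
          (λ u h → let (z , zH , e) = π-e h in subst (_∈ pr (π F) (π G)) (sym e)
             (case MW.ae-em (λ p → app z p ≡ app F p) of λ
               { (inj₁ b) → subst (_∈ pr (π F) (π G)) (sym (π-cong z F b)) pr-i₁
               ; (inj₂ b) → subst (_∈ pr (π F) (π G)) (sym (π-cong z G (MW.ae-mono₂ b (MW.ae-and (ε-AE zH) a)
                   λ p _ n (k , q) → [ (λ r → ⊥-elim (n r)) , (λ r → r) ]′ (pr-e (subst (app z p ∈_) q k))))) pr-i₂ }))
          (λ u h → case pr-e h of λ
             { (inj₁ e) → subst (_∈ π H) (sym e) (π-mem DF (MW.ae-mono a λ p _ q → subst (app F p ∈_) (sym q) pr-i₁))
             ; (inj₂ e) → subst (_∈ π H) (sym e) (π-mem DG (MW.ae-mono a λ p _ q → subst (app G p ∈_) (sym q) pr-i₂)) })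

      opaque
        π-pair : ∀ {F G} → 𝒟 F → 𝒟 G → π (F ⟨,⟩ G) ≡ pair (π F) (π G)
        π-pair {F} {G} DF DG =
          let (A , DA , a) = skolem (λ v y → y ≡ sg (fst v)) (𝒟-pair DF DG) (MW.ae-full λ p _ → _ , refl)
              (B , DB , b) = skolem (λ v y → y ≡ pr (fst v) (snd v)) (𝒟-pair DF DG) (MW.ae-full λ p _ → _ , refl)
              a′ : AEW (λ p → app A p ≡ pr (app F p) (app F p))
              a′ = MW.ae-mono a λ p pκ e → trans e (cong sg (fst-≡ (⟨,⟩-app pκ)))
              b′ : AEW (λ p → app B p ≡ pr (app F p) (app G p))
              b′ = MW.ae-mono b λ p pκ e → trans e (cong₂ pr (fst-≡ (⟨,⟩-app pκ)) (snd-≡ (⟨,⟩-app pκ)))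
          in trans (π-pr {A} {B} DA DB (MW.ae-mono₂ a′ b′ λ p pκ e q →
                      trans (⟨,⟩-app pκ) (trans (pair-def _ _) (sym (cong₂ pr e q)))))
                   (trans (cong₂ pr (π-pr DF DF a′) (π-pr DF DG b′)) (sym (pair-def _ _)))

      -- D represents κ, so that p ↦ ⟨Φ(ν)(p) : ν ∈ D(p)⟩ represents the sequence of
      -- the sets represented by the Φ(ν), ν < κ.
      opaque
        κ-closed : ∀ {D} → 𝒟 D → π D ≡ κ →
                   (∀ Φ → (∀ ν → ν ∈ κ → 𝒟 (app Φ ν)) → 𝒟 (sequence D Φ)) → ClosedUnder κ M
        κ-closed {D} DD πD 𝒟-seq f fo Mf =
          let (Φ , hΦ) = choose κ (λ ν F → 𝒟 F × app f ν ≡ π F) (λ ν νκ → Mf ν _ (App⇐ (fun-pair fo νκ)))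
              value : ∀ {ν} → ν ∈ κ → π (cst ν ⟨,⟩ app Φ ν) ≡ pair ν (app f ν)
              value {ν} νκ = trans (π-pair (𝒟-cst ν) (proj₁ (hΦ ν νκ)))
                                   (cong₂ pair (j-fixes ν νκ) (sym (proj₂ (hΦ ν νκ))))
          in subst M (ext
            (λ u h →
              let (z , zS , e) = π-e h
                  (ν , νκ , a) = term-of Φ (ε-𝒟 zS) (ε-AE zS)
              in subst (_∈ f) (sym (trans e (trans (π-cong z (cst ν ⟨,⟩ app Φ ν) (MW.ae-mono a λ p pκ q →
                   trans q (sym (trans (⟨,⟩-app pκ) (cong (λ x → pair x (app (app Φ ν) p)) (cst-app pκ))))))
                   (value νκ)))) (fun-pair fo νκ))
            (λ u uf →
              let (ν , y , _ , _ , νκ , ip) = proj₁ fo u tt uf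
                  e : u ≡ pair ν (app f ν)
                  e = trans (IsPair⇒ ip) (cong (pair ν) (sym (fun-app fo νκ (subst (_∈ f) (IsPair⇒ ip) uf))))
              in subst (_∈ π (sequence D Φ)) (sym (trans e (sym (value νκ))))
                   (π-mem (𝒟-pair (𝒟-cst ν) (proj₁ (hΦ ν νκ))) (MW.ae-mono (below ν νκ) λ p pκ k →
                     subst₂ _∈_ (sym (trans (⟨,⟩-app pκ) (cong (λ x → pair x (app (app Φ ν) p)) (cst-app pκ))))
                                (sym (sequence-app pκ)) (lam-i k)))))
            (M-π (𝒟-seq Φ (λ ν νκ → proj₁ (hΦ ν νκ))))
          where
            below : ∀ ν → ν ∈ κ → AEW (λ p → ν ∈ app D p)
            below ν νκ = MW.ae-mono (π-mem⁻ (𝒟-cst ν) (subst₂ _∈_ (sym (j-fixes ν νκ)) (sym πD) νκ))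
                           λ p pκ → subst (_∈ app D p) (cst-app pκ)
            -- The ordinal `π K` is below κ, so it equals its own image under `j`, which a constant
            -- function represents.
            index : ∀ K → AEW (λ p → app K p ∈ app D p) → 𝒟 K → ∃[ ν ] ν ∈ κ × AEW (λ p → app K p ≡ ν)
            index K a DK = let πK = subst (π K ∈_) πD (π-mem DK a) in
              π K , πK , MW.ae-mono (π-inj K DK (cst (π K)) (𝒟-cst _) (sym (j-fixes _ πK))) λ p pκ e → trans e (cst-app pκ)
            term-of : ∀ Φ {z} → 𝒟 z → AEW (λ p → app z p ∈ app (sequence D Φ) p) →
                      ∃[ ν ] ν ∈ κ × AEW (λ p → app z p ≡ pair ν (app (app Φ ν) p))
            term-of Φ {z} Dz a =
              let a′ = MW.ae-mono a λ p pκ h → lam-e (subst (app z p ∈_) (sequence-app pκ) h)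
                  (K , DK , b) = skolem (λ v y → ∃[ x ] v ≡ pair y x) Dz (MW.ae-mono a′ λ p _ (ν , _ , e) → ν , _ , e)
                  hK : AEW (λ p → app K p ∈ app D p × app z p ≡ pair (app K p) (app (app Φ (app K p)) p))
                  hK = MW.ae-mono₂ a′ b λ p _ (ν , νD , e) (x , q) →
                    subst (λ ν → ν ∈ app D p × app z p ≡ pair ν (app (app Φ ν) p)) (proj₁ (pair-inj (trans (sym e) q))) (νD , e)
                  (ν , νκ , c) = index K (MW.ae-mono hK λ p _ → proj₁) DK
              in ν , νκ , MW.ae-mono₂ hK c λ p _ (_ , h) r → subst (λ ν → app z p ≡ pair ν (app (app Φ ν) p)) r h

    -- Functions and cardinality as relativised formulas

    private
      p-all₂ : ∀ {n} {P : Class → Env (2 +ℕ n) → Set ℓ} → Pure P →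
               Pure (λ C ρ → ∀ x y → C x → C y → P C (y ∷ x ∷ ρ))
      p-all₂ p = p-equiv (λ C ρ h x y Cx Cy → h x Cx y Cy) (λ C ρ h x Cx y Cy → h x y Cx Cy) (p-all (p-all p))

      p-all₃ : ∀ {n} {P : Class → Env (3 +ℕ n) → Set ℓ} → Pure P →
               Pure (λ C ρ → ∀ x y z → C x → C y → C z → P C (z ∷ y ∷ x ∷ ρ))
      p-all₃ p = p-equiv (λ C ρ h x y z Cx Cy Cz → h x Cx y Cy z Cz) (λ C ρ h x Cx y Cy z Cz → h x y z Cx Cy Cz)
                         (p-all (p-all (p-all p)))

      p-ex₂ : ∀ {n} {P : Class → Env (2 +ℕ n) → Set ℓ} → Pure P →
              Pure (λ C ρ → ∃[ x ] ∃[ y ] C x × C y × P C (y ∷ x ∷ ρ))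
      p-ex₂ p = p-equiv (λ C ρ (x , Cx , y , Cy , h) → x , y , Cx , Cy , h)
                        (λ C ρ (x , y , Cx , Cy , h) → x , Cx , y , Cy , h) (p-ex (p-ex p))

    opaque
      p-IsUpair : ∀ {n} (z x y : Fin n) → Pure (λ C ρ → Relative.IsUpair C (lookup ρ z) (lookup ρ x) (lookup ρ y))
      p-IsUpair z x y = p-all (p-iff (p-mem i₀ (suc z)) (p-or (p-eq i₀ (suc x)) (p-eq i₀ (suc y))))

    opaque
      p-IsPair : ∀ {n} (p x y : Fin n) → Pure (λ C ρ → Relative.IsPair C (lookup ρ p) (lookup ρ x) (lookup ρ y))
      p-IsPair p x y = p-all (p-iff (p-mem i₀ (suc p))
        (p-or (p-IsUpair i₀ (suc x) (suc x)) (p-IsUpair i₀ (suc x) (suc y))))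

    opaque
      p-App : ∀ {n} (f x y : Fin n) → Pure (λ C ρ → Relative.App C (lookup ρ f) (lookup ρ x) (lookup ρ y))
      p-App f x y = p-ex (p-and (p-IsPair i₀ (suc x) (suc y)) (p-mem i₀ (suc f)))

    opaque
      p-FunctionOn : ∀ {n} (f a : Fin n) → Pure (λ C ρ → Relative.FunctionOn C (lookup ρ f) (lookup ρ a))
      p-FunctionOn f a = p-and
        (p-all (p-imp (p-mem i₀ (suc f))
          (p-ex₂ (p-and (p-mem i₁ (suc (suc (suc a)))) (p-IsPair i₂ i₁ i₀)))))
        (p-all (p-imp (p-mem i₀ (suc a))
          (p-ex (p-and (p-App (suc (suc f)) i₁ i₀)
            (p-all (p-imp (p-App (suc (suc (suc f))) i₂ i₀) (p-eq i₀ i₁)))))))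

    opaque
      p-Function : ∀ {n} (f a b : Fin n) → Pure (λ C ρ → Relative.Function C (lookup ρ f) (lookup ρ a) (lookup ρ b))
      p-Function f a b = p-and (p-FunctionOn f a)
        (p-all₂ (p-imp (p-App (suc (suc f)) i₁ i₀) (p-mem i₀ (suc (suc b)))))

    opaque
      p-Bijection : ∀ {n} (f a b : Fin n) → Pure (λ C ρ → Relative.Bijection C (lookup ρ f) (lookup ρ a) (lookup ρ b))
      p-Bijection f a b = p-and
        (p-and (p-Function f a b)
          (p-all₃ (p-imp (p-App (suc (suc (suc f))) i₂ i₀) (p-imp (p-App (suc (suc (suc f))) i₁ i₀) (p-eq i₂ i₁)))))
        (p-all (p-imp (p-mem i₀ (suc b)) (p-ex (p-and (p-mem i₀ (suc (suc a))) (p-App (suc (suc f)) i₀ i₁)))))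

    opaque
      p-Equinumerous : ∀ {n} (a b : Fin n) → Pure (λ C ρ → Relative.Equinumerous C (lookup ρ a) (lookup ρ b))
      p-Equinumerous a b = p-ex (p-Bijection i₀ (suc a) (suc b))

    opaque
      p-WellOrderedBy∈ : ∀ {n} (x : Fin n) → Pure (λ C ρ → Relative.WellOrderedBy∈ C (lookup ρ x))
      p-WellOrderedBy∈ x = p-equiv
        (λ C ρ (a , b , c , d) → record { irrefl = a ; trans = b ; trichotomy = c ; least = d })
        (λ C ρ w → let module W = Relative.WellOrderedBy∈ w in W.irrefl , W.trans , W.trichotomy , W.least)
        (p-and (p-all (p-imp (p-mem i₀ (suc x)) (p-not (p-mem i₀ i₀))))
        (p-and (p-all₃ (p-imp (p-mem i₂ (suc (suc (suc x)))) (p-imp (p-mem i₁ (suc (suc (suc x))))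
                 (p-imp (p-mem i₀ (suc (suc (suc x)))) (p-imp (p-mem i₂ i₁) (p-imp (p-mem i₁ i₀) (p-mem i₂ i₀)))))))
        (p-and (p-all₂ (p-imp (p-mem i₁ (suc (suc x))) (p-imp (p-mem i₀ (suc (suc x)))
                 (p-or (p-mem i₁ i₀) (p-or (p-eq i₁ i₀) (p-mem i₀ i₁))))))
               (p-all (p-imp (p-all (p-imp (p-mem i₀ i₁) (p-mem i₀ (suc (suc x)))))
                 (p-imp (p-ex (p-mem i₀ i₁))
                   (p-ex (p-and (p-mem i₀ i₁) (p-all (p-imp (p-mem i₀ i₂) (p-or (p-eq i₀ i₁) (p-mem i₁ i₀))))))))))))

    opaque
      p-Cardinal : ∀ {n} (x : Fin n) → Pure (λ C ρ → Relative.Cardinal C (lookup ρ x))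
      p-Cardinal x = p-and
        (p-and (p-all (p-imp (p-mem i₀ (suc x)) (p-all (p-imp (p-mem i₀ i₁) (p-mem i₀ (suc (suc x)))))))
               (p-WellOrderedBy∈ x))
        (p-all (p-imp (p-mem i₀ (suc x)) (p-not (p-Equinumerous i₀ (suc x)))))

    opaque
      p-CardLess : ∀ {n} (a x : Fin n) → Pure (λ C ρ → Relative.CardLess C (lookup ρ a) (lookup ρ x))
      p-CardLess a x = p-ex (p-and (p-Cardinal i₀) (p-and (p-Equinumerous (suc a) i₀) (p-mem i₀ (suc x))))

    -- Thin functions

    opaque
      instance
        term-prod : ∀ {n} {s t : Env n → V} → ⦃ Term s ⦄ → ⦃ Term t ⦄ → Term (λ ρ → prod (s ρ) (t ρ))
        term-prod ⦃ c ⦄ ⦃ d ⦄ = term-sub₂ {h = prod} term-prod₂ c d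

    -- In the ultrapower by U, thin functions represent the sets of the form j[Y].
    Thin : V → Set ℓ
    Thin G = ∀ h → AE (λ q → app h q ∈ app G q) → ∃[ y ] AE (λ q → app h q ≡ y)

    opaque
      -- A choice of counterexamples in G(q) would be a selector of `G`, hence equal to a fixed `y`
      -- almost everywhere, where the hypothesis for `y` refutes it.
      thin-all : ∀ {G} → Thin G → (P : V → V → Set ℓ) ⦃ d : Def₂ P ⦄ →
                 (∀ y → AE (λ q → y ∈ app G q → P y q)) → AE (λ q → ∀ y → y ∈ app G q → P y q)
      thin-all {G} thin P ⦃ d ⦄ h = dne λ n →
        let (k , hk) = ae-choose (λ q y → y ∈ app G q × ¬ P y q) ⦃ bad ⦄
              (ae-mono (ae-not _ ⦃ all ⦄ n) λ q _ m →
                let (y , r) = ¬∀⇒∃¬ {A = V} m in y , dne (λ e → r λ yG → ⊥-elim (e yG)) , λ p → r λ _ → p)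
            (y , a) = thin k (ae-mono hk λ q _ → proj₁)
            (q , _ , (yG , np) , e , i) = ae-wit (ae-and hk (ae-and a (h y)))
        in np (subst (λ y → P y q) (sym e) (i (subst (_∈ app G q) e yG)))
        where
          all : Def₁ (λ q → ∀ y → y ∈ app G q → P y q)
          all = c-all {P = λ ρ y → y ∈ app G (head ρ) → P y (head ρ)} (c-imp auto (def-sub₂ {P = P} d auto auto))
          bad : Def₂ (λ q y → y ∈ app G q × ¬ P y q)
          bad = c-and auto (c-not (def-sub₂ {P = P} d auto auto))

    -- The models M and N

    Hull : V → Set ℓ
    Hull F = ∃[ G ] Thin G × MW.AE (λ p → app F p ∈ app G (base p))

    opaque
      def-Hull : Def₁ Hull
      def-Hull = auto

    opaque
      hull-≈ : ∀ {F F′} → Hull F → MW.AE (λ p → app F p ≡ app F′ p) → Hull F′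
      hull-≈ (G , thin , a) b = G , thin , MW.ae-mono₂ a b λ p _ h e → subst (_∈ _) e h

    opaque
      hull-pair : ∀ {F F′} → Hull F → Hull F′ → Hull (F ⟨,⟩ F′)
      hull-pair {F} {F′} (G , thin , a) (G′ , thin′ , a′) = G× , thin× ,
        MW.ae-mono₂ W-base-κ (MW.ae-and a a′) λ p pκ bκ (h , h′) →
          subst₂ _∈_ (sym (⟨,⟩-app pκ)) (sym (app-lam bκ)) (prod-i h h′)
        where
          G× : V
          G× = lam κ (λ q → prod (app G q) (app G′ q))
          thin× : Thin G×
          thin× h b =
            let parts : AE (λ q → app h q ∈ prod (app G q) (app G′ q))
                parts = ae-mono b λ q qκ → subst (app h q ∈_) (app-lam qκ)
                (x , c) = thin (lam κ (λ q → fst (app h q))) (ae-mono parts λ q qκ k →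
                  let (u , v , uG , vG , e) = prod-e k in
                  subst (_∈ app G q) (sym (trans (app-lam qκ) (fst-≡ e))) uG)
                (y , c′) = thin′ (lam κ (λ q → snd (app h q))) (ae-mono parts λ q qκ k →
                  let (u , v , uG , vG , e) = prod-e k in
                  subst (_∈ app G′ q) (sym (trans (app-lam qκ) (snd-≡ e))) vG)
            in pair x y , ae-mono₂ parts (ae-and c c′) λ q qκ k (r , r′) →
                 let (u , v , _ , _ , e) = prod-e k in
                 trans e (cong₂ pair (trans (sym (trans (app-lam qκ) (fst-≡ e))) r)
                                     (trans (sym (trans (app-lam qκ) (snd-≡ e))) r′))

    private
      image : V → V → V
      image h G = lam κ (λ q → img (app G q) (λ v → app h v))

      opaque
        image-thin : ∀ {h G} → Thin G → Thin (image h G)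
        image-thin {h} {G} thin k b =
          let (v , hv) = ae-choose (λ q v → v ∈ app G q × app k q ≡ app h v)
                (ae-mono b λ q qκ m → img-e (subst (app k q ∈_) (app-lam qκ) m))
              (y , c) = thin v (ae-mono hv λ q _ → proj₁)
          in app h y , ae-mono₂ hv c λ q _ (_ , e) r → trans e (cong (app h) r)

    opaque
      hull-comp : ∀ {h F} → Hull F → Hull (h ⊚ F)
      hull-comp {h} {F} (G , thin , a) = image h G , image-thin thin ,
        MW.ae-mono₂ W-base-κ a λ p pκ bκ k → subst₂ _∈_ (sym (⊚-app pκ)) (sym (app-lam bκ)) (img-i k)

    opaque
      hull-cst : ∀ x → Hull (cst x)
      hull-cst x = cst (sg x) ,
        (λ h a → x , ae-mono a λ q qκ k → sg-e (subst (app h q ∈_) (cst-app qκ) k)) ,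
        MW.ae-mono W-base-κ λ p pκ bκ → subst₂ _∈_ (sym (cst-app pκ)) (sym (cst-app bκ)) sg-i

    opaque
      -- The minimality of `g` modulo `U` says precisely that `g` is thin.
      hull-below : ∀ {F} → MW.AE (λ p → app F p ∈ app g (base p)) → Hull F
      hull-below a = g , g-normal , a

    private
      opaque
        def-Univ : Def₁ Univ
        def-Univ = auto

      opaque
        univ-class : FunctionClass Univ
        univ-class = record { def-𝒟 = def-Univ ; 𝒟-≈ = λ _ _ → tt ; 𝒟-pair = λ _ _ → tt
                            ; 𝒟-comp = λ _ → tt ; 𝒟-cst = λ _ → tt }

        hull-class : FunctionClass Hull
        hull-class = record { def-𝒟 = def-Hull ; 𝒟-≈ = hull-≈ ; 𝒟-pair = hull-pair
                            ; 𝒟-comp = hull-comp ; 𝒟-cst = hull-cst }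

    module UM = Ultrapower Univ univ-class
    module UN = Ultrapower Hull hull-class
    open UM using () renaming (term-π to term-πM)
    open UN using () renaming (term-π to term-πN)

    -- The two collapses below η

    opaque
      base-O : ∀ {p} → base p ∈ κ → O (app g (base p))
      base-O h = O-elem oκ (g-κ h)

    opaque
      -- All functions below p ↦ g(q) belong to the hull, so both collapses find the same members,
      -- hereditarily.
      πN≡πM : ∀ F → MW.AE (λ p → app F p ∈ app g (base p)) → UN.π F ≡ UM.π F
      πN≡πM = UM.ε-induction (λ F → MW.AE (λ p → app F p ∈ app g (base p)) → UN.π F ≡ UM.π F) λ F ih a →
        let inner : ∀ {z} → MW.AE (λ p → app z p ∈ app F p) → MW.AE (λ p → app z p ∈ app g (base p))
            inner {z} b = MW.ae-mono₂ W-base-κ (MW.ae-and a b) λ p _ bκ (h , k) → proj₁ (base-O bκ) _ h _ k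
        in ext (λ u h → let (z , (Hz , sub , b) , e) = UN.π-e h in
                 subst (_∈ UM.π F) (sym (trans e (ih z (tt , sub , b) (inner b)))) (UM.π-i (tt , sub , b)))
               (λ u h → let (z , (_ , sub , b) , e) = UM.π-e h in
                 subst (_∈ UN.π F) (trans (ih z (tt , sub , b) (inner b)) (sym e))
                       (UN.π-i (hull-below (inner b) , sub , b)))

    opaque
      η : V
      η = lam κ (λ p → app g (base p))

      η-app : ∀ {p} → p ∈ κ → app η p ≡ app g (base p)
      η-app = app-lam

    opaque
      -- A fixed `y` in κ lies in g(q) almost everywhere because `g` is unbounded; `thin-all` makes
      -- this uniform over the elements of G(q).
      iκ-N : ∀ {z} → Hull z → MW.AE (λ p → app z p ∈ κ) → MW.AE (λ p → app z p ∈ app g (base p))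
      iκ-N {z} (G , thin , a) b = MW.ae-mono₂
        (W-base (λ q → ∀ y → y ∈ app G q → y ∈ κ → y ∈ app g q)
          (thin-all thin (λ y q → y ∈ κ → y ∈ app g q) λ y →
            by-cases (y ∈ κ) (λ yκ → ae-mono (g-unbounded yκ) λ q _ h _ _ → h)
                             (λ n → ae-full λ q _ _ k → ⊥-elim (n k))))
        (MW.ae-and a b) λ p _ all (h , k) → all (app z p) h k

    opaque
      iκ≡η : UN.j κ ≡ UM.π η
      iκ≡η = ext
        (λ u h → let (z , (Hz , _ , b) , e) = UN.π-e h
                     c = iκ-N Hz (MW.ae-mono b λ p pκ → subst (app z p ∈_) (cst-app pκ))
                 in subst (_∈ UM.π η) (sym (trans e (πN≡πM z c)))
                      (UM.π-mem tt (MW.ae-mono c λ p pκ → subst (app z p ∈_) (sym (η-app pκ)))))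
        (λ u h → let (z , (_ , _ , b) , e) = UM.π-e h
                     c : MW.AE (λ p → app z p ∈ app g (base p))
                     c = MW.ae-mono b λ p pκ → subst (app z p ∈_) (η-app pκ)
                 in subst (_∈ UN.j κ) (trans (πN≡πM z c) (sym e))
                      (UN.π-mem (hull-below c) (MW.ae-mono₂ W-base-κ c λ p pκ bκ k →
                        subst (app z p ∈_) (sym (cst-app pκ)) (proj₁ oκ _ (g-κ bκ) _ k))))

    -- A representative of κ, and closure under κ-sequences

    private
      dltF : V
      dltF = lam κ (λ p → dlt p)

      opaque
        dltF-below : MW.AE (λ p → app dltF p ∈ app g (base p))
        dltF-below = MW.ae-mono W-dlt λ p pκ → subst (_∈ app g (base p)) (sym (app-lam pκ))

      opaque
        κ⊆dltF : κ ⊆ UM.π dltF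
        κ⊆dltF ξ ξκ = subst (_∈ UM.π dltF) (UM.j-fixes ξ ξκ) (UM.π-mem tt (MW.ae-mono (W-unbounded ξκ)
          λ p pκ → subst₂ _∈_ (sym (cst-app pκ)) (sym (app-lam pκ))))

      opaque
        dltF-O : O (UM.π dltF)
        dltF-O = UM.π-O tt (MW.ae-mono₂ W-base-κ dltF-below λ p _ bκ h → O-elem (base-O bκ) h)

    opaque
      -- Each ξ < κ is below `dlt` almost everywhere, so `dlt` represents an ordinal that is at
      -- least κ and below η. Either this is κ, or κ is one of its members and so has a
      -- representative below `dlt`.
      κ-representative : ∃[ D ] MW.AE (λ p → app D p ∈ app g (base p)) × UM.π D ≡ κ
      κ-representative = case O-⊆ oκ dltF-O κ⊆dltF of λ
        { (inj₂ e) → dltF , dltF-below , sym e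
        ; (inj₁ k) → let (z , (_ , _ , b) , e) = UM.π-e k in
            z , MW.ae-mono₂ W-base-κ (MW.ae-and dltF-below b)
                  (λ p _ bκ (h , l) → proj₁ (base-O bκ) _ h _ l) , sym e }

    opaque
      D : V
      D = proj₁ κ-representative

      D-below : MW.AE (λ p → app D p ∈ app g (base p))
      D-below = proj₁ (proj₂ κ-representative)

      πD : UM.π D ≡ κ
      πD = proj₂ (proj₂ κ-representative)

    opaque
      D-index : ∀ {K} → MW.AE (λ p → app K p ∈ app D p) → ∃[ ν ] ν ∈ κ × MW.AE (λ p → app K p ≡ ν)
      D-index {K} a = let πK = subst (UM.π K ∈_) πD (UM.π-mem tt a) in
        UM.π K , πK , MW.ae-mono (UM.π-inj K tt (cst (UM.π K)) tt (sym (UM.j-fixes _ πK))) λ p pκ e → trans e (cst-app pκ)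

    opaque
      -- The argument of `thin-all` with `W` in place of `U`: a choice of counterexamples in D(p) is
      -- constant almost everywhere, since `D` represents κ.
      D-all : (P : V → V → Set ℓ) ⦃ d : Def₂ P ⦄ → (∀ ν → ν ∈ κ → MW.AE (λ p → P ν p)) →
              MW.AE (λ p → ∀ ν → ν ∈ app D p → P ν p)
      D-all P ⦃ d ⦄ h = dne λ n →
        let (K , hK) = MW.ae-choose (λ p ν → ν ∈ app D p × ¬ P ν p) ⦃ bad ⦄
              (MW.ae-mono (MW.ae-not _ ⦃ all ⦄ n) λ p _ m →
                let (ν , r) = ¬∀⇒∃¬ {A = V} m in ν , dne (λ e → r λ k → ⊥-elim (e k)) , λ x → r λ _ → x)
            (ν , νκ , a) = D-index (MW.ae-mono hK λ p _ → proj₁)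
            (p , _ , (_ , np) , e , x) = MW.ae-wit (MW.ae-and hK (MW.ae-and a (h ν νκ)))
        in np (subst (λ ν → P ν p) (sym e) x)
        where
          all : Def₁ (λ p → ∀ ν → ν ∈ app D p → P ν p)
          all = c-all {P = λ ρ ν → ν ∈ app D (head ρ) → P ν (head ρ)} (c-imp auto (def-sub₂ {P = P} d auto auto))
          bad : Def₂ (λ p ν → ν ∈ app D p × ¬ P ν p)
          bad = c-and auto (c-not (def-sub₂ {P = P} d auto auto))

    private
      -- The functions t with domain d ∈ b and t(ν) ∈ Γ(ν)(q).
      IsSeq : V → V → V → V → V → Set ℓ
      IsSeq Γ q b t d = d ∈ b × (∀ u → u ∈ t → ∃[ ν ] ν ∈ d × u ≡ pair ν (app t ν)) ×
                        (∀ ν → ν ∈ d → pair ν (app t ν) ∈ t × app t ν ∈ app (app Γ ν) q)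

      seqs-range : V → V → V → V
      seqs-range Γ q b = ⋃ (img b (λ ν → app (app Γ ν) q))

      seqs-at : V → V → V → V
      seqs-at Γ q b = sep (𝒫 (prod b (seqs-range Γ q b))) (λ t → ∃[ d ] IsSeq Γ q b t d)

      opaque
        seqs : V → V
        seqs Γ = lam κ (λ q → seqs-at Γ q (app g q))

        seqs-e : ∀ {Γ q t} → q ∈ κ → t ∈ app (seqs Γ) q → ∃[ d ] IsSeq Γ q (app g q) t d
        seqs-e {t = t} qκ h = proj₂ (sep-e (subst (t ∈_) (app-lam qκ) h))

        seqs-i : ∀ {Γ q t d} → q ∈ κ → IsSeq Γ q (app g q) t d → t ∈ app (seqs Γ) q
        seqs-i {Γ} {q} {t} {d} qκ (dg , h , k) = subst (t ∈_) (sym (app-lam qκ))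
          (sep-i (𝒫-i λ u ut → let (ν , νd , e) = h u ut ; νg = proj₁ (O-elem oκ (g-κ qκ)) d dg ν νd in
                    subst (_∈ prod (app g q) (seqs-range Γ q (app g q))) (sym e)
                      (prod-i νg (⋃-i (img-i νg) (proj₂ (k ν νd)))))
                 (d , dg , h , k))

      opaque
        seqs-domain : ∀ {Γ h} → AE (λ q → app h q ∈ app (seqs Γ) q) →
                      ∃[ d ] d ∈ κ × AE (λ q → IsSeq Γ q (app g q) (app h q) d)
        seqs-domain {Γ} {h} a =
          let (dd , hd) = pick h (ae-mono a λ q qκ → seqs-e qκ)
              (d , c) = g-normal dd (ae-mono hd λ q _ → proj₁)
              s = ae-mono₂ hd c λ q qκ s e → subst (IsSeq Γ q (app g q) (app h q)) e s
              (_ , q₀κ , d₀ , _) = ae-wit s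
          in d , proj₁ oκ _ (g-κ q₀κ) d d₀ , s
          where
            pick : ∀ h → AE (λ q → ∃[ d ] IsSeq Γ q (app g q) (app h q) d) →
                   ∃[ dd ] AE (λ q → IsSeq Γ q (app g q) (app h q) (app dd q))
            pick h = ae-choose (λ q d → IsSeq Γ q (app g q) (app h q) d)

      slice : V → V → V
      slice h ν = lam κ (λ q → app (app h q) ν)

      opaque
        slice-const : ∀ {Γ h d ν} → Thin (app Γ ν) → ν ∈ d → AE (λ q → IsSeq Γ q (app g q) (app h q) d) →
                      ∃[ y ] AE (λ q → app (app h q) ν ≡ y)
        slice-const {Γ} {h} {d} {ν} thin νd s =
          let (y , b) = thin (slice h ν) (ae-mono s λ q qκ (_ , _ , k) →
                          subst (_∈ app (app Γ ν) q) (sym (app-lam qκ)) (proj₂ (k ν νd)))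
          in y , ae-mono b λ q qκ e → trans (sym (app-lam qκ)) e

      opaque
        IsSeq-≡ : ∀ {Γ q b t d y} → IsSeq Γ q b t d → (∀ ν → ν ∈ d → app t ν ≡ app y ν) → t ≡ lam d (λ ν → app y ν)
        IsSeq-≡ {t = t} {d} {y} (_ , s , k) v = ext
          (λ u ut → let (ν , νd , e) = s u ut in
             subst (_∈ lam d (λ ν → app y ν)) (sym (trans e (cong (pair ν) (v ν νd)))) (lam-i νd))
          (λ u ul → let (ν , νd , e) = lam-e ul in
             subst (_∈ t) (sym (trans e (cong (pair ν) (sym (v ν νd))))) (proj₁ (k ν νd)))

      opaque
        -- The domain of a selected sequence is below g(q), hence a constant d < κ. Each of its d
        -- entries is constant because `Γ ν` is thin, and completeness combines these d statements
        -- into one.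
        seqs-thin : ∀ {Γ} → (∀ ν → ν ∈ κ → Thin (app Γ ν)) → Thin (seqs Γ)
        seqs-thin {Γ} thin h a =
          let (d , dκ , s) = seqs-domain a
              (y , hy) = choose d (λ ν y → AE (λ q → app (app h q) ν ≡ y))
                           λ ν νd → slice-const (thin ν (proj₁ oκ d dκ ν νd)) νd s
          in lam d (λ ν → app y ν) ,
             ae-mono₂ s (ae-all (small-∈κ dκ) (λ ν q → app (app h q) ν ≡ app y ν) hy) λ q _ → IsSeq-≡

    opaque
      -- A thin cover `Γ ν` is chosen for every `Φ ν`. The domain D(p) lies below g(q), so the
      -- sequence over p is among those collected by `seqs Γ` at q.
      hull-sequence : ∀ Φ → (∀ ν → ν ∈ κ → Hull (app Φ ν)) → Hull (sequence D Φ)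
      hull-sequence Φ hΦ =
        let (Γ , hΓ) = choose κ (λ ν G → Thin G × MW.AE (λ p → app (app Φ ν) p ∈ app G (base p))) hΦ
        in seqs Γ , seqs-thin (λ ν νκ → proj₁ (hΓ ν νκ)) ,
           MW.ae-mono₂ W-base-κ (MW.ae-and D-below (D-all (λ ν p → app (app Φ ν) p ∈ app (app Γ ν) (base p)) λ ν νκ → proj₂ (hΓ ν νκ)))
             λ p pκ bκ (Dg , ins) → subst (_∈ app (seqs Γ) (base p)) (sym (sequence-app pκ)) (seqs-i bκ (is-seq Γ p Dg ins))
        where
          is-seq : ∀ Γ p → app D p ∈ app g (base p) → (∀ ν → ν ∈ app D p → app (app Φ ν) p ∈ app (app Γ ν) (base p)) →
                   IsSeq Γ (base p) (app g (base p)) (lam (app D p) (λ ν → app (app Φ ν) p)) (app D p)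
          is-seq Γ p Dg ins = Dg ,
            (λ u ul → let (ν , νD , e) = lam-e ul in ν , νD , trans e (cong (pair ν) (sym (app-lam νD)))) ,
            λ ν νD → subst (λ y → pair ν y ∈ lam (app D p) (λ ν → app (app Φ ν) p)) (sym (app-lam νD)) (lam-i νD) ,
                     subst (_∈ app (app Γ ν) (base p)) (sym (app-lam νD)) (ins ν νD)

    opaque
      M-closed : ClosedUnder κ UM.M
      M-closed = UM.κ-closed {D} tt πD λ _ _ → tt

    opaque
      N-closed : ClosedUnder κ UN.M
      N-closed = UN.κ-closed {D} (hull-below D-below) (trans (πN≡πM D D-below) πD) hull-sequence

    -- The factor embedding k and the critical points

    opaque
      -- Any representative may be used: functions of the hull with the same collapse in N agree
      -- almost everywhere and so have the same collapse in M.
      k : V → V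
      k y with em {UN.M y}
      ... | yes (F , _) = UM.π F
      ... | no _        = ∅

      k-π : ∀ {F} → Hull F → k (UN.π F) ≡ UM.π F
      k-π {F} HF with em {UN.M (UN.π F)}
      ... | yes (F′ , HF′ , e) = sym (UM.π-cong F F′ (UN.π-inj F HF F′ HF′ e))
      ... | no n               = ⊥-elim (n (UN.M-π HF))

    private
      opaque
        map-k : ∀ {n} (Fs : Vec V n) → All Hull Fs → map k (map UN.π Fs) ≡ map UM.π Fs
        map-k []       []         = refl
        map-k (F ∷ Fs) (HF ∷ HFs) = cong₂ _∷_ (k-π HF) (map-k Fs HFs)

      opaque
        k-elementary : ∀ {n} (φ : Formula n) (ρ : Vec V n) → All UN.M ρ → Sat UN.M φ ρ ⇔ Sat UM.M φ (map k ρ)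
        k-elementary φ ρ Mρ =
          let (Fs , HFs , e) = UN.represent ρ Mρ
              q = trans (cong (map k) e) (map-k Fs HFs)
              a = UN.łoś φ Fs HFs
              b = UM.łoś φ Fs (all-univ Fs)
          in mk⇔ (λ s → subst (Sat UM.M φ) (sym q) (from b (to a (subst (Sat UN.M φ) e s))))
                 (λ s → subst (Sat UN.M φ) (sym e) (from a (to b (subst (Sat UM.M φ) q s))))

      -- The definition of `k` by cases on excluded middle is no formula; this is its graph on N in
      -- the language of sets.
      K : V → V → Set ℓ
      K x y = ∃[ F ] Hull F × x ≡ UN.π F × y ≡ UM.π F

      opaque
        def-K : Def₂ K
        def-K = auto

      opaque
        k⇔K : ∀ x y → UN.M x → (k x ≡ y) ⇔ K x y
        k⇔K x y (F , HF , e) = mk⇔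
          (λ q → F , HF , e , trans (sym q) (trans (cong k e) (k-π HF)))
          (λ (F′ , HF′ , e′ , q) → trans (cong k e′) (trans (k-π HF′) (sym q)))

    opaque
      k-embedding : ElementaryEmbedding UN.M UM.M k
      k-embedding = record
        { definable  = definable-on def-K k⇔K
        ; maps       = λ x (F , HF , e) → subst UM.M (sym (trans (cong k e) (k-π HF))) (UM.M-π tt)
        ; elementary = k-elementary
        }

    opaque
      η∈jκ : UM.π η ∈ UM.j κ
      η∈jκ = UM.π-mem tt (MW.ae-mono W-base-κ λ p pκ bκ → subst₂ _∈_ (sym (η-app pκ)) (sym (cst-app pκ)) (g-κ bκ))

    opaque
      κ∈η : κ ∈ UM.π η
      κ∈η = subst (_∈ UM.π η) πD (UM.π-mem tt (MW.ae-mono D-below λ p pκ → subst (app D p ∈_) (sym (η-app pκ))))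

    opaque
      j-critical : IsCriticalPoint UM.j κ
      j-critical = Ordinal⇐ oκ , UM.j-fixes , λ e → ∈-asym κ∈η (subst (UM.π η ∈_) e η∈jκ)

    opaque
      -- Below η the two collapses agree, so `k` is the identity there, whereas `k` sends i(κ) = η
      -- to j(κ), of which η is a member.
      k-critical : IsCriticalPoint k (UN.j κ)
      k-critical = Ordinal⇐ (UN.j-O oκ) ,
        (λ α h → let (z , (_ , _ , b) , e) = UM.π-e (subst (α ∈_) iκ≡η h)
                     c : MW.AE (λ p → app z p ∈ app g (base p))
                     c = MW.ae-mono b λ p pκ → subst (app z p ∈_) (η-app pκ)
                 in trans (cong k (trans e (sym (πN≡πM z c)))) (trans (k-π (hull-below c)) (sym e))) ,
        λ e → ∈-irrefl (subst (UM.π η ∈_) (trans (sym (k-π (hull-cst κ))) (trans e iκ≡η)) η∈jκ)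

    -- Covering the image of κ⁺

    private
      collapse : V → V → V
      collapse α F = lam κ (λ p → col (trace α (base p)) (app F p))

      opaque
        -- A selector of the sets b_α[g(q)] comes from a choice of indices below g(q), which is
        -- constant almost everywhere; so these sets form a thin function.
        hull-trace : ∀ {α F} → MW.AE (λ p → app F p ∈ trace α (base p)) → Hull F
        hull-trace {α} {F} a = G , thin , MW.ae-mono₂ W-base-κ a λ p _ bκ → subst (app F p ∈_) (sym (app-lam bκ))
          where
            G : V
            G = lam κ (λ q → trace α q)
            thin : Thin G
            thin h b =
              let (ξ , hξ) = choose-ξ (app enum α) (ae-mono b λ q qκ m → trace-e (subst (app h q ∈_) (app-lam qκ) m))
                  (y , c) = g-normal ξ (ae-mono hξ λ q _ → proj₁)
              in app (app enum α) y , ae-mono₂ hξ c λ q _ (_ , e) r → trans e (cong (app (app enum α)) r)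
              where
                choose-ξ : ∀ b → AE (λ q → ∃[ ξ ] ξ ∈ app g q × app h q ≡ app b ξ) →
                           ∃[ ξ ] AE (λ q → app ξ q ∈ app g q × app h q ≡ app b (app ξ q))
                choose-ξ b = ae-choose (λ q ξ → ξ ∈ app g q × app h q ≡ app b ξ)

      opaque
        -- Every fixed `y` in α is b_α(ξ) for some ξ < κ, and ξ is below g(q) almost everywhere;
        -- `thin-all` does the rest.
        in-trace : ∀ {α z} → α ∈ κ⁺ → Hull z → MW.AE (λ p → app z p ∈ α) → MW.AE (λ p → app z p ∈ trace α (base p))
        in-trace {α} {z} α⁺ (G , thin , a) b = MW.ae-mono₂
          (W-base (λ q → ∀ y → y ∈ app G q → y ∈ α → y ∈ trace α q)
            (thin-all thin (λ y q → y ∈ α → y ∈ trace α q) λ y →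
              by-cases (y ∈ α)
                (λ yα → let (ξ , ξκ , e) = enum-onto α⁺ y yα in
                  ae-mono (g-unbounded ξκ) λ q _ ξg _ _ → subst (_∈ trace α q) e (trace-i ξg))
                (λ n → ae-full λ q _ _ h → ⊥-elim (n h))))
          (MW.ae-and a b) λ p _ all (h , l) → all (app z p) h l

      opaque
        -- For functions with values in α, belonging to the hull amounts to taking values in
        -- b_α[g(q)] almost everywhere (`in-trace` and `hull-trace`). Dropping everything outside
        -- the hull therefore has the same effect as collapsing each F(p) along that set.
        π-collapse : ∀ {α} → α ∈ κ⁺ → ∀ F → MW.AE (λ p → app F p ⊆ α) → UN.π F ≡ UM.π (collapse α F)
        π-collapse {α} α⁺ = UN.ε-induction (λ F → MW.AE (λ p → app F p ⊆ α) → UN.π F ≡ UM.π (collapse α F)) λ F ih a → ext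
          (λ u h →
            let (z , zF@(Hz , _ , b) , e) = UN.π-e h
                zα = MW.ae-mono₂ a b λ p _ s m → s _ m
                zt = in-trace α⁺ Hz zα
            in subst (_∈ UM.π (collapse α F)) (sym (trans e (ih z zF (MW.ae-mono zα λ p _ → proj₁ oα _))))
                 (UM.π-mem tt (MW.ae-mono₂ b zt λ p pκ m t →
                   subst₂ _∈_ (sym (app-lam pκ)) (sym (app-lam pκ)) (col-i m t))))
          (λ u h →
            let (K , (_ , _ , b) , e) = UM.π-e h
                (z , hz) = MW.ae-choose (λ p v → v ∈ app F p × v ∈ trace α (base p) × app K p ≡ col (trace α (base p)) v)
                             (MW.ae-mono b λ p pκ m → col-e (subst (app K p ∈_) (app-lam pκ) m))
                (z′ , z′F , c) = UN.cut (hull-trace (MW.ae-mono hz λ p _ (_ , t , _) → t)) (MW.ae-mono hz λ p _ → proj₁)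
                z′α = MW.ae-mono₂ a (UN.ε-AE z′F) λ p _ s m → proj₁ oα _ (s _ m)
                q : UM.π (collapse α z′) ≡ UM.π K
                q = UM.π-cong _ K (MW.ae-mono₂ hz c λ p pκ (_ , _ , r) s →
                      trans (app-lam pκ) (trans (cong (col (trace α (base p))) s) (sym r)))
            in subst (_∈ UN.π F) (trans (ih z′ z′F z′α) (trans q (sym e))) (UN.π-i z′F))
          where
            oα : O α
            oα = O-elem κ⁺-O α⁺

      famF : V
      famF = lam κ (λ p → fam p)

    opaque
      i-covered : ∀ α → α ∈ κ⁺ → UN.j α ∈ UM.π famF
      i-covered α α⁺ = subst (_∈ UM.π famF)
        (sym (π-collapse α⁺ (cst α) (MW.ae-full λ p pκ z → subst (z ∈_) (cst-app pκ))))
        (UM.π-mem tt (MW.ae-mono (W-canonical α⁺) λ p pκ h → subst₂ _∈_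
          (trans (canonical-≡ α (base p)) (sym (trans (app-lam pκ) (cong (col (trace α (base p))) (cst-app pκ)))))
          (sym (app-lam pκ)) h))

    opaque
      -- The bound on the size of a below g(q) holds almost everywhere and is first-order, so Łoś's
      -- theorem carries it to M, where q ↦ g(q) becomes η = i(κ).
      famF-CardLess : Relative.CardLess UM.M (UM.π famF) (UN.j κ)
      famF-CardLess = subst (Relative.CardLess UM.M (UM.π famF)) (sym iκ≡η)
        (UM.reflect (p-CardLess zero (suc zero)) (famF ∷ η ∷ []) (tt ∷ tt ∷ [])
          (MW.ae-mono₂ W-base-κ W-fam λ p pκ bκ (β , βg , h) →
            subst₂ R.CardLess (sym (app-lam pκ)) (sym (η-app pκ)) (≼⇒CardLess (base-O bκ) βg h)))

    non-Galvin : NonGalvin κ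
    non-Galvin = record
      { M           = UM.M
      ; N           = UN.M
      ; j           = UM.j
      ; i           = UN.j
      ; k           = k
      ; M-inner     = UM.M-inner
      ; N-inner     = UN.M-inner
      ; j-embedding = UM.j-embedding
      ; i-embedding = UN.j-embedding
      ; k-embedding = k-embedding
      ; commutes    = λ x → k-π (hull-cst x)
      ; crit-j      = j-critical
      ; crit-k      = k-critical
      ; N-closed    = N-closed
      ; M-closed    = M-closed
      ; covering    = κ⁺ , κ⁺-successor , UM.π famF , UM.M-π tt , i-covered , famF-CardLess
      }

theorem5p7 : ∀ {ℓ} → ExcludedMiddle ℓ →
    (V : Set ℓ) (_∈_ : V → V → Set ℓ) →
    let open SetTheory V _∈_
        open Relative Univ using (Cardinal) in
    ZFC →
    ∀ κ → Cardinal κ → Uncountable κ → Regular κ → IsCompact κ → NonGalvin κ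
theorem5p7 em V _∈_ zfc κ card unc reg compact =
  Development.Compact.non-Galvin V _∈_ (em , zfc) κ (card , unc , reg , compact)
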